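{- Let $k, m, n$ be integers greater than $1$ such that $2^m \equiv 1 \pmod n$, and let $B(k,m,n)$ be the Bouwer graph defined in the context. Then $B(k,m,n)$ is arc-transitive if and only if $n = 3$, or $(k,n) = (2,5)$, or $(k,m,n) \in \{(2,3,7), (2,6,7), (2,6,21)\}$. Otherwise, $B(k,m,n)$ is half-arc-transitive. In particular, $B(k,m,n)$ is half-arc-transitive whenever $m > 6$ and $n > 5$.
   Context: For integers $k,m,n > 1$ with $2^m \equiv 1 \pmod n$ (so $n$ is odd and $2$ is a unit mod $n$, and $2^a$ mod $n$ is well defined for $a \in \mathbb{Z}_m$), the Bouwer graph $B(k,m,n)$ has vertex set $\mathbb{Z}_m \times (\mathbb{Z}_n)^{k-1}$; write a vertex as $(a,\mathbf{b})$ with $a \in \mathbb{Z}_m$, $\mathbf{b} \in (\mathbb{Z}_n)^{k-1}$. Let $\mathbf{e}_j$ ($1 \le j \le k-1$) denote the vector in $(\mathbb{Z}_n)^{k-1}$ with $j$th entry $1$ and all other entries $0$. Two vertices are adjacent if and only if they can be written as $(a,\mathbf{b})$ and $(a+1,\mathbf{c})$ where either $\mathbf{c} = \mathbf{b}$ or $\mathbf{c} = \mathbf{b} + 2^a \mathbf{e}_j$ for some $j \in \{1,\dots,k-1\}$. This is a simple $2k$-regular graph, and it is always vertex-transitive and edge-transitive. A graph is half-arc-transitive if it is vertex-transitive and edge-transitive but not arc-transitive. -}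

module Defs where

open import Data.Nat using (ℕ; zero; suc; _+_; _^_)
open import Data.Nat.DivMod using (_mod_)
open import Data.Fin using (Fin; toℕ)
open import Data.Vec using (Vec; lookup; _[_]≔_)
open import Data.Product using (Σ; _×_; _,_; ∃-syntax)
open import Data.Sum using (_⊎_)
open import Function.Bundles using (_⤖_; _⇔_; Bijection)
open import Relation.Binary.PropositionalEquality using (_≡_)
open import Relation.Nullary using (¬_)
open import Level using (0ℓ)

record Graph : Set₁ where
  field
    V   : Set
    Adj : V → V → Set
open Graph public

Aut : Graph → Set
Aut G = Σ (V G ⤖ V G) λ σ →
  ∀ u v → Adj G u v ⇔ Adj G (Bijection.to σ u) (Bijection.to σ v)

app : {G : Graph} → Aut G → V G → V G
app (σ , _) = Bijection.to σ

VertexTransitive : Graph → Set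
VertexTransitive G = ∀ (u v : V G) → ∃[ σ ] (app {G} σ u ≡ v)

EdgeTransitive : Graph → Set
EdgeTransitive G = ∀ (u v x y : V G) → Adj G u v → Adj G x y →
  ∃[ σ ] ((app {G} σ u ≡ x × app {G} σ v ≡ y) ⊎ (app {G} σ u ≡ y × app {G} σ v ≡ x))

ArcTransitive : Graph → Set
ArcTransitive G = ∀ (u v x y : V G) → Adj G u v → Adj G x y →
  ∃[ σ ] (app {G} σ u ≡ x × app {G} σ v ≡ y)

HalfArcTransitive : Graph → Set
HalfArcTransitive G = VertexTransitive G × EdgeTransitive G × ¬ ArcTransitive G

-- x + t in Z_n (n ≥ 1 necessarily, since Fin n is inhabited)
addF : ∀ {n} → Fin n → ℕ → Fin n
addF {suc n} x t = (toℕ x + t) mod (suc n)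

-- vertices (a , b) with a ∈ Z_m, b ∈ (Z_n)^(k-1); here kminus1 = k - 1
BVertex : (kminus1 m n : ℕ) → Set
BVertex kminus1 m n = Fin m × Vec (Fin n) kminus1

BStep : ∀ {kminus1 m n} → BVertex kminus1 m n → BVertex kminus1 m n → Set
BStep {kminus1} (a , b) (a′ , c) =
  a′ ≡ addF a 1 ×
  (c ≡ b ⊎ ∃[ j ] (c ≡ b [ j ]≔ addF (lookup b j) (2 ^ toℕ a)))

BAdj : ∀ {kminus1 m n} → BVertex kminus1 m n → BVertex kminus1 m n → Set
BAdj u v = BStep u v ⊎ BStep v u

Bouwer : (k m n : ℕ) → Graph
Bouwer k m n = record { V = BVertex (Data.Nat._∸_ k 1) m n ; Adj = BAdj }

{-# OPTIONS --safe #-}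
module Submission where

-- Give every vertex (a , b) an extra coordinate 2ᵃ − Σ b.  Then the k out-neighbours of a vertex
-- at level a are obtained by adding 2ᵃ to one of its k coordinates, so all k labels of edges play
-- the same role, and a walk closes up iff its level change is 0 mod m and, for every label, the
-- signed weights 2ᵃ of the edges with this label add up to 0 mod n.  Translations, the shift
-- (a , b) ↦ (a + 1 , 2b) and the exchange of two coordinates generate a group which is transitive
-- on directed edges; hence the graph is vertex- and edge-transitive, and it is arc-transitive iff
-- some automorphism reverses an edge.
--
-- In the exceptional cases such an automorphism is written down.  In all other cases an invariant
-- of arcs that refers only to closed non-backtracking walks of length 6 ("hexagons") distinguishes
-- forward from backward arcs.  For all parameters there are the hexagons +i +j −i −j +i −j, where
-- ±i is a forward or backward step along an edge of label i; they have the shape ++−−+−, whose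
-- mirror image ++−+−− does not occur for generic n.  To make this intrinsic one must recognise the
-- corners (+i , +j) with i ≠ j by the number of third steps that extend them inside a hexagon.
-- For n = 5 both shapes occur, and the 3-paths (+i , +i , +j) and (+i , +j , +j) are compared instead.
-- Since every label of a hexagon occurs at least twice, there are finitely many hexagons up to
-- renaming of labels, whatever k is; they are enumerated by evaluation.

-- Read backwards, ++--+- becomes a rotation of itself. So its cycle of corners straight, turn,
-- straight, turn, turn, turn has a sense: a reading in either direction that begins with straight,
-- turn, straight, turn begins with a forward step. The special parameters stem from coincidences
-- among powers of 2. Since 1 + 2 = 3, 1 + 4 = 5, 1 + 2 + 4 = 7, 1 + 8 = 9, 1 + 4 + 16 = 21 and 1 +
-- 2 + 4 + 8 + 16 + 32 = 63, label sums can vanish modulo n that do not vanish in the integers; and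
-- for m = 4 or m dividing 6, walks with a nonzero level change can close up. The additional
-- hexagons shift the numbers of extensions, so the threshold of the count depends on the case. For
-- k = 2 and n = 7 or 21 with small m, straight corners can catch up with turns; from k = 3 on, a
-- third label gives every turn one more extension. As m and n are unbounded, evaluation cannot
-- decide divisibility by them. One-sided tests suffice: accepting too much is harmless when
-- hexagons are excluded, accepting too little when they are exhibited.

open import Defs
open import Data.Bool.Base using (Bool; true; false; if_then_else_; not; _∧_; _xor_)
import Data.Bool.Properties as Bool
open import Data.Empty using (⊥; ⊥-elim)
open import Data.Fin.Base using (Fin; zero; suc; toℕ)
open import Data.Fin.Patterns
import Data.Fin.Properties as Fin
open import Data.List.Base using (List; []; _∷_; _++_; length; allFin; upTo; cartesianProductWith)
open import Data.List.Membership.Propositional using (_∈_; _∉_)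
open import Data.List.Membership.Propositional.Properties using (∈-allFin; ∈-upTo⁺; ∈-cartesianProductWith⁻)
import Data.List.Membership.DecPropositional as DecMembership
import Data.List.Properties as List
import Data.List.Relation.Unary.All as All
open import Data.List.Relation.Unary.Any using (here; there)
open import Data.Nat.Base
open import Data.Nat.Divisibility
open import Data.Nat.DivMod
open import Data.Nat.Properties
open import Data.Nat.Tactic.RingSolver using (solve-∀)
open import Data.Product.Base using (_×_; _,_; proj₁; proj₂; ∃-syntax; map₂)
open import Data.Product.Properties using (≡-dec)
open import Data.Sum.Base using (_⊎_; inj₁; inj₂)
open import Data.Vec.Base as Vec using (Vec; []; _∷_; lookup; _[_]≔_)
import Data.Vec.Properties as Vec
open import Data.Vec.Relation.Unary.All using ([]; _∷_)
open import Data.Vec.Relation.Unary.Unique.Propositional using (Unique; []; _∷_)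
open import Data.Vec.Relation.Unary.Unique.Propositional.Properties using (lookup-injective)
open import Function.Base using (_∘_; id)
open import Function.Bundles using (_⇔_; Bijection; Equivalence; mk⇔; mk⤖; mk↔ₛ′)
open import Function.Definitions using (Injective)
open import Function.Properties.Inverse using (↔⇒⤖)
open import Relation.Binary.Bundles using (Setoid)
open import Relation.Binary.Definitions using (DecidableEquality)
open import Relation.Binary.PropositionalEquality
import Relation.Binary.Reasoning.Setoid as SetoidReasoning
open import Relation.Nullary using (¬_; Dec; yes; no; does)
open import Relation.Nullary.Decidable using (True; toWitness; dec-true; dec-false; ¬?; _×-dec_; _⊎-dec_; _→-dec_)

-- Congruence modulo n

module Mod (n′ : ℕ) where

  infix 4 _≈_
  -- A record rather than the bare equation of remainders, so that `x` and `y` can be inferred from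
  -- the type; unification cannot recover them from `x % suc n′`.
  record _≈_ (x y : ℕ) : Set where
    constructor mk≈
    field %-≡ : x % suc n′ ≡ y % suc n′
  open _≈_ public

  ≈-refl : ∀ {x} → x ≈ x
  ≈-refl = mk≈ refl

  ≈-sym : ∀ {x y} → x ≈ y → y ≈ x
  ≈-sym (mk≈ e) = mk≈ (sym e)

  ≈-trans : ∀ {x y z} → x ≈ y → y ≈ z → x ≈ z
  ≈-trans (mk≈ e) (mk≈ f) = mk≈ (trans e f)

  ≡⇒≈ : ∀ {x y} → x ≡ y → x ≈ y
  ≡⇒≈ refl = ≈-refl

  ≈-setoid : Setoid _ _
  ≈-setoid = record { Carrier = ℕ ; _≈_ = _≈_ ; isEquivalence = record { refl = ≈-refl ; sym = ≈-sym ; trans = ≈-trans } }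

  module ≈-Reasoning = SetoidReasoning ≈-setoid

  +-cong : ∀ {x y u v} → x ≈ y → u ≈ v → x + u ≈ y + v
  +-cong {x} {y} {u} {v} (mk≈ e) (mk≈ f) = mk≈ (begin
    (x + u) % suc n′                      ≡⟨ %-distribˡ-+ x u (suc n′) ⟩
    (x % suc n′ + u % suc n′) % suc n′    ≡⟨ cong₂ (λ a b → (a + b) % suc n′) e f ⟩
    (y % suc n′ + v % suc n′) % suc n′    ≡⟨ %-distribˡ-+ y v (suc n′) ⟨
    (y + v) % suc n′                      ∎)
    where open ≡-Reasoning

  *-cong : ∀ {x y u v} → x ≈ y → u ≈ v → x * u ≈ y * v
  *-cong {x} {y} {u} {v} (mk≈ e) (mk≈ f) = mk≈ (begin
    (x * u) % suc n′                      ≡⟨ %-distribˡ-* x u (suc n′) ⟩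
    (x % suc n′ * (u % suc n′)) % suc n′  ≡⟨ cong₂ (λ a b → (a * b) % suc n′) e f ⟩
    (y % suc n′ * (v % suc n′)) % suc n′  ≡⟨ %-distribˡ-* y v (suc n′) ⟨
    (y * v) % suc n′                      ∎)
    where open ≡-Reasoning

  +-congˡ : ∀ x {u v} → u ≈ v → x + u ≈ x + v
  +-congˡ x = +-cong (≈-refl {x})

  +-congʳ : ∀ x {u v} → u ≈ v → u + x ≈ v + x
  +-congʳ x e = +-cong e (≈-refl {x})

  *-congˡ : ∀ x {u v} → u ≈ v → x * u ≈ x * v
  *-congˡ x = *-cong (≈-refl {x})

  *-congʳ : ∀ x {u v} → u ≈ v → u * x ≈ v * x
  *-congʳ x e = *-cong e (≈-refl {x})

  x+kn≈x : ∀ x k → x + k * suc n′ ≈ x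
  x+kn≈x x k = mk≈ ([m+kn]%n≡m%n x k (suc n′))

  x+n′y+y≈x : ∀ x y → x + n′ * y + y ≈ x
  x+n′y+y≈x x y = ≈-trans (≡⇒≈ (lemma x y n′)) (x+kn≈x x y)
    where
    lemma : ∀ x y n → x + n * y + y ≡ x + y * suc n
    lemma = solve-∀

  +-cancelʳ : ∀ z {x y} → x + z ≈ y + z → x ≈ y
  +-cancelʳ z {x} {y} e = begin
    x                    ≈⟨ x+n′y+y≈x x z ⟨
    x + n′ * z + z       ≡⟨ lemma x (n′ * z) z ⟩
    x + z + n′ * z       ≈⟨ +-congʳ (n′ * z) e ⟩
    y + z + n′ * z       ≡⟨ lemma y (n′ * z) z ⟨
    y + n′ * z + z       ≈⟨ x+n′y+y≈x y z ⟩
    y                    ∎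
    where
    open ≈-Reasoning
    lemma : ∀ x a z → x + a + z ≡ x + z + a
    lemma = solve-∀

  +-cancelˡ : ∀ z {x y} → z + x ≈ z + y → x ≈ y
  +-cancelˡ z {x} {y} e = +-cancelʳ z (≈-trans (≡⇒≈ (+-comm x z)) (≈-trans e (≡⇒≈ (+-comm z y))))

  ≈⇒∣ : ∀ {x y} → x ≈ y → suc n′ ∣ ∣ x - y ∣
  ≈⇒∣ {x} {y} (mk≈ e) = divides ∣ x / suc n′ - y / suc n′ ∣ (begin
    ∣ x - y ∣                                                        ≡⟨ cong₂ ∣_-_∣ (m≡m%n+[m/n]*n x (suc n′)) (m≡m%n+[m/n]*n y (suc n′)) ⟩
    ∣ x % suc n′ + x / suc n′ * suc n′ - y % suc n′ + y / suc n′ * suc n′ ∣ ≡⟨ cong (λ r → ∣ r + x / suc n′ * suc n′ - y % suc n′ + y / suc n′ * suc n′ ∣) e ⟩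
    ∣ y % suc n′ + x / suc n′ * suc n′ - y % suc n′ + y / suc n′ * suc n′ ∣ ≡⟨ ∣m+n-m+o∣≡∣n-o∣ (y % suc n′) _ _ ⟩
    ∣ x / suc n′ * suc n′ - y / suc n′ * suc n′ ∣                    ≡⟨ *-distribʳ-∣-∣ (suc n′) (x / suc n′) (y / suc n′) ⟨
    ∣ x / suc n′ - y / suc n′ ∣ * suc n′                             ∎)
    where open ≡-Reasoning

  ∣∸⇒≈ : ∀ {x y} → x ≤ y → suc n′ ∣ y ∸ x → y ≈ x
  ∣∸⇒≈ {x} {y} x≤y (divides q e) =
    ≈-trans (≡⇒≈ (trans (sym (m+[n∸m]≡n x≤y)) (cong (x +_) e))) (x+kn≈x x q)

  ∣⇒≈ : ∀ {x y} → suc n′ ∣ ∣ x - y ∣ → x ≈ y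
  ∣⇒≈ {x} {y} d with ≤-total x y
  ... | inj₁ x≤y = ≈-sym (∣∸⇒≈ x≤y (subst (suc n′ ∣_) (m≤n⇒∣m-n∣≡n∸m x≤y) d))
  ... | inj₂ y≤x = ∣∸⇒≈ y≤x (subst (suc n′ ∣_) (m≤n⇒∣n-m∣≡n∸m y≤x) d)

  x+n≈x : ∀ x → x + suc n′ ≈ x
  x+n≈x x = subst (λ k → x + k ≈ x) (+-identityʳ (suc n′)) (x+kn≈x x 1)

  ∣⇒≈0 : ∀ {x} → suc n′ ∣ x → x ≈ 0
  ∣⇒≈0 (divides q refl) = x+kn≈x 0 q

  toℕ-mod : ∀ x → toℕ (x mod suc n′) ≈ x
  toℕ-mod x = mk≈ (trans (cong (_% suc n′) (Fin.toℕ-fromℕ< (m%n<n x (suc n′)))) (m%n%n≡m%n x (suc n′)))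

  toℕ-addF : ∀ (x : Fin (suc n′)) t → toℕ (addF x t) ≈ toℕ x + t
  toℕ-addF x t = toℕ-mod (toℕ x + t)

  toℕ-injective-≈ : ∀ {x y : Fin (suc n′)} → toℕ x ≈ toℕ y → x ≡ y
  toℕ-injective-≈ {x} {y} (mk≈ e) = Fin.toℕ-injective
    (trans (sym (m<n⇒m%n≡m (Fin.toℕ<n x))) (trans e (m<n⇒m%n≡m (Fin.toℕ<n y))))

-- Automorphisms of a graph

module _ {G : Graph} where

  mkAut : (f g : V G → V G) → (∀ v → f (g v) ≡ v) → (∀ v → g (f v) ≡ v) →
          (∀ u v → Adj G u v → Adj G (f u) (f v)) →
          (∀ u v → Adj G u v → Adj G (g u) (g v)) → Aut G
  mkAut f g fg gf f-adj g-adj =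
    ↔⇒⤖ (mk↔ₛ′ f g fg gf) ,
    λ u v → mk⇔ (f-adj u v) (λ a → subst₂ (Adj G) (gf u) (gf v) (g-adj (f u) (f v) a))

  app-injective : (σ : Aut G) → ∀ {u v} → app {G} σ u ≡ app {G} σ v → u ≡ v
  app-injective (σ , _) = Bijection.injective σ

  app-adj : (σ : Aut G) → ∀ u v → Adj G u v → Adj G (app {G} σ u) (app {G} σ v)
  app-adj (_ , h) u v = Equivalence.to (h u v)

  app-adj⁻ : (σ : Aut G) → ∀ u v → Adj G (app {G} σ u) (app {G} σ v) → Adj G u v
  app-adj⁻ (_ , h) u v = Equivalence.from (h u v)

  app-surjective : (σ : Aut G) → ∀ v → ∃[ u ] app {G} σ u ≡ v
  app-surjective (σ , _) v = Bijection.to⁻ σ v , proj₂ (Bijection.strictlySurjective σ v)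

  infixr 9 _∘ᴬ_
  _∘ᴬ_ : Aut G → Aut G → Aut G
  σ ∘ᴬ τ = (mk⤖ ((λ e → app-injective τ (app-injective σ e)) , surj)) ,
           λ u v → mk⇔ (app-adj σ _ _ ∘ app-adj τ u v) (app-adj⁻ τ u v ∘ app-adj⁻ σ _ _)
    where
    surj : ∀ w → ∃[ u ] ∀ {z} → z ≡ u → app {G} σ (app {G} τ z) ≡ w
    surj w = let v , e = app-surjective σ w ; u , e′ = app-surjective τ v in
      u , λ { refl → trans (cong (app {G} σ) e′) e }

-- Label-symmetric coordinates; transitivity on forward arcs

sumᵛ : ∀ {n k} → Vec (Fin n) k → ℕ
sumᵛ []      = 0
sumᵛ (x ∷ b) = toℕ x + sumᵛ b

sumᵛ-update : ∀ {n k} (b : Vec (Fin n) k) j c → sumᵛ (b [ j ]≔ c) + toℕ (lookup b j) ≡ sumᵛ b + toℕ c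
sumᵛ-update (x ∷ b) zero    c = lemma (toℕ c) (sumᵛ b) (toℕ x)
  where
  lemma : ∀ c s x → c + s + x ≡ x + s + c
  lemma = solve-∀
sumᵛ-update (x ∷ b) (suc j) c = begin
  toℕ x + sumᵛ (b [ j ]≔ c) + toℕ (lookup b j)   ≡⟨ +-assoc (toℕ x) _ _ ⟩
  toℕ x + (sumᵛ (b [ j ]≔ c) + toℕ (lookup b j)) ≡⟨ cong (toℕ x +_) (sumᵛ-update b j c) ⟩
  toℕ x + (sumᵛ b + toℕ c)                       ≡⟨ +-assoc (toℕ x) _ _ ⟨
  toℕ x + sumᵛ b + toℕ c                         ∎
  where open ≡-Reasoning

lookup-extensional : ∀ {a} {A : Set a} {k} {b c : Vec A k} → (∀ j → lookup b j ≡ lookup c j) → b ≡ c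
lookup-extensional {b = b} {c} e = trans (sym (Vec.tabulate∘lookup b)) (trans (Vec.tabulate-cong e) (Vec.tabulate∘lookup c))

module Model (k′ m′ n′ : ℕ) (n∣ : suc n′ ∣ 2 ^ suc m′ ∸ 1) where

  module M = Mod m′
  open Mod n′ public
  open ≈-Reasoning

  k m n : ℕ
  k = suc k′
  m = suc m′
  n = suc n′

  B : Graph
  B = Bouwer k m n

  Vertex : Set
  Vertex = BVertex k′ m n

  Label : Set
  Label = Fin k

  2^m≈1 : 2 ^ m ≈ 1
  2^m≈1 = ∣⇒≈ (subst (n ∣_) (sym (m≤n⇒∣n-m∣≡n∸m (m^n>0 2 m))) n∣)

  [2^m]^q≈1 : ∀ q → 2 ^ (q * m) ≈ 1
  [2^m]^q≈1 zero    = ≈-refl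
  [2^m]^q≈1 (suc q) = begin
    2 ^ (m + q * m)     ≡⟨ ^-distribˡ-+-* 2 m (q * m) ⟩
    2 ^ m * 2 ^ (q * m) ≈⟨ *-cong 2^m≈1 ([2^m]^q≈1 q) ⟩
    1                   ∎

  2^-cong : ∀ {x y} → x M.≈ y → 2 ^ x ≈ 2 ^ y
  2^-cong {x} {y} (M.mk≈ e) = begin
    2 ^ x       ≈⟨ reduce x ⟩
    2 ^ (x % m) ≡⟨ cong (2 ^_) e ⟩
    2 ^ (y % m) ≈⟨ reduce y ⟨
    2 ^ y       ∎
    where
    reduce : ∀ x → 2 ^ x ≈ 2 ^ (x % m)
    reduce x = begin
      2 ^ x                           ≡⟨ cong (2 ^_) (m≡m%n+[m/n]*n x m) ⟩
      2 ^ (x % m + x / m * m)         ≡⟨ ^-distribˡ-+-* 2 (x % m) (x / m * m) ⟩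
      2 ^ (x % m) * 2 ^ (x / m * m)   ≈⟨ *-congˡ (2 ^ (x % m)) ([2^m]^q≈1 (x / m)) ⟩
      2 ^ (x % m) * 1                 ≡⟨ *-identityʳ _ ⟩
      2 ^ (x % m)                     ∎

  2*-cancel : ∀ {x y} → 2 * x ≈ 2 * y → x ≈ y
  2*-cancel {x} {y} e = begin
    x                ≈⟨ halve x ⟨
    2 ^ m′ * (2 * x) ≈⟨ *-congˡ (2 ^ m′) e ⟩
    2 ^ m′ * (2 * y) ≈⟨ halve y ⟩
    y                ∎
    where
    lemma : ∀ h x → h * (2 * x) ≡ 2 * h * x
    lemma = solve-∀
    halve : ∀ x → 2 ^ m′ * (2 * x) ≈ x
    halve x = begin
      2 ^ m′ * (2 * x) ≡⟨ lemma (2 ^ m′) x ⟩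
      2 ^ m * x        ≈⟨ *-congʳ x 2^m≈1 ⟩
      1 * x            ≡⟨ *-identityˡ x ⟩
      x                ∎

  2^*-cancel : ∀ t {x y} → 2 ^ t * x ≈ 2 ^ t * y → x ≈ y
  2^*-cancel zero    {x} {y} e = subst₂ _≈_ (*-identityˡ x) (*-identityˡ y) e
  2^*-cancel (suc t) {x} {y} e =
    2^*-cancel t (2*-cancel (subst₂ _≈_ (*-assoc 2 (2 ^ t) x) (*-assoc 2 (2 ^ t) y) e))

  level : Vertex → ℕ
  level (a , _) = toℕ a

  weight : Vertex → ℕ
  weight v = 2 ^ level v

  -- Here and below n′ = n − 1 stands for −1 modulo n.
  coord : Vertex → Label → ℕ
  coord (a , b) zero    = 2 ^ toℕ a + n′ * sumᵛ b
  coord (a , b) (suc j) = toℕ (lookup b j)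

  up : Label → Vertex → Vertex
  up zero    (a , b) = addF a 1 , b
  up (suc j) (a , b) = addF a 1 , b [ j ]≔ addF (lookup b j) (2 ^ toℕ a)

  dn : Label → Vertex → Vertex
  dn zero    (a , b) = addF a m′ , b
  dn (suc j) (a , b) = addF a m′ , b [ j ]≔ addF (lookup b j) (n′ * 2 ^ toℕ (addF a m′))

  -- All `k` coordinates of a vertex add up to 2ᵃ modulo `n`, so the level and the coordinates
  -- `suc j` determine coordinate `zero`.
  coord-extensional : ∀ {u v} → level u ≡ level v → (∀ j → coord u (suc j) ≈ coord v (suc j)) → u ≡ v
  coord-extensional {a , b} {a′ , c} la e =
    cong₂ _,_ (Fin.toℕ-injective la) (lookup-extensional (λ j → toℕ-injective-≈ (e j)))

  level-up : ∀ p v → level (up p v) M.≈ suc (level v)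
  level-up zero    (a , b) = M.≈-trans (M.toℕ-addF a 1) (M.≡⇒≈ (+-comm (toℕ a) 1))
  level-up (suc j) (a , b) = M.≈-trans (M.toℕ-addF a 1) (M.≡⇒≈ (+-comm (toℕ a) 1))

  level-up-cong : ∀ p q {u v} → level u ≡ level v → level (up p u) ≡ level (up q v)
  level-up-cong zero    zero    e = cong toℕ (cong (λ a → addF a 1) (Fin.toℕ-injective e))
  level-up-cong zero    (suc _) e = cong toℕ (cong (λ a → addF a 1) (Fin.toℕ-injective e))
  level-up-cong (suc _) zero    e = cong toℕ (cong (λ a → addF a 1) (Fin.toℕ-injective e))
  level-up-cong (suc _) (suc _) e = cong toℕ (cong (λ a → addF a 1) (Fin.toℕ-injective e))

  weight-up : ∀ p v → weight (up p v) ≈ 2 * weight v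
  weight-up p v = 2^-cong (level-up p v)

  coord-up-same : ∀ p v → coord (up p v) p ≈ coord v p + weight v
  coord-up-same zero (a , b) = begin
    2 ^ toℕ (addF a 1) + n′ * sumᵛ b    ≈⟨ +-congʳ (n′ * sumᵛ b) (weight-up zero (a , b)) ⟩
    2 * 2 ^ toℕ a + n′ * sumᵛ b         ≡⟨ lemma (2 ^ toℕ a) (n′ * sumᵛ b) ⟩
    2 ^ toℕ a + n′ * sumᵛ b + 2 ^ toℕ a ∎
    where
    lemma : ∀ w s → 2 * w + s ≡ w + s + w
    lemma = solve-∀
  coord-up-same (suc j) (a , b) = begin
    toℕ (lookup (b [ j ]≔ addF (lookup b j) (2 ^ toℕ a)) j) ≡⟨ cong toℕ (Vec.lookup∘update j b _) ⟩
    toℕ (addF (lookup b j) (2 ^ toℕ a))                     ≈⟨ toℕ-addF (lookup b j) _ ⟩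
    toℕ (lookup b j) + 2 ^ toℕ a                            ∎

  coord-up-other : ∀ p q v → p ≢ q → coord (up p v) q ≈ coord v q
  coord-up-other zero    zero    v ne = ⊥-elim (ne refl)
  coord-up-other zero    (suc i) v ne = ≈-refl
  -- Here 2ᵃ is doubled while Σ b grows by 2ᵃ, so their difference stays. The old entry `x` is
  -- carried along with factor -1 because `sumᵛ-update` is stated without subtraction.
  coord-up-other (suc j) zero (a , b) ne = +-cancelʳ (n′ * toℕ (lookup b j)) (begin
    2 ^ toℕ (addF a 1) + n′ * sumᵛ (b [ j ]≔ c) + n′ * x  ≡⟨ lemma₁ (2 ^ toℕ (addF a 1)) n′ (sumᵛ (b [ j ]≔ c)) x ⟩
    2 ^ toℕ (addF a 1) + n′ * (sumᵛ (b [ j ]≔ c) + x)     ≡⟨ cong (λ s → 2 ^ toℕ (addF a 1) + n′ * s) (sumᵛ-update b j c) ⟩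
    2 ^ toℕ (addF a 1) + n′ * (sumᵛ b + toℕ c)            ≈⟨ +-cong (weight-up zero (a , b)) (*-congˡ n′ (+-congˡ (sumᵛ b) (toℕ-addF (lookup b j) w))) ⟩
    2 * w + n′ * (sumᵛ b + (x + w))                       ≡⟨ lemma₂ w n′ (sumᵛ b) x ⟩
    w + n′ * sumᵛ b + n′ * x + n′ * w + w                 ≈⟨ x+n′y+y≈x (w + n′ * sumᵛ b + n′ * x) w ⟩
    w + n′ * sumᵛ b + n′ * x                              ∎)
    where
    w = 2 ^ toℕ a
    x = toℕ (lookup b j)
    c = addF (lookup b j) w
    lemma₁ : ∀ w n s x → w + n * s + n * x ≡ w + n * (s + x)
    lemma₁ = solve-∀
    lemma₂ : ∀ w n s x → 2 * w + n * (s + (x + w)) ≡ w + n * s + n * x + n * w + w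
    lemma₂ = solve-∀
  coord-up-other (suc j) (suc i) (a , b) ne =
    ≡⇒≈ (cong toℕ (Vec.lookup∘update′ (λ e → ne (cong suc (sym e))) b _))

  up-dn : ∀ p v → up p (dn p v) ≡ v
  up-dn p v = coord-extensional (level-up-dn p v) (coord-up-dn p v)
    where
    level-up-dn : ∀ p v → level (up p (dn p v)) ≡ level v
    level-up-dn p v@(a , b) = cong toℕ {x = proj₁ (up p (dn p v))} (M.toℕ-injective-≈ (M.≈-trans (level-up p (dn p v)) (lemma p)))
      where
      lemma : ∀ p → suc (level (dn p v)) M.≈ toℕ a
      lemma zero    = M.≈-trans (M.+-congˡ 1 (M.toℕ-addF a m′))
        (M.≈-trans (M.≡⇒≈ (sym (+-suc (toℕ a) m′))) (M.x+n≈x (toℕ a)))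
      lemma (suc j) = lemma zero
    coord-up-dn : ∀ p v j → coord (up p (dn p v)) (suc j) ≈ coord v (suc j)
    coord-up-dn zero    (a , b) i = ≈-refl
    coord-up-dn (suc j) v@(a , b) i with j Fin.≟ i
    ... | yes refl = begin
      coord (up (suc j) (dn (suc j) v)) (suc j)                  ≈⟨ coord-up-same (suc j) (dn (suc j) v) ⟩
      toℕ (lookup (b [ j ]≔ addF (lookup b j) (n′ * w)) j) + w   ≡⟨ cong (λ x → toℕ x + w) (Vec.lookup∘update j b _) ⟩
      toℕ (addF (lookup b j) (n′ * w)) + w                       ≈⟨ +-congʳ w (toℕ-addF (lookup b j) (n′ * w)) ⟩
      toℕ (lookup b j) + n′ * w + w                              ≈⟨ x+n′y+y≈x (toℕ (lookup b j)) w ⟩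
      toℕ (lookup b j)                                           ∎
      where w = 2 ^ toℕ (addF a m′)
    ... | no ne = ≈-trans (coord-up-other (suc j) (suc i) (dn (suc j) v) (ne ∘ Fin.suc-injective))
                    (≡⇒≈ (cong toℕ (Vec.lookup∘update′ (ne ∘ sym) b _)))

  up-injective : ∀ p {u v} → up p u ≡ up p v → u ≡ v
  up-injective p {u@(a , b)} {v@(a′ , c)} e = coord-extensional level-≡ coord-≈
    where
    level-≡ : level u ≡ level v
    level-≡ = cong toℕ {x = a} (M.toℕ-injective-≈ (M.+-cancelˡ 1
      (M.≈-trans (M.≈-sym (level-up p u)) (M.≈-trans (M.≡⇒≈ (cong level e)) (level-up p v)))))
    coord-≈ : ∀ i → coord u (suc i) ≈ coord v (suc i)
    coord-≈ i with p Fin.≟ suc i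
    ... | yes refl = +-cancelʳ (weight u) (begin
      coord u p + weight u ≈⟨ coord-up-same p u ⟨
      coord (up p u) p     ≡⟨ cong (λ w → coord w p) e ⟩
      coord (up p v) p     ≈⟨ coord-up-same p v ⟩
      coord v p + weight v ≡⟨ cong (λ l → coord v p + 2 ^ l) level-≡ ⟨
      coord v p + weight u ∎)
    ... | no ne = begin
      coord u (suc i)        ≈⟨ coord-up-other p (suc i) u ne ⟨
      coord (up p u) (suc i) ≡⟨ cong (λ w → coord w (suc i)) e ⟩
      coord (up p v) (suc i) ≈⟨ coord-up-other p (suc i) v ne ⟩
      coord v (suc i)        ∎

  dn-up : ∀ p v → dn p (up p v) ≡ v
  dn-up p v = up-injective p (up-dn p (up p v))

  up-step : ∀ p v → BStep v (up p v)
  up-step zero    (a , b) = refl , inj₁ refl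
  up-step (suc j) (a , b) = refl , inj₂ (j , refl)

  step-up : ∀ u v → BStep u v → ∃[ p ] v ≡ up p u
  step-up (a , b) _ (refl , inj₁ refl)       = zero , refl
  step-up (a , b) _ (refl , inj₂ (j , refl)) = suc j , refl

  permuting-adj : (f : Vertex → Vertex) → (∀ p v → ∃[ q ] f (up p v) ≡ up q (f v)) →
                  ∀ u v → BAdj u v → BAdj (f u) (f v)
  permuting-adj f h u v (inj₁ s) with step-up u v s
  ... | p , refl = inj₁ (subst (BStep (f u)) (sym (proj₂ (h p u))) (up-step (proj₁ (h p u)) (f u)))
  permuting-adj f h u v (inj₂ s) with step-up v u s
  ... | p , refl = inj₂ (subst (BStep (f v)) (sym (proj₂ (h p v))) (up-step (proj₁ (h p v)) (f v)))

  -- Commuting with every `up p` gives adjacency for free and determines the image of an edge from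
  -- the image of its tail, so transitivity on vertices already moves edges of a fixed label.
  record LabelPreserving : Set where
    field
      to from : Vertex → Vertex
      to-from : ∀ v → to (from v) ≡ v
      from-to : ∀ v → from (to v) ≡ v
      to-up   : ∀ p v → to (up p v) ≡ up p (to v)

    from-up : ∀ p v → from (up p v) ≡ up p (from v)
    from-up p v = trans (cong (from ∘ up p) (sym (to-from v))) (trans (cong from (sym (to-up p (from v)))) (from-to _))

    aut : Aut B
    aut = mkAut to from to-from from-to (permuting-adj to (λ p v → p , to-up p v)) (permuting-adj from (λ p v → p , from-up p v))
  open LabelPreserving

  inverseᴸ : LabelPreserving → LabelPreserving
  inverseᴸ σ = record { to = from σ ; from = to σ ; to-from = from-to σ ; from-to = to-from σ ; to-up = from-up σ }

  infixr 9 _∘ᴸ_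
  _∘ᴸ_ : LabelPreserving → LabelPreserving → LabelPreserving
  σ ∘ᴸ τ = record
    { to      = to σ ∘ to τ
    ; from    = from τ ∘ from σ
    ; to-from = λ v → trans (cong (to σ) (to-from τ (from σ v))) (to-from σ v)
    ; from-to = λ v → trans (cong (from τ) (from-to σ (to τ v))) (from-to τ v)
    ; to-up   = λ p v → trans (cong (to σ) (to-up τ p v)) (to-up σ p (to τ v))
    }

  idᴸ : LabelPreserving
  idᴸ = record { to = id ; from = id ; to-from = λ _ → refl ; from-to = λ _ → refl ; to-up = λ _ _ → refl }

  -- An affine map x ↦ c x + d of the coordinates respects `up p` once it scales the weights by the
  -- same c, as the increment of coordinate p is the weight. Translations have c = 1, the shift has
  -- c = 2 and d = 0.
  up-map : (f : Vertex → Vertex) (c : ℕ) → (∀ p v → level (f (up p v)) ≡ level (up p (f v))) →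
           (∀ v → weight (f v) ≈ c * weight v) →
           (d : Fin k′ → ℕ) → (∀ v j → coord (f v) (suc j) ≈ c * coord v (suc j) + d j) →
           ∀ p v → f (up p v) ≡ up p (f v)
  up-map f c f-level f-weight d f-coord p v = coord-extensional (f-level p v) coords
    where
    lemma : ∀ c x w d → c * (x + w) + d ≡ c * x + d + c * w
    lemma = solve-∀
    coords : ∀ j → coord (f (up p v)) (suc j) ≈ coord (up p (f v)) (suc j)
    coords j with p Fin.≟ suc j
    ... | yes refl = begin
      coord (f (up p v)) p              ≈⟨ f-coord (up p v) j ⟩
      c * coord (up p v) p + d j        ≈⟨ +-congʳ (d j) (*-congˡ c (coord-up-same p v)) ⟩
      c * (coord v p + weight v) + d j  ≡⟨ lemma c (coord v p) (weight v) (d j) ⟩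
      c * coord v p + d j + c * weight v ≈⟨ +-cong (f-coord v j) (f-weight v) ⟨
      coord (f v) p + weight (f v)      ≈⟨ coord-up-same p (f v) ⟨
      coord (up p (f v)) p              ∎
    ... | no ne = begin
      coord (f (up p v)) (suc j)        ≈⟨ f-coord (up p v) j ⟩
      c * coord (up p v) (suc j) + d j  ≈⟨ +-congʳ (d j) (*-congˡ c (coord-up-other p (suc j) v ne)) ⟩
      c * coord v (suc j) + d j         ≈⟨ f-coord v j ⟨
      coord (f v) (suc j)               ≈⟨ coord-up-other p (suc j) (f v) ne ⟨
      coord (up p (f v)) (suc j)        ∎

  addᵛ : Vec (Fin n) k′ → Vec (Fin n) k′ → Vec (Fin n) k′
  addᵛ = Vec.zipWith (λ x t → addF x (toℕ t))

  negᵛ : Vec (Fin n) k′ → Vec (Fin n) k′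
  negᵛ = Vec.map (λ t → (n′ * toℕ t) mod n)

  lookup-addᵛ : ∀ b t j → toℕ (lookup (addᵛ b t) j) ≈ toℕ (lookup b j) + toℕ (lookup t j)
  lookup-addᵛ b t j = ≈-trans (≡⇒≈ (cong toℕ (Vec.lookup-zipWith _ j b t))) (toℕ-addF (lookup b j) _)

  lookup-negᵛ : ∀ t j → toℕ (lookup (negᵛ t) j) ≈ n′ * toℕ (lookup t j)
  lookup-negᵛ t j = ≈-trans (≡⇒≈ (cong toℕ (Vec.lookup-map j _ t))) (toℕ-mod _)

  addᵛ-negᵛ : ∀ b t → addᵛ (addᵛ b (negᵛ t)) t ≡ b
  addᵛ-negᵛ b t = lookup-extensional λ j → toℕ-injective-≈ (begin
    toℕ (lookup (addᵛ (addᵛ b (negᵛ t)) t) j)                     ≈⟨ lookup-addᵛ (addᵛ b (negᵛ t)) t j ⟩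
    toℕ (lookup (addᵛ b (negᵛ t)) j) + toℕ (lookup t j)           ≈⟨ +-congʳ _ (≈-trans (lookup-addᵛ b (negᵛ t) j) (+-congˡ _ (lookup-negᵛ t j))) ⟩
    toℕ (lookup b j) + n′ * toℕ (lookup t j) + toℕ (lookup t j)   ≈⟨ x+n′y+y≈x _ (toℕ (lookup t j)) ⟩
    toℕ (lookup b j)                                              ∎)

  addᵛ-negᵛ′ : ∀ b t → addᵛ (addᵛ b t) (negᵛ t) ≡ b
  addᵛ-negᵛ′ b t = lookup-extensional λ j → toℕ-injective-≈ (begin
    toℕ (lookup (addᵛ (addᵛ b t) (negᵛ t)) j)                     ≈⟨ lookup-addᵛ (addᵛ b t) (negᵛ t) j ⟩
    toℕ (lookup (addᵛ b t) j) + toℕ (lookup (negᵛ t) j)           ≈⟨ +-cong (lookup-addᵛ b t j) (lookup-negᵛ t j) ⟩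
    toℕ (lookup b j) + toℕ (lookup t j) + n′ * toℕ (lookup t j)   ≡⟨ lemma (toℕ (lookup b j)) (toℕ (lookup t j)) n′ ⟩
    toℕ (lookup b j) + n′ * toℕ (lookup t j) + toℕ (lookup t j)   ≈⟨ x+n′y+y≈x _ (toℕ (lookup t j)) ⟩
    toℕ (lookup b j)                                              ∎)
    where
    lemma : ∀ x t n → x + t + n * t ≡ x + n * t + t
    lemma = solve-∀

  translation : Vec (Fin n) k′ → LabelPreserving
  translation t = record
    { to      = T t
    ; from    = T (negᵛ t)
    ; to-from = λ { (a , b) → cong (a ,_) (addᵛ-negᵛ b t) }
    ; from-to = λ { (a , b) → cong (a ,_) (addᵛ-negᵛ′ b t) }
    ; to-up   = up-map (T t) 1 T-level (λ v → ≡⇒≈ (sym (*-identityˡ (weight v)))) (λ j → toℕ (lookup t j))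
                  λ { (a , b) j → ≈-trans (lookup-addᵛ b t j) (≡⇒≈ (cong (_+ toℕ (lookup t j)) (sym (*-identityˡ _)))) }
    }
    where
    T : Vec (Fin n) k′ → Vertex → Vertex
    T t (a , b) = a , addᵛ b t
    T-level : ∀ p v → level (T t (up p v)) ≡ level (up p (T t v))
    T-level zero    v = refl
    T-level (suc j) v = refl

  shift : Vertex → Vertex
  shift (a , b) = addF a 1 , Vec.map (λ x → addF x (toℕ x)) b

  level-shift : ∀ v → level (shift v) M.≈ suc (level v)
  level-shift (a , b) = M.≈-trans (M.toℕ-addF a 1) (M.≡⇒≈ (+-comm (toℕ a) 1))

  coord-shift : ∀ v j → coord (shift v) (suc j) ≈ 2 * coord v (suc j)
  coord-shift (a , b) j = begin
    toℕ (lookup (Vec.map (λ x → addF x (toℕ x)) b) j) ≡⟨ cong toℕ (Vec.lookup-map j _ b) ⟩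
    toℕ (addF (lookup b j) (toℕ (lookup b j)))        ≈⟨ toℕ-addF (lookup b j) _ ⟩
    toℕ (lookup b j) + toℕ (lookup b j)               ≡⟨ cong (toℕ (lookup b j) +_) (+-identityʳ _) ⟨
    2 * toℕ (lookup b j)                              ∎

  shift-up : ∀ p v → shift (up p v) ≡ up p (shift v)
  shift-up = up-map shift 2 s-level (λ v → 2^-cong (level-shift v)) (λ _ → 0) (λ v j → ≈-trans (coord-shift v j) (≡⇒≈ (sym (+-identityʳ _))))
    where
    s-level : ∀ p v → level (shift (up p v)) ≡ level (up p (shift v))
    s-level zero    v = refl
    s-level (suc j) v = refl

  shift^ : ℕ → Vertex → Vertex
  shift^ zero    v = v
  shift^ (suc t) v = shift (shift^ t v)

  level-shift^ : ∀ t v → level (shift^ t v) M.≈ level v + t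
  level-shift^ zero    v = M.≡⇒≈ (sym (+-identityʳ _))
  level-shift^ (suc t) v = M.≈-trans (level-shift (shift^ t v))
    (M.≈-trans (M.+-congˡ 1 (level-shift^ t v)) (M.≡⇒≈ (sym (+-suc (level v) t))))

  coord-shift^ : ∀ t v j → coord (shift^ t v) (suc j) ≈ 2 ^ t * coord v (suc j)
  coord-shift^ zero    v j = ≡⇒≈ (sym (*-identityˡ _))
  coord-shift^ (suc t) v j = begin
    coord (shift (shift^ t v)) (suc j) ≈⟨ coord-shift (shift^ t v) j ⟩
    2 * coord (shift^ t v) (suc j)     ≈⟨ *-congˡ 2 (coord-shift^ t v j) ⟩
    2 * (2 ^ t * coord v (suc j))      ≡⟨ *-assoc 2 (2 ^ t) _ ⟨
    2 ^ suc t * coord v (suc j)        ∎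

  shift^m≡id : ∀ v → shift^ m v ≡ v
  shift^m≡id v@(a , b) = coord-extensional
    (cong toℕ {x = proj₁ (shift^ m v)} (M.toℕ-injective-≈ (M.≈-trans (level-shift^ m v) (M.x+n≈x (toℕ a)))))
    (λ j → ≈-trans (coord-shift^ m v j) (≈-trans (*-congʳ _ 2^m≈1) (≡⇒≈ (*-identityˡ _))))

  shift^-suc : ∀ t v → shift^ t (shift v) ≡ shift (shift^ t v)
  shift^-suc zero    v = refl
  shift^-suc (suc t) v = cong shift (shift^-suc t v)

  shiftᴸ : LabelPreserving
  shiftᴸ = record
    { to      = shift
    ; from    = shift^ m′
    ; to-from = shift^m≡id
    ; from-to = λ v → trans (shift^-suc m′ v) (shift^m≡id v)
    ; to-up   = shift-up
    }

  shift^ᴸ : ℕ → LabelPreserving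
  shift^ᴸ zero    = idᴸ
  shift^ᴸ (suc t) = shiftᴸ ∘ᴸ shift^ᴸ t

  to-shift^ᴸ : ∀ t v → to (shift^ᴸ t) v ≡ shift^ t v
  to-shift^ᴸ zero    v = refl
  to-shift^ᴸ (suc t) v = cong shift (to-shift^ᴸ t v)

  origin : Vertex
  origin = zero , Vec.replicate k′ zero

  from-origin : ∀ v → ∃[ σ ] to σ origin ≡ v
  from-origin v@(a , b) = translation b ∘ᴸ shift^ᴸ (toℕ a) ,
    trans (cong (to (translation b)) (to-shift^ᴸ (toℕ a) origin)) (coord-extensional
      (cong toℕ {x = proj₁ (shift^ (toℕ a) origin)} (M.toℕ-injective-≈ (level-shift^ (toℕ a) origin)))
      (λ j → ≈-trans (lookup-addᵛ (proj₂ (shift^ (toℕ a) origin)) b j) (+-congʳ (toℕ (lookup b j)) (zeros j))))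
    where
    zeros : ∀ j → coord (shift^ (toℕ a) origin) (suc j) ≈ 0
    zeros j = ≈-trans (coord-shift^ (toℕ a) origin j)
      (≡⇒≈ (trans (cong (λ x → 2 ^ toℕ a * toℕ x) (Vec.lookup-replicate j zero)) (*-zeroʳ (2 ^ toℕ a))))

  label-preserving-transitive : ∀ u v → ∃[ σ ] to σ u ≡ v
  label-preserving-transitive u v =
    let σ , e = from-origin u ; τ , f = from-origin v in
    τ ∘ᴸ inverseᴸ σ , trans (cong (to τ) (trans (cong (from σ) (sym e)) (from-to σ origin))) f

  swap : Fin k′ → Vertex → Vertex
  swap j v@(a , b) = a , b [ j ]≔ (coord v zero mod n)

  coord-swap-same : ∀ j v → coord (swap j v) (suc j) ≈ coord v zero
  coord-swap-same j v@(a , b) = ≈-trans (≡⇒≈ (cong toℕ (Vec.lookup∘update j b _))) (toℕ-mod (coord v zero))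

  coord-swap-other : ∀ j i v → j ≢ i → coord (swap j v) (suc i) ≈ coord v (suc i)
  coord-swap-other j i (a , b) ne = ≡⇒≈ (cong toℕ (Vec.lookup∘update′ (ne ∘ sym) b _))

  -- `swap j` writes only entry j. As the level is kept and the coordinates still add up to w = 2ᵃ,
  -- coordinate `zero` is forced to become the old entry x: w - (s - x + (w - s)) = x with s = Σ b.
  coord-swap-zero : ∀ j v → coord (swap j v) zero ≈ coord v (suc j)
  coord-swap-zero j v@(a , b) = +-cancelʳ (n′ * x) (begin
    w + n′ * sumᵛ (b [ j ]≔ c) + n′ * x        ≡⟨ lemma₁ w n′ _ x ⟩
    w + n′ * (sumᵛ (b [ j ]≔ c) + x)           ≡⟨ cong (λ s → w + n′ * s) (sumᵛ-update b j c) ⟩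
    w + n′ * (sumᵛ b + toℕ c)                  ≈⟨ +-congˡ w (*-congˡ n′ (+-congˡ (sumᵛ b) (toℕ-mod (w + n′ * sumᵛ b)))) ⟩
    w + n′ * (sumᵛ b + (w + n′ * sumᵛ b))      ≡⟨ lemma₂ w n′ (sumᵛ b) ⟩
    0 + (w + n′ * sumᵛ b) * suc n′             ≈⟨ x+kn≈x 0 (w + n′ * sumᵛ b) ⟩
    0                                          ≈⟨ x+n′y+y≈x 0 x ⟨
    0 + n′ * x + x                             ≡⟨ +-comm (n′ * x) x ⟩
    x + n′ * x                                 ∎)
    where
    w = 2 ^ toℕ a
    x = toℕ (lookup b j)
    c = coord v zero mod n
    lemma₁ : ∀ w n s x → w + n * s + n * x ≡ w + n * (s + x)
    lemma₁ = solve-∀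
    lemma₂ : ∀ w n s → w + n * (s + (w + n * s)) ≡ 0 + (w + n * s) * suc n
    lemma₂ = solve-∀

  swap-involutive : ∀ j v → swap j (swap j v) ≡ v
  swap-involutive j v = coord-extensional refl coords
    where
    coords : ∀ i → coord (swap j (swap j v)) (suc i) ≈ coord v (suc i)
    coords i with j Fin.≟ i
    ... | yes refl = ≈-trans (coord-swap-same j (swap j v)) (coord-swap-zero j v)
    ... | no ne    = ≈-trans (coord-swap-other j i (swap j v) ne) (coord-swap-other j i v ne)

  transpose : Fin k′ → Label → Label
  transpose j zero    = suc j
  transpose j (suc i) = if does (j Fin.≟ i) then zero else suc i

  swap-up : ∀ j p v → swap j (up p v) ≡ up (transpose j p) (swap j v)
  swap-up j p v = coord-extensional (swap-level p) (coords p)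
    where
    swap-level : ∀ p → level (swap j (up p v)) ≡ level (up (transpose j p) (swap j v))
    swap-level zero    = refl
    swap-level (suc i) = level-up-cong (suc i) (transpose j (suc i)) {v} {swap j v} refl

    coords : ∀ p i → coord (swap j (up p v)) (suc i) ≈ coord (up (transpose j p) (swap j v)) (suc i)
    coords zero i with j Fin.≟ i
    ... | yes refl = begin
      coord (swap j (up zero v)) (suc j)        ≈⟨ coord-swap-same j (up zero v) ⟩
      coord (up zero v) zero                    ≈⟨ coord-up-same zero v ⟩
      coord v zero + weight v                   ≈⟨ +-congʳ (weight v) (coord-swap-same j v) ⟨
      coord (swap j v) (suc j) + weight v       ≈⟨ coord-up-same (suc j) (swap j v) ⟨
      coord (up (suc j) (swap j v)) (suc j)     ∎
    ... | no ne = begin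
      coord (swap j (up zero v)) (suc i)        ≈⟨ coord-swap-other j i (up zero v) ne ⟩
      coord v (suc i)                           ≈⟨ coord-swap-other j i v ne ⟨
      coord (swap j v) (suc i)                  ≈⟨ coord-up-other (suc j) (suc i) (swap j v) (ne ∘ Fin.suc-injective) ⟨
      coord (up (suc j) (swap j v)) (suc i)     ∎
    coords (suc l) i with j Fin.≟ l | j Fin.≟ i
    ... | yes refl | yes refl = begin
      coord (swap j (up (suc j) v)) (suc j)     ≈⟨ coord-swap-same j (up (suc j) v) ⟩
      coord (up (suc j) v) zero                 ≈⟨ coord-up-other (suc j) zero v (λ ()) ⟩
      coord v zero                              ≈⟨ coord-swap-same j v ⟨
      coord (swap j v) (suc j)                  ∎
    ... | yes refl | no ne = begin
      coord (swap j (up (suc j) v)) (suc i)     ≈⟨ coord-swap-other j i (up (suc j) v) ne ⟩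
      coord (up (suc j) v) (suc i)              ≈⟨ coord-up-other (suc j) (suc i) v (ne ∘ Fin.suc-injective) ⟩
      coord v (suc i)                           ≈⟨ coord-swap-other j i v ne ⟨
      coord (swap j v) (suc i)                  ∎
    ... | no ne | yes refl = begin
      coord (swap j (up (suc l) v)) (suc j)     ≈⟨ coord-swap-same j (up (suc l) v) ⟩
      coord (up (suc l) v) zero                 ≈⟨ coord-up-other (suc l) zero v (λ ()) ⟩
      coord v zero                              ≈⟨ coord-swap-same j v ⟨
      coord (swap j v) (suc j)                  ≈⟨ coord-up-other (suc l) (suc j) (swap j v) (ne ∘ sym ∘ Fin.suc-injective) ⟨
      coord (up (suc l) (swap j v)) (suc j)     ∎
    ... | no ne | no ne′ with l Fin.≟ i
    ...   | yes refl = begin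
      coord (swap j (up (suc l) v)) (suc l)     ≈⟨ coord-swap-other j l (up (suc l) v) ne ⟩
      coord (up (suc l) v) (suc l)              ≈⟨ coord-up-same (suc l) v ⟩
      coord v (suc l) + weight v                ≈⟨ +-congʳ (weight v) (coord-swap-other j l v ne) ⟨
      coord (swap j v) (suc l) + weight v       ≈⟨ coord-up-same (suc l) (swap j v) ⟨
      coord (up (suc l) (swap j v)) (suc l)     ∎
    ...   | no ne″ = begin
      coord (swap j (up (suc l) v)) (suc i)     ≈⟨ coord-swap-other j i (up (suc l) v) ne′ ⟩
      coord (up (suc l) v) (suc i)              ≈⟨ coord-up-other (suc l) (suc i) v (ne″ ∘ Fin.suc-injective) ⟩
      coord v (suc i)                           ≈⟨ coord-swap-other j i v ne′ ⟨
      coord (swap j v) (suc i)                  ≈⟨ coord-up-other (suc l) (suc i) (swap j v) (ne″ ∘ Fin.suc-injective) ⟨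
      coord (up (suc l) (swap j v)) (suc i)     ∎

  swapᴬ : Fin k′ → Aut B
  swapᴬ j = mkAut (swap j) (swap j) (swap-involutive j) (swap-involutive j)
    (permuting-adj (swap j) (λ p v → transpose j p , swap-up j p v))
    (permuting-adj (swap j) (λ p v → transpose j p , swap-up j p v))

  relabel : ∀ p q u → ∃[ σ ] app {B} σ (up p u) ≡ up q (app {B} σ u)
  relabel zero    zero    u = aut idᴸ , refl
  relabel zero    (suc j) u = swapᴬ j , swap-up j zero u
  relabel (suc j) zero    u = swapᴬ j , to-zero
    where
    to-zero : swap j (up (suc j) u) ≡ up zero (swap j u)
    to-zero = trans (cong (swap j) (trans (cong (up (suc j)) (sym (swap-involutive j u))) (sym (swap-up j zero (swap j u)))))
                    (swap-involutive j (up zero (swap j u)))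
  relabel (suc i) (suc j) u =
    let σ , e = relabel (suc i) zero u ; τ , f = relabel zero (suc j) (app {B} σ u) in
    τ ∘ᴬ σ , trans (cong (app {B} τ) e) f

  up-arc-transitive : ∀ p q u v → ∃[ σ ] (app {B} σ u ≡ v × app {B} σ (up p u) ≡ up q v)
  up-arc-transitive p q u v =
    let σ , e = relabel p q u ; τ , f = label-preserving-transitive (app {B} σ u) v in
    aut τ ∘ᴬ σ , f , trans (cong (to τ) e) (trans (to-up τ q _) (cong (up q) f))

  vertexTransitive : VertexTransitive B
  vertexTransitive u v = let σ , e , _ = up-arc-transitive zero zero u v in σ , e

  edgeTransitive : EdgeTransitive B
  edgeTransitive u v x y (inj₁ s) (inj₁ t) with step-up u v s | step-up x y t
  ... | p , refl | q , refl = let σ , e , f = up-arc-transitive p q u x in σ , inj₁ (e , f)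
  edgeTransitive u v x y (inj₁ s) (inj₂ t) with step-up u v s | step-up y x t
  ... | p , refl | q , refl = let σ , e , f = up-arc-transitive p q u y in σ , inj₂ (e , f)
  edgeTransitive u v x y (inj₂ s) (inj₁ t) with step-up v u s | step-up x y t
  ... | p , refl | q , refl = let σ , e , f = up-arc-transitive p q v x in σ , inj₂ (f , e)
  edgeTransitive u v x y (inj₂ s) (inj₂ t) with step-up v u s | step-up y x t
  ... | p , refl | q , refl = let σ , e , f = up-arc-transitive p q v y in σ , inj₁ (f , e)

  -- Forward arcs are already permuted transitively, so one edge that is turned around suffices:
  -- move the given arc to that edge, apply `ρ`, and move the resulting backward arc to the target.
  arcTransitive : (ρ : Aut B) (p : Label) (u : Vertex) → BStep (app {B} ρ (up p u)) (app {B} ρ u) → ArcTransitive B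
  arcTransitive ρ p₀ u₀ r with step-up _ _ r
  ... | q₀ , e₀ = λ
    { u v x y (inj₁ s) (inj₁ t) → forward u v x y s t
    ; u v x y (inj₁ s) (inj₂ t) → reversing u v x y s t
    ; u v x y (inj₂ s) (inj₁ t) → let σ , e , f = reversing v u y x s t in σ , f , e
    ; u v x y (inj₂ s) (inj₂ t) → let σ , e , f = forward v u y x s t in σ , f , e }
    where
    forward : ∀ u v x y → BStep u v → BStep x y → ∃[ σ ] (app {B} σ u ≡ x × app {B} σ v ≡ y)
    forward u v x y s t with step-up u v s | step-up x y t
    ... | p , refl | q , refl = up-arc-transitive p q u x
    reversing : ∀ u v x y → BStep u v → BStep y x → ∃[ σ ] (app {B} σ u ≡ x × app {B} σ v ≡ y)
    reversing u v x y s t with step-up u v s | step-up y x t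
    ... | p , refl | q , refl =
      let σ , e , f = up-arc-transitive p p₀ u u₀
          τ , g , h = up-arc-transitive q₀ q (app {B} ρ (up p₀ u₀)) y
      in τ ∘ᴬ ρ ∘ᴬ σ ,
         trans (cong (app {B} τ) (trans (cong (app {B} ρ) e) e₀)) h ,
         trans (cong (app {B} τ ∘ app {B} ρ) f) g

-- The arc-transitive cases

module _ {G : Graph} where

  -- `f ∘ f ∘ f` serves as inverse. Order four occurs for n = 5, where the reversal multiplies the
  -- coordinate by 2, an element of order four modulo 5; involutions are covered as well.
  fourthRootᴬ : (f : V G → V G) → (∀ v → f (f (f (f v))) ≡ v) →
                (∀ u v → Adj G u v → Adj G (f u) (f v)) → Aut G
  fourthRootᴬ f f⁴ f-adj = mkAut {G} f (f ∘ f ∘ f) f⁴ f⁴ f-adj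
    (λ u v a → f-adj _ _ (f-adj _ _ (f-adj u v a)))

module Reversal (k′ m′ n′ : ℕ) (n∣ : suc n′ ∣ 2 ^ suc m′ ∸ 1) where

  open Model k′ m′ n′ n∣
  open ≈-Reasoning

  negF : Fin m → Fin m
  negF a = (m′ * toℕ a) mod m

  negF-+ : ∀ a → toℕ (negF a) + toℕ a M.≈ 0
  negF-+ a = M.≈-trans (M.+-congʳ (toℕ a) (M.toℕ-mod (m′ * toℕ a))) (M.x+n′y+y≈x 0 (toℕ a))

  negF-unique : ∀ {a a′} → toℕ a′ + toℕ a M.≈ 0 → a′ ≡ negF a
  negF-unique {a} e = M.toℕ-injective-≈ (M.+-cancelʳ (toℕ a) (M.≈-trans e (M.≈-sym (negF-+ a))))

  negF-involutive : ∀ a → negF (negF a) ≡ a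
  negF-involutive a = sym (negF-unique {negF a} {a} (M.≈-trans (M.≡⇒≈ (+-comm (toℕ a) _)) (negF-+ a)))

  negF-addF : ∀ a → addF (negF (addF a 1)) 1 ≡ negF a
  negF-addF a = negF-unique {a} (M.≈-trans (M.+-congʳ (toℕ a) (M.toℕ-addF (negF (addF a 1)) 1))
    (M.≈-trans (M.≡⇒≈ (lemma (toℕ (negF (addF a 1))) (toℕ a)))
      (M.≈-trans (M.+-congˡ _ (M.≈-sym (M.toℕ-addF a 1))) (negF-+ (addF a 1)))))
    where
    lemma : ∀ x y → x + 1 + y ≡ x + (y + 1)
    lemma = solve-∀

  weight-negF : ∀ a → 2 ^ toℕ (negF a) * 2 ^ toℕ a ≈ 1
  weight-negF a = ≈-trans (≡⇒≈ (sym (^-distribˡ-+-* 2 (toℕ (negF a)) (toℕ a)))) (2^-cong (negF-+ a))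

  reversing-adj : (f : Vertex → Vertex) → (∀ p v → ∃[ q ] f v ≡ up q (f (up p v))) →
                  ∀ u v → BAdj u v → BAdj (f u) (f v)
  reversing-adj f h u v (inj₁ s) with step-up u v s
  ... | p , refl = inj₂ (subst (BStep (f v)) (sym (proj₂ (h p u))) (up-step (proj₁ (h p u)) (f v)))
  reversing-adj f h u v (inj₂ s) with step-up v u s
  ... | p , refl = inj₁ (subst (BStep (f u)) (sym (proj₂ (h p v))) (up-step (proj₁ (h p v)) (f u)))

  arcTransitive-reversing : (f : Vertex → Vertex) → (∀ v → f (f (f (f v))) ≡ v) →
                            (∀ p v → ∃[ q ] f v ≡ up q (f (up p v))) → ArcTransitive B
  arcTransitive-reversing f f⁴ h = arcTransitive (fourthRootᴬ {B} f f⁴ (reversing-adj f h)) zero origin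
    (subst (BStep (f (up zero origin))) (sym (proj₂ (h zero origin))) (up-step (proj₁ (h zero origin)) (f (up zero origin))))

module _ (k′ m′ : ℕ) (3∣ : 3 ∣ 2 ^ suc m′ ∸ 1) where

  open Model k′ m′ 2 3∣
  open Reversal k′ m′ 2 3∣
  open ≈-Reasoning

  -- Modulo 3 the weights 2ᵃ = ±1 are their own inverses, so negating the level reverses every edge.
  arcTransitive-3 : ArcTransitive B
  arcTransitive-3 = arcTransitive-reversing ρ (λ v → trans (cong (ρ ∘ ρ) (ρ-involutive v)) (ρ-involutive v)) (λ p v → p , ρ-up p v)
    where
    ρ : Vertex → Vertex
    ρ (a , b) = negF a , b
    ρ-involutive : ∀ v → ρ (ρ v) ≡ v
    ρ-involutive (a , b) = cong (_, b) (negF-involutive a)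
    ρ-level : ∀ p v → level (ρ v) ≡ level (up p (ρ (up p v)))
    ρ-level zero    (a , b) = cong toℕ (sym (negF-addF a))
    ρ-level (suc j) (a , b) = cong toℕ (sym (negF-addF a))
    4^≈1 : ∀ t → 2 ^ t * 2 ^ t ≈ 1
    4^≈1 zero    = ≈-refl
    4^≈1 (suc t) = begin
      2 * 2 ^ t * (2 * 2 ^ t)   ≡⟨ lemma (2 ^ t) ⟩
      4 * (2 ^ t * 2 ^ t)       ≈⟨ *-cong {4} {1} (mk≈ refl) (4^≈1 t) ⟩
      1                         ∎
      where
      lemma : ∀ w → 2 * w * (2 * w) ≡ 4 * (w * w)
      lemma = solve-∀
    -- Modulo 3 the second weight, the inverse of 2ᵃ⁺¹, equals 2ᵃ⁺¹, and 2ᵃ + 2ᵃ⁺¹ = 3 · 2ᵃ. Hence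
    -- climbing along p before and after the reflection leaves coordinate p unchanged.
    ρ-weight : ∀ p v → weight v + weight (ρ (up p v)) ≈ 0
    ρ-weight p v = begin
      weight v + weight (ρ (up p v)) ≈⟨ +-congˡ (weight v) (≈-trans (inverse-weight (proj₁ (up p v))) (weight-up p v)) ⟩
      weight v + 2 * weight v        ≡⟨ *-comm 3 (weight v) ⟩
      0 + weight v * 3               ≈⟨ x+kn≈x 0 (weight v) ⟩
      0                              ∎
      where
      inverse-weight : ∀ a → 2 ^ toℕ (negF a) ≈ 2 ^ toℕ a
      inverse-weight a = 2^*-cancel (toℕ a) (begin
        2 ^ toℕ a * 2 ^ toℕ (negF a) ≡⟨ *-comm (2 ^ toℕ a) _ ⟩
        2 ^ toℕ (negF a) * 2 ^ toℕ a ≈⟨ weight-negF a ⟩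
        1                            ≈⟨ 4^≈1 (toℕ a) ⟨
        2 ^ toℕ a * 2 ^ toℕ a        ∎)
    ρ-up : ∀ p v → ρ v ≡ up p (ρ (up p v))
    ρ-up p v = coord-extensional (ρ-level p v) coords
      where
      coords : ∀ j → coord (ρ v) (suc j) ≈ coord (up p (ρ (up p v))) (suc j)
      coords j with p Fin.≟ suc j
      ... | yes refl = begin
        coord v p                                        ≡⟨ +-identityʳ _ ⟨
        coord v p + 0                                    ≈⟨ +-congˡ (coord v p) (ρ-weight p v) ⟨
        coord v p + (weight v + weight (ρ (up p v)))     ≡⟨ +-assoc (coord v p) _ _ ⟨
        coord v p + weight v + weight (ρ (up p v))       ≈⟨ +-congʳ _ (coord-up-same p v) ⟨
        coord (up p v) p + weight (ρ (up p v))           ≈⟨ coord-up-same p (ρ (up p v)) ⟨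
        coord (up p (ρ (up p v))) p                      ∎
      ... | no ne = begin
        coord v (suc j)                                  ≈⟨ coord-up-other p (suc j) v ne ⟨
        coord (up p v) (suc j)                           ≈⟨ coord-up-other p (suc j) (ρ (up p v)) ne ⟨
        coord (up p (ρ (up p v))) (suc j)                ∎

module _ (m′ : ℕ) (5∣ : 5 ∣ 2 ^ suc m′ ∸ 1) where

  open Model 1 m′ 4 5∣
  open Reversal 1 m′ 4 5∣
  open ≈-Reasoning

  -- x ↦ 2x + d with d depending on the level a through w = 2ᵃ only; d is forced by
  -- d = 0 at level 0 and by the requirement that edges are reversed.
  reflect : Fin 5 → Fin 5 → Fin 5
  reflect w x = (2 * toℕ x + lookup (0 ∷ 0 ∷ 0 ∷ 1 ∷ 1 ∷ []) w) mod 5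

  reflect-order : ∀ w y → toℕ y * toℕ w % 5 ≡ 1 → ∀ x → reflect y (reflect w (reflect y (reflect w x))) ≡ x
  reflect-order = toWitness {a? = Fin.all? λ w → Fin.all? λ y → (toℕ y * toℕ w % 5 ≟ 1) →-dec
    Fin.all? λ x → reflect y (reflect w (reflect y (reflect w x))) Fin.≟ x} _

  -- `z = 2w` is the weight one level higher, and its inverse `y` is the weight of the reflected
  -- edge. The two alternatives are the two labels that this edge can have for k = 2. Only residues
  -- modulo 5 occur, so the check is finite although m is arbitrary.
  reflect-stay : ∀ w (y z : Fin 5) → toℕ z ≡ 2 * toℕ w % 5 → toℕ y * toℕ z % 5 ≡ 1 → ∀ x →
    reflect w x ≡ reflect z x ⊎ reflect w x ≡ addF (reflect z x) (toℕ y)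
  reflect-stay = toWitness {a? = Fin.all? λ w → Fin.all? λ y → Fin.all? λ z → (toℕ z ≟ 2 * toℕ w % 5) →-dec
    ((toℕ y * toℕ z % 5 ≟ 1) →-dec Fin.all? λ x → (reflect w x Fin.≟ reflect z x) ⊎-dec (reflect w x Fin.≟ addF (reflect z x) (toℕ y)))} _

  reflect-move : ∀ w (y z : Fin 5) → toℕ z ≡ 2 * toℕ w % 5 → toℕ y * toℕ z % 5 ≡ 1 → ∀ x →
    reflect w x ≡ reflect z (addF x (toℕ w)) ⊎ reflect w x ≡ addF (reflect z (addF x (toℕ w))) (toℕ y)
  reflect-move = toWitness {a? = Fin.all? λ w → Fin.all? λ y → Fin.all? λ z → (toℕ z ≟ 2 * toℕ w % 5) →-dec
    ((toℕ y * toℕ z % 5 ≟ 1) →-dec Fin.all? λ x → (reflect w x Fin.≟ reflect z (addF x (toℕ w))) ⊎-dec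
      (reflect w x Fin.≟ addF (reflect z (addF x (toℕ w))) (toℕ y)))} _

  module _ (w : Fin m → Fin 5) (w≈ : ∀ a → toℕ (w a) ≈ 2 ^ toℕ a) where

    w-negF : ∀ a → toℕ (w (negF a)) * toℕ (w a) % 5 ≡ 1
    w-negF a = %-≡ (≈-trans (*-cong (w≈ (negF a)) (w≈ a)) (weight-negF a))

    w-suc : ∀ a → toℕ (w (addF a 1)) ≡ 2 * toℕ (w a) % 5
    w-suc a = trans (sym (m<n⇒m%n≡m (Fin.toℕ<n (w (addF a 1)))))
      (%-≡ (≈-trans (w≈ (addF a 1)) (≈-trans (weight-up zero (a , zero ∷ [])) (*-congˡ 2 (≈-sym (w≈ a))))))

    addF-w : ∀ (x : Fin 5) a → addF x (toℕ (w a)) ≡ addF x (2 ^ toℕ a)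
    addF-w x a = toℕ-injective-≈ (≈-trans (toℕ-addF x (toℕ (w a)))
      (≈-trans (+-congˡ (toℕ x) (w≈ a)) (≈-sym (toℕ-addF x (2 ^ toℕ a)))))

    reflectᵛ : Vertex → Vertex
    reflectᵛ (a , x ∷ []) = negF a , reflect (w a) x ∷ []

    reflectᵛ-order : ∀ v → reflectᵛ (reflectᵛ (reflectᵛ (reflectᵛ v))) ≡ v
    reflectᵛ-order (a , x ∷ []) = cong₂ (λ a x → a , x ∷ []) (trans (negF-involutive _) (negF-involutive a))
      (trans (cong (λ c → reflect (w (negF c)) (reflect (w c) (reflect (w (negF a)) (reflect (w a) x)))) (negF-involutive a))
        (reflect-order (w a) (w (negF a)) (w-negF a) x))

    reflectᵛ-reversing : ∀ p v → ∃[ q ] reflectᵛ v ≡ up q (reflectᵛ (up p v))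
    reflectᵛ-reversing p (a , x ∷ []) = lemma p
      where
      a⁺ = addF a 1
      lift : ∀ y → reflect (w a) x ≡ y ⊎ reflect (w a) x ≡ addF y (toℕ (w (negF a⁺))) →
             ∃[ q ] (negF a , reflect (w a) x ∷ []) ≡ up q (negF a⁺ , y ∷ [])
      lift y (inj₁ e) = zero , cong₂ (λ a x → a , x ∷ []) (sym (negF-addF a)) e
      lift y (inj₂ e) = suc zero , cong₂ (λ a x → a , x ∷ []) (sym (negF-addF a)) (trans e (addF-w y (negF a⁺)))
      lemma : ∀ p → ∃[ q ] reflectᵛ (a , x ∷ []) ≡ up q (reflectᵛ (up p (a , x ∷ [])))
      lemma zero       = lift (reflect (w a⁺) x) (reflect-stay (w a) (w (negF a⁺)) (w a⁺) (w-suc a) (w-negF a⁺) x)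
      lemma (suc zero) = lift (reflect (w a⁺) (addF x (2 ^ toℕ a)))
        (subst (λ z → reflect (w a) x ≡ reflect (w a⁺) z ⊎ reflect (w a) x ≡ addF (reflect (w a⁺) z) (toℕ (w (negF a⁺))))
          (addF-w x a) (reflect-move (w a) (w (negF a⁺)) (w a⁺) (w-suc a) (w-negF a⁺) x))

  arcTransitive-2-5 : ArcTransitive B
  arcTransitive-2-5 = arcTransitive-reversing (reflectᵛ w w≈) (reflectᵛ-order w w≈) (reflectᵛ-reversing w w≈)
    where
    w : Fin m → Fin 5
    w a = 2 ^ toℕ a mod 5
    w≈ : ∀ a → toℕ (w a) ≈ 2 ^ toℕ a
    w≈ a = toℕ-mod (2 ^ toℕ a)

_≟ⱽ_ : ∀ {k′ m n} (u v : BVertex k′ m n) → Dec (u ≡ v)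
_≟ⱽ_ = ≡-dec Fin._≟_ (Vec.≡-dec Fin._≟_)

BStep? : ∀ {k′ m n} (u v : BVertex k′ m n) → Dec (BStep u v)
BStep? (a , b) (a′ , c) = (a′ Fin.≟ addF a 1) ×-dec
  (Vec.≡-dec Fin._≟_ c b ⊎-dec Fin.any? (λ j → Vec.≡-dec Fin._≟_ c (b [ j ]≔ addF (lookup b j) (2 ^ toℕ a))))

BAdj? : ∀ {k′ m n} (u v : BVertex k′ m n) → Dec (BAdj u v)
BAdj? u v = BStep? u v ⊎-dec BStep? v u

-- The sporadic graphs have an involution (a , x) ↦ (s x + c x · a , π x) with c x = ±1 that
-- exchanges (0 , 0) and (1 , 0); the tables come from a computer search.
module Sporadic (m′ n′ : ℕ) (n∣ : suc n′ ∣ 2 ^ suc m′ ∸ 1) (π s c : Vec ℕ (suc n′)) where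

  open Model 1 m′ n′ n∣

  ι : Vertex → Vertex
  ι (a , x ∷ []) = (lookup s x + lookup c x * toℕ a) mod m , lookup π x mod n ∷ []

  Check : Fin m → Fin n → Set
  Check a x = let v = a , x ∷ [] in
    ι (ι v) ≡ v × BAdj (ι v) (ι (up zero v)) × BAdj (ι v) (ι (up (suc zero) v))

  check? : ∀ a x → Dec (Check a x)
  check? a x = (_ ≟ⱽ _) ×-dec (BAdj? _ _ ×-dec BAdj? _ _)

  arcTransitive-table : (∀ a x → Check a x) → BStep (ι (up zero origin)) (ι origin) → ArcTransitive B
  arcTransitive-table checked = arcTransitive (fourthRootᴬ {B} ι ι⁴ ι-adj) zero origin
    where
    ι² : ∀ v → ι (ι v) ≡ v
    ι² (a , x ∷ []) = proj₁ (checked a x)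
    ι⁴ : ∀ v → ι (ι (ι (ι v))) ≡ v
    ι⁴ v = trans (cong (ι ∘ ι) (ι² v)) (ι² v)
    ι-up : ∀ p v → BAdj (ι v) (ι (up p v))
    ι-up zero       (a , x ∷ []) = proj₁ (proj₂ (checked a x))
    ι-up (suc zero) (a , x ∷ []) = proj₂ (proj₂ (checked a x))
    ι-adj : ∀ u v → BAdj u v → BAdj (ι u) (ι v)
    ι-adj u v (inj₁ t) with step-up u v t
    ... | p , refl = ι-up p u
    ι-adj u v (inj₂ t) with step-up v u t
    ... | p , refl with ι-up p v
    ...   | inj₁ r = inj₂ r
    ...   | inj₂ r = inj₁ r

arcTransitive-2-3-7 : ArcTransitive (Bouwer 2 3 7)
arcTransitive-2-3-7 = arcTransitive-table (toWitness {a? = Fin.all? λ a → Fin.all? (check? a)} _)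
  (toWitness {a? = BStep? (ι (up zero origin)) (ι origin)} _)
  where
  open Sporadic 2 6 (divides 1 refl)
    (0 ∷ 6 ∷ 3 ∷ 2 ∷ 4 ∷ 5 ∷ 1 ∷ [])
    (1 ∷ 2 ∷ 1 ∷ 1 ∷ 0 ∷ 0 ∷ 1 ∷ [])
    (2 ∷ 1 ∷ 2 ∷ 2 ∷ 2 ∷ 1 ∷ 1 ∷ [])
  open Model 1 2 6 (divides 1 refl)

arcTransitive-2-6-7 : ArcTransitive (Bouwer 2 6 7)
arcTransitive-2-6-7 = arcTransitive-table (toWitness {a? = Fin.all? λ a → Fin.all? (check? a)} _)
  (toWitness {a? = BStep? (ι (up zero origin)) (ι origin)} _)
  where
  open Sporadic 5 6 (divides 9 refl)
    (0 ∷ 2 ∷ 1 ∷ 6 ∷ 4 ∷ 5 ∷ 3 ∷ [])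
    (1 ∷ 1 ∷ 5 ∷ 5 ∷ 3 ∷ 5 ∷ 5 ∷ [])
    (5 ∷ 1 ∷ 1 ∷ 5 ∷ 1 ∷ 5 ∷ 5 ∷ [])
  open Model 1 5 6 (divides 9 refl)

arcTransitive-2-6-21 : ArcTransitive (Bouwer 2 6 21)
arcTransitive-2-6-21 = arcTransitive-table (toWitness {a? = Fin.all? λ a → Fin.all? (check? a)} _)
  (toWitness {a? = BStep? (ι (up zero origin)) (ι origin)} _)
  where
  open Sporadic 5 20 (divides 3 refl)
    (0 ∷ 20 ∷ 10 ∷ 9 ∷ 11 ∷ 19 ∷ 15 ∷ 14 ∷ 13 ∷ 3 ∷ 2 ∷ 4 ∷ 12 ∷ 8 ∷ 7 ∷ 6 ∷ 17 ∷ 16 ∷ 18 ∷ 5 ∷ 1 ∷ [])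
    (1 ∷ 5 ∷ 1 ∷ 1 ∷ 3 ∷ 3 ∷ 1 ∷ 1 ∷ 5 ∷ 1 ∷ 1 ∷ 3 ∷ 3 ∷ 1 ∷ 1 ∷ 5 ∷ 1 ∷ 1 ∷ 3 ∷ 3 ∷ 1 ∷ [])
    (5 ∷ 1 ∷ 5 ∷ 5 ∷ 5 ∷ 1 ∷ 1 ∷ 5 ∷ 1 ∷ 5 ∷ 5 ∷ 5 ∷ 1 ∷ 1 ∷ 5 ∷ 1 ∷ 5 ∷ 5 ∷ 5 ∷ 1 ∷ 1 ∷ [])
  open Model 1 5 20 (divides 3 refl)

-- Hexagons up to renaming of labels

-- A walk is a sequence of (direction , label) pairs, with true for upward steps.
Walk : Set → ℕ → Set
Walk A t = Vec (Bool × A) t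

height : ∀ {A t} → ℕ → Walk A t → ℕ
height h []               = h
height h ((true  , _) ∷ w) = height (suc h) w
height h ((false , _) ∷ w) = height (pred h) w

select : Bool → ℕ → ℕ
select b x = if b then x else 0

module _ {A : Set} (sel : A → Bool) where

  -- A step between heights h and h + 1 weighs 2ʰ in both directions. Upward and downward steps are
  -- added up separately to stay within ℕ.
  rise fall : ∀ {t} → ℕ → Walk A t → ℕ
  rise h []                = 0
  rise h ((true  , a) ∷ w) = select (sel a) (2 ^ h) + rise (suc h) w
  rise h ((false , a) ∷ w) = rise (pred h) w
  fall h []                = 0
  fall h ((true  , a) ∷ w) = fall (suc h) w
  fall h ((false , a) ∷ w) = select (sel a) (2 ^ pred h) + fall (pred h) w

-- Boolean tests for divisibility by m and by n, possibly only sound or only complete ones.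
record Tests : Set where
  constructor tests
  field
    level? sum? : ℕ → Bool
open Tests public

-- Walks of length 6 start at height 6, so that no truncation occurs on the way down.
module _ {A : Set} (_≟_ : DecidableEquality A) where

  noTurn : Bool × A → Bool × A → Bool
  noTurn (b , x) (c , y) = if b xor c then not (does (x ≟ y)) else true

  labelSum : A → Walk A 6 → ℕ
  labelSum a w = ∣ rise (λ x → does (x ≟ a)) 6 w - fall (λ x → does (x ≟ a)) 6 w ∣

  -- The recursion consumes one copy of the walk to run through the labels that occur, while each
  -- sum is taken over the other, complete copy.
  labelSums? : ∀ {t} → (ℕ → Bool) → Walk A t → Walk A 6 → Bool
  labelSums? test []             w = true
  labelSums? test ((_ , a) ∷ w′) w = test (labelSum a w) ∧ labelSums? test w′ w

  noBacktracking : Walk A 6 → Bool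
  noBacktracking (s₀ ∷ s₁ ∷ s₂ ∷ s₃ ∷ s₄ ∷ s₅ ∷ []) =
    noTurn s₀ s₁ ∧ noTurn s₁ s₂ ∧ noTurn s₂ s₃ ∧ noTurn s₃ s₄ ∧ noTurn s₄ s₅ ∧ noTurn s₅ s₀

  hexagon? : Tests → Walk A 6 → Bool
  hexagon? test w = noBacktracking w ∧ level? test ∣ height 6 w - 6 ∣ ∧ labelSums? (sum? test) w w

relabelʷ : ∀ {A B : Set} {t} → (A → B) → Walk A t → Walk B t
relabelʷ f = Vec.map (map₂ f)

module _ {A B : Set} (_≟ᴬ_ : DecidableEquality A) (_≟ᴮ_ : DecidableEquality B) (f : A → B) (f-inj : ∀ {x y} → f x ≡ f y → x ≡ y) where

  does-injective : ∀ x y → does (f x ≟ᴮ f y) ≡ does (x ≟ᴬ y)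
  does-injective x y with x ≟ᴬ y
  ... | yes refl = dec-true (f x ≟ᴮ f x) refl
  ... | no ne    = dec-false (f x ≟ᴮ f y) (ne ∘ f-inj)

  height-relabel : ∀ {t} h (w : Walk A t) → height h (relabelʷ f w) ≡ height h w
  height-relabel h []                = refl
  height-relabel h ((true  , _) ∷ w) = height-relabel (suc h) w
  height-relabel h ((false , _) ∷ w) = height-relabel (pred h) w

  rise-relabel : ∀ {t} a h (w : Walk A t) → rise (λ x → does (x ≟ᴮ f a)) h (relabelʷ f w) ≡ rise (λ x → does (x ≟ᴬ a)) h w
  rise-relabel a h []                = refl
  rise-relabel a h ((true  , x) ∷ w) = cong₂ (λ b r → select b (2 ^ h) + r) (does-injective x a) (rise-relabel a (suc h) w)
  rise-relabel a h ((false , x) ∷ w) = rise-relabel a (pred h) w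

  fall-relabel : ∀ {t} a h (w : Walk A t) → fall (λ x → does (x ≟ᴮ f a)) h (relabelʷ f w) ≡ fall (λ x → does (x ≟ᴬ a)) h w
  fall-relabel a h []                = refl
  fall-relabel a h ((true  , x) ∷ w) = fall-relabel a (suc h) w
  fall-relabel a h ((false , x) ∷ w) = cong₂ (λ b r → select b (2 ^ pred h) + r) (does-injective x a) (fall-relabel a (pred h) w)

  labelSums?-relabel : ∀ {t} test (w′ : Walk A t) w →
    labelSums? _≟ᴮ_ test (relabelʷ f w′) (relabelʷ f w) ≡ labelSums? _≟ᴬ_ test w′ w
  labelSums?-relabel test []             w = refl
  labelSums?-relabel test ((_ , a) ∷ w′) w = cong₂ (λ d r → test d ∧ r)
    (cong₂ ∣_-_∣ (rise-relabel a 6 w) (fall-relabel a 6 w)) (labelSums?-relabel test w′ w)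

  noTurn-relabel : ∀ s t → noTurn _≟ᴮ_ (map₂ f s) (map₂ f t) ≡ noTurn _≟ᴬ_ s t
  noTurn-relabel (b , x) (c , y) = cong (λ e → if b xor c then not e else true) (does-injective x y)

  noBacktracking-relabel : ∀ w → noBacktracking _≟ᴮ_ (relabelʷ f w) ≡ noBacktracking _≟ᴬ_ w
  noBacktracking-relabel (s₀ ∷ s₁ ∷ s₂ ∷ s₃ ∷ s₄ ∷ s₅ ∷ []) =
    cong₂ _∧_ (noTurn-relabel s₀ s₁) (cong₂ _∧_ (noTurn-relabel s₁ s₂) (cong₂ _∧_ (noTurn-relabel s₂ s₃)
      (cong₂ _∧_ (noTurn-relabel s₃ s₄) (cong₂ _∧_ (noTurn-relabel s₄ s₅) (noTurn-relabel s₅ s₀)))))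

  hexagon?-relabel : ∀ test w → hexagon? _≟ᴮ_ test (relabelʷ f w) ≡ hexagon? _≟ᴬ_ test w
  hexagon?-relabel test w = cong₂ _∧_ (noBacktracking-relabel w)
    (cong₂ _∧_ (cong (λ h → level? test ∣ h - 6 ∣) (height-relabel 6 w)) (labelSums?-relabel (sum? test) w w))

∧-true : ∀ {a b} → a ∧ b ≡ true → a ≡ true × b ≡ true
∧-true {true} {true} _ = refl , refl

∧-intro : ∀ {a b} → a ≡ true → b ≡ true → a ∧ b ≡ true
∧-intro refl refl = refl

allUpTo : ℕ → (ℕ → Bool) → Bool
allUpTo zero    P = P zero
allUpTo (suc r) P = P (suc r) ∧ allUpTo r P

allUpTo-sound : ∀ r P → allUpTo r P ≡ true → ∀ c → c ≤ r → P c ≡ true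
allUpTo-sound zero    P e c c≤0 rewrite n≤0⇒n≡0 c≤0 = e
allUpTo-sound (suc r) P e c c≤r with m≤n⇒m<n∨m≡n c≤r
... | inj₁ (s≤s c≤r′) = allUpTo-sound r P (proj₂ (∧-true {P (suc r)} e)) c c≤r′
... | inj₂ refl       = proj₁ (∧-true e)

-- Ranges over the walks whose labels ≥ r appear in the order r, r + 1, r + 2, …, each for
-- the first time after all smaller ones: up to renaming of the labels, all walks.
allWalks : (t r : ℕ) → (Walk ℕ t → Bool) → Bool
allWalks zero    r P = P []
allWalks (suc t) r P =
  allUpTo r λ c →
    allWalks t (if c ≡ᵇ r then suc r else r) (λ w → P ((true , c) ∷ w)) ∧
    allWalks t (if c ≡ᵇ r then suc r else r) (λ w → P ((false , c) ∷ w))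

allWalks-cons : ∀ {t r} P → allWalks (suc t) r P ≡ true → ∀ b c → c ≤ r →
                allWalks t (if c ≡ᵇ r then suc r else r) (λ w → P ((b , c) ∷ w)) ≡ true
allWalks-cons {t} {r} P e b c c≤r = pick b (∧-true (allUpTo-sound r _ e c c≤r))
  where
  pick : ∀ b → (allWalks t (if c ≡ᵇ r then suc r else r) (λ w → P ((true , c) ∷ w)) ≡ true ×
                allWalks t (if c ≡ᵇ r then suc r else r) (λ w → P ((false , c) ∷ w)) ≡ true) →
         allWalks t (if c ≡ᵇ r then suc r else r) (λ w → P ((b , c) ∷ w)) ≡ true
  pick true  = proj₁
  pick false = proj₂

allWalks-old : ∀ {t r} P → allWalks (suc t) r P ≡ true → ∀ b c → c < r →
               allWalks t r (λ w → P ((b , c) ∷ w)) ≡ true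
allWalks-old {t} {r} P e b c c<r = subst (λ q → allWalks t (if q then suc r else r) (λ w → P ((b , c) ∷ w)) ≡ true)
  (dec-false (c Data.Nat.Properties.≟ r) (<⇒≢ c<r)) (allWalks-cons P e b c (<⇒≤ c<r))

allWalks-new : ∀ {t r} P → allWalks (suc t) r P ≡ true → ∀ b →
               allWalks t (suc r) (λ w → P ((b , r) ∷ w)) ≡ true
allWalks-new {t} {r} P e b = subst (λ q → allWalks t (if q then suc r else r) (λ w → P ((b , r) ∷ w)) ≡ true)
  (dec-true (r Data.Nat.Properties.≟ r) refl) (allWalks-cons P e b r ≤-refl)

module _ {A : Set} (_≟_ : DecidableEquality A) where

  open DecMembership _≟_ using (_∈?_)

  index : A → List A → ℕ
  index x []       = 0
  index x (y ∷ ys) = if does (x ≟ y) then 0 else suc (index x ys)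

  index-injective : ∀ {x y} ys → x ∈ ys → index x ys ≡ index y ys → x ≡ y
  index-injective {x} {y} (z ∷ zs) x∈ e with x ≟ z | y ≟ z
  ... | yes refl | yes refl = refl
  index-injective (z ∷ zs) (here x≡z) e | no ne | no _ = ⊥-elim (ne x≡z)
  index-injective (z ∷ zs) (there x∈) e | no ne | no _ = index-injective zs x∈ (suc-injective e)

  index-++ : ∀ x ys zs → x ∈ ys → index x (ys ++ zs) < length ys
  index-++ x (y ∷ ys) zs x∈ with x ≟ y
  ... | yes _ = z<s
  index-++ x (y ∷ ys) zs (here e)   | no ne = ⊥-elim (ne e)
  index-++ x (y ∷ ys) zs (there x∈) | no ne = s<s (index-++ x ys zs x∈)

  index-fresh : ∀ x ys zs → x ∉ ys → index x (ys ++ x ∷ zs) ≡ length ys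
  index-fresh x []       zs x∉ rewrite dec-true (x ≟ x) refl = refl
  index-fresh x (y ∷ ys) zs x∉ with x ≟ y
  ... | yes e = ⊥-elim (x∉ (here e))
  ... | no _  = cong suc (index-fresh x ys zs (x∉ ∘ there))

  -- `D` holds the labels met so far in order of first occurrence: a known label has an index below
  -- `length D`, a new one receives `length D`, and these are the choices made by `allWalks`. `E`
  -- lists the new labels still to come and then `rest`, which makes the indexing injective on
  -- labels outside the walk too. `E` is found before `P` is given, because the predicate changes
  -- with every step of the induction.
  allWalks-sound : ∀ {t} (rest D : List A) (w : Walk A t) → ∃[ E ] ((∀ {x} → x ∈ rest → x ∈ E) ×
    (∀ P → allWalks t (length D) P ≡ true → P (relabelʷ (λ x → index x (D ++ E)) w) ≡ true))
  allWalks-sound rest D [] = rest , id , λ P e → e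
  allWalks-sound {suc t} rest D ((b , l) ∷ w) with l ∈? D
  ... | yes l∈D = let E , rest⊆E , h = allWalks-sound rest D w in
    E , rest⊆E , λ P e → h (λ w → P ((b , index l (D ++ E)) ∷ w)) (allWalks-old P e b _ (index-++ l D E l∈D))
  ... | no l∉D = let E , rest⊆E , h = allWalks-sound rest (D ++ l ∷ []) w in
    l ∷ E , there ∘ rest⊆E , λ P e → conclude E h P e
    where
    conclude : ∀ E → (∀ P → allWalks t (length (D ++ l ∷ [])) P ≡ true → P (relabelʷ (λ x → index x ((D ++ l ∷ []) ++ E)) w) ≡ true) →
               ∀ P → allWalks (suc t) (length D) P ≡ true →
               P (relabelʷ (λ x → index x (D ++ l ∷ E)) ((b , l) ∷ w)) ≡ true
    conclude E h P e rewrite List.++-assoc D (l ∷ []) E | index-fresh l D E l∉D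
                           | List.length-++ D {l ∷ []} | +-comm (length D) 1 =
      h (λ w → P ((b , length D) ∷ w)) (allWalks-new P e b)

  allWalks-relabel : ∀ {t} (all : List A) → (∀ x → x ∈ all) → ∀ P → allWalks t 0 P ≡ true → ∀ (w : Walk A t) →
    ∃[ f ] ((∀ {x y} → f x ≡ f y → x ≡ y) × P (relabelʷ f w) ≡ true)
  allWalks-relabel all ∈all P e w = let E , all⊆E , h = allWalks-sound all [] w in
    (λ x → index x E) , (λ {x} → index-injective E (all⊆E (∈all x))) , h P e

Pattern : Set
Pattern = Walk ℕ 6

_∈ᴾ?_ : (p : Pattern) (ps : List Pattern) → Dec (p ∈ ps)
_∈ᴾ?_ = DecMembership._∈?_ (Vec.≡-dec (≡-dec Bool._≟_ Data.Nat.Properties._≟_))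

listed? : Tests → (Pattern → Bool) → List Pattern → Pattern → Bool
listed? test pre ps p =
  if pre p then (if hexagon? Data.Nat.Properties._≟_ test p then does (p ∈ᴾ? ps) else true) else true

listed?-sound : ∀ test pre ps p → listed? test pre ps p ≡ true → pre p ≡ true →
  hexagon? Data.Nat.Properties._≟_ test p ≡ true → p ∈ ps
listed?-sound test pre ps p e e₁ e₂ rewrite e₁ | e₂ with yes p∈ ← p ∈ᴾ? ps = p∈

-- Up to renaming of labels, the hexagons which start as prescribed by pre are among ps.
record Complete (test : Tests) (pre : Pattern → Bool) (ps : List Pattern) : Set where
  constructor complete
  field all-listed : allWalks 6 0 (listed? test pre ps) ≡ true

⁺ ⁻ : ∀ {A : Set} → A → Bool × A
⁺ a = true , a
⁻ a = false , a

prefix : Bool → Bool → Bool → Pattern → Bool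
prefix b c same ((b′ , x) ∷ (c′ , y) ∷ _) = not (b xor b′) ∧ not (c xor c′) ∧ not (same xor (x ≡ᵇ y))

-- Invariants of arcs

module _ {G : Graph} where

  inverseᴬ : (σ : Aut G) → ∃[ τ ] ∀ v → app {G} τ (app {G} σ v) ≡ v
  inverseᴬ σ@(f , _) = mkAut {G} (Bijection.to⁻ f) (app {G} σ) left right
      (λ u v a → app-adj⁻ {G} σ _ _ (subst₂ (Adj G) (sym (right u)) (sym (right v)) a)) (app-adj {G} σ) , left
    where
    right : ∀ v → app {G} σ (Bijection.to⁻ f v) ≡ v
    right v = proj₂ (Bijection.strictlySurjective f v)
    left : ∀ v → Bijection.to⁻ f (app {G} σ v) ≡ v
    left v = app-injective {G} σ (right (app {G} σ v))

  -- Vertices may repeat: for m = 3 a triangle traversed twice is allowed.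
  record Hexagon (u v w x y z : V G) : Set where
    field
      uv : Adj G u v
      vw : Adj G v w
      wx : Adj G w x
      xy : Adj G x y
      yz : Adj G y z
      zu : Adj G z u
      u≢w : u ≢ w
      v≢x : v ≢ x
      w≢y : w ≢ y
      x≢z : x ≢ z
      y≢u : y ≢ u
      z≢v : z ≢ v

  hexagon-map : (σ : Aut G) → ∀ {u v w x y z} → Hexagon u v w x y z →
    Hexagon (app {G} σ u) (app {G} σ v) (app {G} σ w) (app {G} σ x) (app {G} σ y) (app {G} σ z)
  hexagon-map σ h = record
    { uv = app-adj {G} σ _ _ uv ; vw = app-adj {G} σ _ _ vw ; wx = app-adj {G} σ _ _ wx
    ; xy = app-adj {G} σ _ _ xy ; yz = app-adj {G} σ _ _ yz ; zu = app-adj {G} σ _ _ zu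
    ; u≢w = u≢w ∘ app-injective {G} σ ; v≢x = v≢x ∘ app-injective {G} σ ; w≢y = w≢y ∘ app-injective {G} σ
    ; x≢z = x≢z ∘ app-injective {G} σ ; y≢u = y≢u ∘ app-injective {G} σ ; z≢v = z≢v ∘ app-injective {G} σ
    }
    where open Hexagon h

  Completable : V G → V G → V G → V G → Set
  Completable u v w x = ∃[ y ] ∃[ z ] Hexagon u v w x y z

  completable-map : (σ : Aut G) → ∀ {u v w x} → Completable u v w x →
    Completable (app {G} σ u) (app {G} σ v) (app {G} σ w) (app {G} σ x)
  completable-map σ (y , z , h) = app {G} σ y , app {G} σ z , hexagon-map σ h

  -- An injection can be composed with an automorphism, so this lower bound is invariant without any
  -- decidability of `P`; upper bounds are its negation.
  MoreThan : ℕ → (V G → Set) → Set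
  MoreThan t P = ∃[ f ] (Injective {A = Fin (suc t)} _≡_ _≡_ f × ∀ i → P (f i))

  ManyExtensions : ℕ → V G → V G → V G → Set
  ManyExtensions t u v w = MoreThan t (Completable u v w)

  manyExtensions-map : ∀ t (σ : Aut G) {u v w} → ManyExtensions t u v w →
    ManyExtensions t (app {G} σ u) (app {G} σ v) (app {G} σ w)
  manyExtensions-map t σ (f , f-inj , h) =
    app {G} σ ∘ f , f-inj ∘ app-injective {G} σ , λ i → completable-map σ (h i)

  Invariant₂ : (V G → V G → Set) → Set
  Invariant₂ P = ∀ σ u v → P u v → P (app {G} σ u) (app {G} σ v)

  Invariant₃ : (V G → V G → V G → Set) → Set
  Invariant₃ Q = ∀ σ u v w → Q u v w → Q (app {G} σ u) (app {G} σ v) (app {G} σ w)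

  Invariant₄ : (V G → V G → V G → V G → Set) → Set
  Invariant₄ R = ∀ σ u v w x → R u v w x → R (app {G} σ u) (app {G} σ v) (app {G} σ w) (app {G} σ x)

  -- Invariance is an implication, but it holds for all automorphisms; applied to the inverse it
  -- gives the converse.
  ¬-invariant₃ : ∀ {Q} → Invariant₃ Q → Invariant₃ (λ u v w → ¬ Q u v w)
  ¬-invariant₃ {Q} Q-inv σ u v w ¬q q with inverseᴬ σ
  ... | τ , e = ¬q (subst (Q u v) (e w) (subst₂ (λ r s → Q r s _) (e u) (e v) (Q-inv τ _ _ _ q)))

  ¬-invariant₄ : ∀ {R} → Invariant₄ R → Invariant₄ (λ u v w x → ¬ R u v w x)
  ¬-invariant₄ {R} R-inv σ u v w x ¬r r with inverseᴬ σ
  ... | τ , e = ¬r (subst₂ (R u v) (e w) (e x) (subst₂ (λ r s → R r s _ _) (e u) (e v) (R-inv τ _ _ _ _ r)))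

  -- Once `Q` recognises straight corners, the corners at v, w, x and y fix the directions of five
  -- steps up to a common sign: ++--+ or --++-.
  Alternating : (V G → V G → V G → Set) → V G → V G → Set
  Alternating Q u v = ∃[ w ] ∃[ x ] ∃[ y ] ∃[ z ]
    (Hexagon u v w x y z × Q u v w × ¬ Q v w x × Q w x y × ¬ Q x y z)

  alternating-invariant : ∀ {Q} → Invariant₃ Q → Invariant₂ (Alternating Q)
  alternating-invariant {Q} Q-inv σ u v (w , x , y , z , h , q₁ , q₂ , q₃ , q₄) =
    app {G} σ w , app {G} σ x , app {G} σ y , app {G} σ z , hexagon-map σ h ,
    Q-inv σ u v w q₁ , ¬-invariant₃ Q-inv σ v w x q₂ , Q-inv σ w x y q₃ , ¬-invariant₃ Q-inv σ x y z q₄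

  -- The same w serves both halves: `R` fails on some way onwards past w, but on no way into u. For
  -- forward arcs w continues with the label i of the arc, the failing path is (+i, +i, +j), and the
  -- paths into u are (s, +i, +i).
  Lopsided : (V G → V G → V G → V G → Set) → V G → V G → Set
  Lopsided R u v = ∃[ w ] ∃[ x ]
    ((Adj G v w × Adj G w x × u ≢ w × v ≢ x × ¬ R u v w x) × (∀ t → Adj G t u → t ≢ v → R t u v w))

  lopsided-invariant : ∀ {R} → Invariant₄ R → Invariant₂ (Lopsided R)
  lopsided-invariant {R} R-inv σ u v (w , x , (vw , wx , u≢w , v≢x , ¬r) , r) =
    app {G} σ w , app {G} σ x ,
    (app-adj {G} σ v w vw , app-adj {G} σ w x wx , u≢w ∘ app-injective {G} σ , v≢x ∘ app-injective {G} σ , ¬-invariant₄ R-inv σ u v w x ¬r) ,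
    extend
    where
    extend : ∀ t → Adj G t (app {G} σ u) → t ≢ app {G} σ v → R t (app {G} σ u) (app {G} σ v) (app {G} σ w)
    extend t tu t≢v with app-surjective {G} σ t
    ... | t′ , refl = R-inv σ t′ u v w (r t′ (app-adj⁻ {G} σ t′ u tu) (t≢v ∘ cong (app {G} σ)))

-- Hexagons of the Bouwer graph as closed walks of labelled steps

module Hexagons (k′ m′ n′ : ℕ) (n∣ : suc n′ ∣ 2 ^ suc m′ ∸ 1) (2<m : 2 < suc m′) (1<n : 1 < suc n′) where

  open Model k′ m′ n′ n∣ public
  open ≈-Reasoning

  Step : Set
  Step = Bool × Label

  step : Step → Vertex → Vertex
  step (true  , p) = up p
  step (false , p) = dn p

  walk : ∀ {t} → Walk Label t → Vertex → Vertex
  walk []      v = v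
  walk (s ∷ w) v = walk w (step s v)

  coord-up : ∀ p q v → coord (up p v) q ≈ coord v q + select (does (p Fin.≟ q)) (weight v)
  coord-up p q v with p Fin.≟ q
  ... | yes refl = coord-up-same p v
  ... | no ne    = ≈-trans (coord-up-other p q v ne) (≡⇒≈ (sym (+-identityʳ _)))

  coord-dn : ∀ p q v → coord v q ≈ coord (dn p v) q + select (does (p Fin.≟ q)) (weight (dn p v))
  coord-dn p q v = subst (λ z → coord z q ≈ coord (dn p v) q + select (does (p Fin.≟ q)) (weight (dn p v))) (up-dn p v) (coord-up p q (dn p v))

  level-dn : ∀ p v → suc (level (dn p v)) M.≈ level v
  level-dn p v = subst (λ z → suc (level (dn p v)) M.≈ level z) (up-dn p v) (M.≈-sym (level-up p (dn p v)))

  weight-dn : ∀ p v → 2 * weight (dn p v) ≈ weight v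
  weight-dn p v = 2^-cong (level-dn p v)

  walk-level : ∀ {t} h (w : Walk Label t) v → t ≤ h → level (walk w v) + h M.≈ level v + height h w
  walk-level h []                v t≤h = M.≈-refl
  walk-level h ((true  , p) ∷ w) v t≤h = M.+-cancelˡ 1 (M.≈-trans (M.≡⇒≈ (sym (+-suc _ h)))
    (M.≈-trans (walk-level (suc h) w (up p v) (m≤n⇒m≤1+n (≤-trans (n≤1+n _) t≤h))) (M.+-congʳ _ (level-up p v))))
  walk-level (suc h) ((false , p) ∷ w) v (s≤s t≤h) = M.≈-trans (M.≡⇒≈ (+-suc _ h))
    (M.≈-trans (M.+-congˡ 1 (walk-level h w (dn p v) t≤h)) (M.+-congʳ _ (level-dn p v)))

  select-cong : ∀ A C b {x y} → A * x ≈ C * y → A * select b x ≈ C * select b y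
  select-cong A C true  e = e
  select-cong A C false e = ≡⇒≈ (trans (*-zeroʳ A) (sym (*-zeroʳ C)))

  -- The true weight of a step is 2 to the level, the formal one 2 to the height; along a walk they
  -- stay in a fixed ratio. Multiplying by `A` and `C` on the two sides expresses this ratio without
  -- division. It is used with `A = 2 ^ h` and `C = weight v`, both of which can be cancelled.
  walk-coord : ∀ {t} q A C h (w : Walk Label t) v → t ≤ h → A * weight v ≈ C * 2 ^ h →
    A * coord (walk w v) q + C * fall (λ x → does (x Fin.≟ q)) h w ≈ A * coord v q + C * rise (λ x → does (x Fin.≟ q)) h w
  walk-coord q A C h [] v t≤h e = ≡⇒≈ (cong (A * coord v q +_) refl)
  walk-coord q A C h ((true , p) ∷ w) v t≤h e = begin
    A * coord (walk w (up p v)) q + C * fall sel (suc h) w          ≈⟨ walk-coord q A C (suc h) w (up p v) (m≤n⇒m≤1+n (≤-trans (n≤1+n _) t≤h)) e′ ⟩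
    A * coord (up p v) q + C * rise sel (suc h) w                   ≈⟨ +-congʳ _ (*-congˡ A (coord-up p q v)) ⟩
    A * (coord v q + select (sel p) (weight v)) + C * rise sel (suc h) w ≡⟨ lemma₁ A (coord v q) _ _ ⟩
    A * coord v q + (A * select (sel p) (weight v) + C * rise sel (suc h) w) ≈⟨ +-congˡ (A * coord v q) (+-congʳ (C * rise sel (suc h) w) (select-cong A C (sel p) e)) ⟩
    A * coord v q + (C * select (sel p) (2 ^ h) + C * rise sel (suc h) w) ≡⟨ cong (A * coord v q +_) (*-distribˡ-+ C _ _) ⟨
    A * coord v q + C * (select (sel p) (2 ^ h) + rise sel (suc h) w) ∎
    where
    sel = λ x → does (x Fin.≟ q)
    lemma₁ : ∀ A c s r → A * (c + s) + r ≡ A * c + (A * s + r)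
    lemma₁ = solve-∀
    lemma₂ : ∀ A w → A * (2 * w) ≡ 2 * (A * w)
    lemma₂ = solve-∀
    e′ : A * weight (up p v) ≈ C * 2 ^ suc h
    e′ = begin
      A * weight (up p v) ≈⟨ *-congˡ A (weight-up p v) ⟩
      A * (2 * weight v)  ≡⟨ lemma₂ A (weight v) ⟩
      2 * (A * weight v)  ≈⟨ *-congˡ 2 e ⟩
      2 * (C * 2 ^ h)     ≡⟨ lemma₂ C (2 ^ h) ⟨
      C * 2 ^ suc h       ∎
  walk-coord q A C (suc h) ((false , p) ∷ w) v (s≤s t≤h) e = begin
    A * coord v′ q + C * (select (sel p) (2 ^ h) + fall sel h w)          ≡⟨ lemma₁ (A * coord v′ q) C (select (sel p) (2 ^ h)) (fall sel h w) ⟩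
    A * coord v′ q + C * fall sel h w + C * select (sel p) (2 ^ h)        ≈⟨ +-cong (walk-coord q A C h w (dn p v) t≤h e′) (≈-sym (select-cong A C (sel p) e′)) ⟩
    A * coord (dn p v) q + C * rise sel h w + A * select (sel p) (weight (dn p v)) ≡⟨ lemma₃ A (coord (dn p v) q) (C * rise sel h w) _ ⟩
    A * (coord (dn p v) q + select (sel p) (weight (dn p v))) + C * rise sel h w ≈⟨ +-congʳ (C * rise sel h w) (*-congˡ A (coord-dn p q v)) ⟨
    A * coord v q + C * rise sel h w ∎
    where
    sel = λ x → does (x Fin.≟ q)
    v′ = walk w (dn p v)
    lemma₁ : ∀ x C s f → x + C * (s + f) ≡ x + C * f + C * s
    lemma₁ = solve-∀
    lemma₂ : ∀ A w → A * (2 * w) ≡ 2 * (A * w)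
    lemma₂ = solve-∀
    lemma₃ : ∀ A c r s → A * c + r + A * s ≡ A * (c + s) + r
    lemma₃ = solve-∀
    e′ : A * weight (dn p v) ≈ C * 2 ^ h
    e′ = 2*-cancel (begin
      2 * (A * weight (dn p v)) ≡⟨ lemma₂ A (weight (dn p v)) ⟨
      A * (2 * weight (dn p v)) ≈⟨ *-congˡ A (weight-dn p v) ⟩
      A * weight v              ≈⟨ e ⟩
      C * (2 * 2 ^ h)           ≡⟨ lemma₂ C (2 ^ h) ⟩
      2 * (C * 2 ^ h)           ∎)

  module _ {t} (h : ℕ) (v : Vertex) (w : Walk Label t) (t≤h : t ≤ h) where

    private
      rise′ fall′ : Label → ℕ
      rise′ q = rise (λ x → does (x Fin.≟ q)) h w
      fall′ q = fall (λ x → does (x Fin.≟ q)) h w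

      walk-coord′ : ∀ q → 2 ^ h * coord (walk w v) q + weight v * fall′ q ≈ 2 ^ h * coord v q + weight v * rise′ q
      walk-coord′ q = walk-coord q (2 ^ h) (weight v) h w v t≤h (≡⇒≈ (*-comm (2 ^ h) (weight v)))

    closed-level : walk w v ≡ v → m ∣ ∣ height h w - h ∣
    closed-level e = M.≈⇒∣ (M.≈-sym (M.+-cancelˡ (level v)
      (subst (λ z → level z + h M.≈ level v + height h w) e (walk-level h w v t≤h))))

    closed-labelSum : walk w v ≡ v → ∀ q → n ∣ ∣ rise′ q - fall′ q ∣
    closed-labelSum e q = ≈⇒∣ (≈-sym (2^*-cancel (level v) (+-cancelˡ (2 ^ h * coord v q)
      (subst (λ z → 2 ^ h * coord z q + weight v * fall′ q ≈ 2 ^ h * coord v q + weight v * rise′ q) e (walk-coord′ q)))))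

    closed : m ∣ ∣ height h w - h ∣ → (∀ q → n ∣ ∣ rise′ q - fall′ q ∣) → walk w v ≡ v
    closed m∣ n∣ = coord-extensional
      (cong toℕ {x = proj₁ (walk w v)} (M.toℕ-injective-≈ (M.+-cancelʳ h (M.≈-trans (walk-level h w v t≤h) (M.+-congˡ (level v) (M.∣⇒≈ m∣))))))
      (λ j → let q = suc j in 2^*-cancel h (+-cancelʳ (weight v * fall′ q)
        (≈-trans (walk-coord′ q) (+-congˡ (2 ^ h * coord v q) (*-congˡ (weight v) (∣⇒≈ (n∣ q)))))))

  ¬1≈0 : ¬ 1 ≈ 0
  ¬1≈0 e with ∣⇒≤ (≈⇒∣ e)
  ... | n≤1 = <⇒≱ 1<n n≤1

  ¬weight≈0 : ∀ v → ¬ weight v ≈ 0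
  ¬weight≈0 v e = ¬1≈0 (2^*-cancel (level v) (≈-trans (≡⇒≈ (*-identityʳ (weight v))) (≈-trans e (≡⇒≈ (sym (*-zeroʳ (weight v)))))))

  up-label-injective : ∀ p q v → up p v ≡ up q v → p ≡ q
  up-label-injective p q v e with p Fin.≟ q
  ... | yes p≡q = p≡q
  ... | no p≢q  = ⊥-elim (¬weight≈0 v (+-cancelˡ (coord v p) (begin
    coord v p + weight v ≈⟨ coord-up-same p v ⟨
    coord (up p v) p     ≡⟨ cong (λ z → coord z p) e ⟩
    coord (up q v) p     ≈⟨ coord-up-other q p v (p≢q ∘ sym) ⟩
    coord v p            ≡⟨ +-identityʳ _ ⟨
    coord v p + 0        ∎)))

  -- The two levels differ by 2, which is nonzero modulo `m` because `2 < m`.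
  up≢dn : ∀ p q v → up p v ≢ dn q v
  up≢dn p q v e = <⇒≱ 2<m (∣⇒≤ (M.≈⇒∣ {2} {0} (M.+-cancelˡ (level v) (M.≈-trans (M.≡⇒≈ (+-comm (level v) 2))
    (M.≈-trans (M.+-congˡ 1 (M.≈-sym (level-up p v))) (M.≈-trans (M.≡⇒≈ (cong (suc ∘ level) e))
      (M.≈-trans (level-dn q v) (M.≡⇒≈ (sym (+-identityʳ _))))))))))

  step-injective : ∀ s t v → step s v ≡ step t v → s ≡ t
  step-injective (true  , p) (true  , q) v e = cong (true ,_) (up-label-injective p q v e)
  step-injective (true  , p) (false , q) v e = ⊥-elim (up≢dn p q v e)
  step-injective (false , p) (true  , q) v e = ⊥-elim (up≢dn q p v (sym e))
  step-injective (false , p) (false , q) v e = cong (false ,_) (up-label-injective p q (dn p v)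
    (trans (up-dn p v) (sym (trans (cong (up q) e) (up-dn q v)))))

  inv : Step → Step
  inv (b , p) = not b , p

  step-inv : ∀ s v → step (inv s) (step s v) ≡ v
  step-inv (true  , p) v = dn-up p v
  step-inv (false , p) v = up-dn p v

  adj-step : ∀ s v → BAdj v (step s v)
  adj-step (true  , p) v = inj₁ (up-step p v)
  adj-step (false , p) v = inj₂ (subst (BStep (dn p v)) (up-dn p v) (up-step p (dn p v)))

  step-adj : ∀ u v → BAdj u v → ∃[ s ] v ≡ step s u
  step-adj u v (inj₁ r) = let p , e = step-up u v r in (true , p) , e
  step-adj u v (inj₂ r) with step-up v u r
  ... | p , refl = (false , p) , sym (dn-up p v)

  noTurn⇒ : ∀ s t v → noTurn Fin._≟_ s t ≡ true → v ≢ step t (step s v)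
  noTurn⇒ s t v nt e with step-injective t (inv s) (step s v) (trans (sym e) (sym (step-inv s v)))
  noTurn⇒ (true  , p) _ v nt e | refl rewrite dec-true (p Fin.≟ p) refl with () ← nt
  noTurn⇒ (false , p) _ v nt e | refl rewrite dec-true (p Fin.≟ p) refl with () ← nt

  ⇒noTurn : ∀ s t v → v ≢ step t (step s v) → noTurn Fin._≟_ s t ≡ true
  ⇒noTurn (true  , p) (true  , q) v ne = refl
  ⇒noTurn (false , p) (false , q) v ne = refl
  ⇒noTurn (true  , p) (false , q) v ne with p Fin.≟ q
  ... | yes refl = ⊥-elim (ne (sym (dn-up p v)))
  ... | no _     = refl
  ⇒noTurn (false , p) (true  , q) v ne with p Fin.≟ q
  ... | yes refl = ⊥-elim (ne (sym (up-dn p v)))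
  ... | no _     = refl

  -- Matching on the view replaces the vertices by those of a walk from u, so that a hexagon becomes
  -- a word of six steps.
  data HexagonView (u : Vertex) : (v w x y z : Vertex) → Set where
    view : ∀ s₀ s₁ s₂ s₃ s₄ s₅ → let ω = s₀ ∷ s₁ ∷ s₂ ∷ s₃ ∷ s₄ ∷ s₅ ∷ [] in
      walk ω u ≡ u → noBacktracking Fin._≟_ ω ≡ true →
      HexagonView u (step s₀ u) (step s₁ (step s₀ u)) (step s₂ (step s₁ (step s₀ u)))
        (step s₃ (step s₂ (step s₁ (step s₀ u)))) (step s₄ (step s₃ (step s₂ (step s₁ (step s₀ u)))))

  Hex : (u v w x y z : Vertex) → Set
  Hex = Hexagon {B}

  hexagonView : ∀ {u v w x y z} → Hex u v w x y z → HexagonView u v w x y z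
  hexagonView {u} {v} {w} {x} {y} {z} h =
    fromSteps (step-adj u v uv) (step-adj v w vw) (step-adj w x wx) (step-adj x y xy) (step-adj y z yz) (step-adj z u zu) u≢w v≢x w≢y x≢z y≢u z≢v
    where
    open Hexagon h
    fromSteps : ∀ {v w x y z} → ∃[ s ] v ≡ step s u → ∃[ s ] w ≡ step s v → ∃[ s ] x ≡ step s w →
      ∃[ s ] y ≡ step s x → ∃[ s ] z ≡ step s y → ∃[ s ] u ≡ step s z →
      u ≢ w → v ≢ x → w ≢ y → x ≢ z → y ≢ u → z ≢ v → HexagonView u v w x y z
    fromSteps (s₀ , refl) (s₁ , refl) (s₂ , refl) (s₃ , refl) (s₄ , refl) (s₅ , e) n₀ n₁ n₂ n₃ n₄ n₅ =
      view s₀ s₁ s₂ s₃ s₄ s₅ (sym e)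
        (∧-intro (⇒noTurn s₀ s₁ _ n₀) (∧-intro (⇒noTurn s₁ s₂ _ n₁) (∧-intro (⇒noTurn s₂ s₃ _ n₂)
          (∧-intro (⇒noTurn s₃ s₄ _ n₃) (∧-intro (⇒noTurn s₄ s₅ _ (λ e′ → n₄ (trans e′ (sym e))))
            (⇒noTurn s₅ s₀ _ (λ e′ → n₅ (trans e′ (cong (step s₀) (sym e))))))))))

  unview : ∀ {u v w x y z} → HexagonView u v w x y z → Hex u v w x y z
  unview {u} {v} {w} {x} {y} {z} (view s₀ s₁ s₂ s₃ s₄ s₅ e nb) with ∧-true {noTurn Fin._≟_ s₀ s₁} nb
  ... | n₀ , nb₁ with ∧-true {noTurn Fin._≟_ s₁ s₂} nb₁
  ... | n₁ , nb₂ with ∧-true {noTurn Fin._≟_ s₂ s₃} nb₂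
  ... | n₂ , nb₃ with ∧-true {noTurn Fin._≟_ s₃ s₄} nb₃
  ... | n₃ , nb₄ with ∧-true {noTurn Fin._≟_ s₄ s₅} nb₄
  ... | n₄ , n₅ = record
    { uv = adj-step s₀ u ; vw = adj-step s₁ v ; wx = adj-step s₂ w ; xy = adj-step s₃ x ; yz = adj-step s₄ y
    ; zu = subst (BAdj z) e (adj-step s₅ z)
    ; u≢w = noTurn⇒ s₀ s₁ u n₀ ; v≢x = noTurn⇒ s₁ s₂ v n₁ ; w≢y = noTurn⇒ s₂ s₃ w n₂ ; x≢z = noTurn⇒ s₃ s₄ x n₃
    ; y≢u = λ e′ → noTurn⇒ s₄ s₅ y n₄ (trans e′ (sym e))
    ; z≢v = λ e′ → noTurn⇒ s₅ s₀ z n₅ (trans e′ (cong (step s₀) (sym e))) }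

  -- The two directions are used separately. A sound test accepts all multiples and perhaps more, so
  -- an enumeration with it misses no hexagon. An exact test accepts nothing but multiples, so a
  -- walk without backtracking that passes it is a hexagon.
  Sound Exact : Tests → Set
  Sound test = (∀ d → m ∣ d → level? test d ≡ true) × (∀ d → n ∣ d → sum? test d ≡ true)
  Exact test = (∀ d → level? test d ≡ true → m ∣ d) × (∀ d → sum? test d ≡ true → n ∣ d)

  labelSums?-sound : ∀ test → Sound test → ∀ {t} (w′ : Walk Label t) w → (∀ q → n ∣ labelSum Fin._≟_ q w) →
    labelSums? Fin._≟_ (sum? test) w′ w ≡ true
  labelSums?-sound test sound []             w h = refl
  labelSums?-sound test sound ((_ , q) ∷ w′) w h = ∧-intro (proj₂ sound _ (h q)) (labelSums?-sound test sound w′ w h)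

  hexagon?-sound : ∀ test → Sound test → ∀ u ω → walk ω u ≡ u → noBacktracking Fin._≟_ ω ≡ true → hexagon? Fin._≟_ test ω ≡ true
  hexagon?-sound test sound u ω e nb = ∧-intro nb (∧-intro (proj₁ sound _ (closed-level 6 u ω ≤-refl e))
    (labelSums?-sound test sound ω ω (closed-labelSum 6 u ω ≤-refl e)))

  -- In the second alternative q does not occur in w′.
  labelSums?-exact : ∀ test → Exact test → ∀ {t} (w′ : Walk Label t) w → labelSums? Fin._≟_ (sum? test) w′ w ≡ true →
    ∀ q → (n ∣ labelSum Fin._≟_ q w) ⊎ (∀ h → rise (λ x → does (x Fin.≟ q)) h w′ ≡ 0 × fall (λ x → does (x Fin.≟ q)) h w′ ≡ 0)
  labelSums?-exact test exact []             w e q = inj₂ λ h → refl , refl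
  labelSums?-exact test exact ((b , p) ∷ w′) w e q with ∧-true {sum? test (labelSum Fin._≟_ p w)} e
  ... | e₁ , e₂ with p Fin.≟ q | labelSums?-exact test exact w′ w e₂ q
  ...   | yes refl | _       = inj₁ (proj₂ exact _ e₁)
  ...   | no _     | inj₁ d  = inj₁ d
  ...   | no p≢q   | inj₂ z  = inj₂ (λ h → extend b h)
    where
    extend : ∀ b h → rise (λ x → does (x Fin.≟ q)) h ((b , p) ∷ w′) ≡ 0 × fall (λ x → does (x Fin.≟ q)) h ((b , p) ∷ w′) ≡ 0
    extend true  h rewrite dec-false (p Fin.≟ q) p≢q = z (suc h)
    extend false h rewrite dec-false (p Fin.≟ q) p≢q = z (pred h)

  hexagon?-exact : ∀ test → Exact test → ∀ ω → hexagon? Fin._≟_ test ω ≡ true →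
    (∀ u → walk ω u ≡ u) × noBacktracking Fin._≟_ ω ≡ true
  hexagon?-exact test exact ω e with ∧-true {noBacktracking Fin._≟_ ω} e
  ... | nb , e₁ with ∧-true {level? test ∣ height 6 ω - 6 ∣} e₁
  ...   | l , s = (λ u → closed 6 u ω ≤-refl (proj₁ exact _ l) sums) , nb
    where
    sums : ∀ q → n ∣ labelSum Fin._≟_ q ω
    sums q with labelSums?-exact test exact ω ω s q
    ... | inj₁ d = d
    ... | inj₂ z rewrite proj₁ (z 6) | proj₂ (z 6) = n ∣0

  hexagonAt : ∀ test → Exact test → ∀ {t} (g : Fin t → Label) → (∀ {a b} → g a ≡ g b → a ≡ b) →
    ∀ s₀ s₁ s₂ s₃ s₄ s₅ → hexagon? Fin._≟_ test (s₀ ∷ s₁ ∷ s₂ ∷ s₃ ∷ s₄ ∷ s₅ ∷ []) ≡ true → ∀ u →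
    let v = step (map₂ g s₀) u ; w = step (map₂ g s₁) v ; x = step (map₂ g s₂) w ; y = step (map₂ g s₃) x in
    Hex u v w x y (step (map₂ g s₄) y)
  hexagonAt test exact g g-inj s₀ s₁ s₂ s₃ s₄ s₅ e u =
    let c , nb = hexagon?-exact test exact (relabelʷ g ω) (trans (hexagon?-relabel Fin._≟_ Fin._≟_ g g-inj test ω) e) in
    unview (view (map₂ g s₀) (map₂ g s₁) (map₂ g s₂) (map₂ g s₃) (map₂ g s₄) (map₂ g s₅) (c u) nb)
    where ω = s₀ ∷ s₁ ∷ s₂ ∷ s₃ ∷ s₄ ∷ s₅ ∷ []

  -- An inductive form of `relabelʷ f w ≡ p`. Matching yields one equation per step: equal numbers
  -- in the pattern give equal labels by injectivity of `f`, different numbers give different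
  -- labels.
  data Realizes (f : Label → ℕ) : ∀ {t} → Walk Label t → Walk ℕ t → Set where
    []  : Realizes f [] []
    _∷_ : ∀ {b l c t} {w : Walk Label t} {p} → f l ≡ c → Realizes f w p → Realizes f ((b , l) ∷ w) ((b , c) ∷ p)

  realizes-relabel : ∀ f {t} (w : Walk Label t) → Realizes f w (relabelʷ f w)
  realizes-relabel f []      = []
  realizes-relabel f (s ∷ w) = refl ∷ realizes-relabel f w

  classify : ∀ test → Sound test → ∀ pre ps → Complete test pre ps →
    ∀ u ω → walk ω u ≡ u → noBacktracking Fin._≟_ ω ≡ true →
    (∀ f → (∀ {x y} → f x ≡ f y → x ≡ y) → pre (relabelʷ f ω) ≡ true) →
    ∃[ p ] (p ∈ ps × ∃[ f ] ((∀ {x y} → f x ≡ f y → x ≡ y) × Realizes f ω p))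
  classify test sound pre ps (complete comp) u ω c nb pre-ok =
    let f , f-inj , e = allWalks-relabel Fin._≟_ (allFin k) ∈-allFin (listed? test pre ps) comp ω in
    relabelʷ f ω ,
    listed?-sound test pre ps (relabelʷ f ω) e (pre-ok f f-inj)
      (trans (hexagon?-relabel Fin._≟_ Data.Nat.Properties._≟_ f f-inj test ω) (hexagon?-sound test sound u ω c nb)) ,
    f , f-inj , realizes-relabel f ω

  prefix-diff : ∀ b c i j (w : Walk Label 4) → i ≢ j → ∀ f → (∀ {x y} → f x ≡ f y → x ≡ y) →
    prefix b c false (relabelʷ f ((b , i) ∷ (c , j) ∷ w)) ≡ true
  prefix-diff b c i j w i≢j f f-inj rewrite dec-false (f i Data.Nat.Properties.≟ f j) (i≢j ∘ f-inj) with b | c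
  ... | true  | true  = refl
  ... | true  | false = refl
  ... | false | true  = refl
  ... | false | false = refl

  prefix-same : ∀ b c i (w : Walk Label 4) → ∀ f → (∀ {x y} → f x ≡ f y → x ≡ y) →
    prefix b c true (relabelʷ f ((b , i) ∷ (c , i) ∷ w)) ≡ true
  prefix-same b c i w f f-inj rewrite dec-true (f i Data.Nat.Properties.≟ f i) refl with b | c
  ... | true  | true  = refl
  ... | true  | false = refl
  ... | false | true  = refl
  ... | false | false = refl

witness : ∀ {P : Set} (P? : Dec P) → does P? ≡ true → P
witness (yes p) _ = p

zero? : ℕ → Bool
zero? x = does (x Data.Nat.Properties.≟ 0)

zero?-exact : ∀ e x → zero? x ≡ true → e ∣ x
zero?-exact e x h = subst (e ∣_) (sym (witness (x Data.Nat.Properties.≟ 0) h)) (e ∣0)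

-- Criteria against arc-transitivity

module Corners (k′ m′ n′ : ℕ) (n∣ : suc n′ ∣ 2 ^ suc m′ ∸ 1) (2<m : 2 < suc m′) (1<n : 1 < suc n′) where

  open Hexagons k′ m′ n′ n∣ 2<m 1<n public

  ¬arcTransitive : ∀ P → Invariant₂ {B} P → P origin (up zero origin) → (∀ u a → ¬ P u (dn a u)) → ¬ ArcTransitive B
  ¬arcTransitive P P-inv forward backward AT =
    let σ , e , f = AT origin (up zero origin) origin (dn zero origin) (adj-step (true , zero) origin) (adj-step (false , zero) origin) in
    backward origin zero (subst₂ P e f (P-inv σ _ _ forward))

  data Tail (u : Vertex) (s₀ s₁ : Step) : (x y z : Vertex) → Set where
    tail : ∀ s₂ s₃ s₄ s₅ → let ω = s₀ ∷ s₁ ∷ s₂ ∷ s₃ ∷ s₄ ∷ s₅ ∷ [] ; w = step s₁ (step s₀ u) in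
      walk ω u ≡ u → noBacktracking Fin._≟_ ω ≡ true →
      Tail u s₀ s₁ (step s₂ w) (step s₃ (step s₂ w)) (step s₄ (step s₃ (step s₂ w)))

  toTail : ∀ {u v w x y z} s₀ s₁ → v ≡ step s₀ u → w ≡ step s₁ v → HexagonView u v w x y z → Tail u s₀ s₁ x y z
  toTail {u} s₀ s₁ e₀ e₁ (view t₀ t₁ t₂ t₃ t₄ t₅ c nb) with step-injective t₀ s₀ u e₀
  ... | refl with step-injective t₁ s₁ (step s₀ u) e₁
  ...   | refl = tail t₂ t₃ t₄ t₅ c nb

  data Classified (ps : List Pattern) (u : Vertex) (s₀ s₁ : Step) : (x y z : Vertex) → Set where
    classified : ∀ {s₂ s₃ s₄ s₅ p f} → let w = step s₁ (step s₀ u) in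
      p ∈ ps → (∀ {x y} → f x ≡ f y → x ≡ y) → Realizes f (s₀ ∷ s₁ ∷ s₂ ∷ s₃ ∷ s₄ ∷ s₅ ∷ []) p →
      Classified ps u s₀ s₁ (step s₂ w) (step s₃ (step s₂ w)) (step s₄ (step s₃ (step s₂ w)))

  module _ (test : Tests) (sound : Sound test) {ps : List Pattern} where

    classifyTail : ∀ {u s₀ s₁ x y z} pre → Complete test pre ps →
      (∀ (w : Walk Label 4) f → (∀ {x y} → f x ≡ f y → x ≡ y) → pre (relabelʷ f (s₀ ∷ s₁ ∷ w)) ≡ true) →
      Tail u s₀ s₁ x y z → Classified ps u s₀ s₁ x y z
    classifyTail {u} pre comp pre-ok (tail s₂ s₃ s₄ s₅ c nb) =
      let p , p∈ , f , f-inj , r = classify test sound pre ps comp u _ c nb (pre-ok (s₂ ∷ s₃ ∷ s₄ ∷ s₅ ∷ [])) in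
      classified p∈ f-inj r

    classify-≢ : ∀ {u x y z} b c {i j} → Complete test (prefix b c false) ps → i ≢ j →
      Hex u (step (b , i) u) (step (c , j) (step (b , i) u)) x y z → Classified ps u (b , i) (c , j) x y z
    classify-≢ b c {i} {j} comp i≢j h = classifyTail (prefix b c false) comp (λ w → prefix-diff b c i j w i≢j)
      (toTail _ _ refl refl (hexagonView h))

    classify-≡ : ∀ {u x y z} b c {i} → Complete test (prefix b c true) ps →
      Hex u (step (b , i) u) (step (c , i) (step (b , i) u)) x y z → Classified ps u (b , i) (c , i) x y z
    classify-≡ b c {i} comp h = classifyTail (prefix b c true) comp (prefix-same b c i) (toTail _ _ refl refl (hexagonView h))

  at : ∀ test → Exact test → ∀ {t} {ls : Vec Label t} → Unique ls →
    ∀ s₀ s₁ s₂ s₃ s₄ s₅ → hexagon? Fin._≟_ test (s₀ ∷ s₁ ∷ s₂ ∷ s₃ ∷ s₄ ∷ s₅ ∷ []) ≡ true → ∀ u →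
    let v = step (map₂ (lookup ls) s₀) u ; w = step (map₂ (lookup ls) s₁) v
        x = step (map₂ (lookup ls) s₂) w ; y = step (map₂ (lookup ls) s₃) x in
    Hex u v w x y (step (map₂ (lookup ls) s₄) y)
  at test exact {ls = ls} unique = hexagonAt test exact (lookup ls) (lookup-injective unique _ _)

  unique₁ : ∀ i → Unique {A = Label} (i ∷ [])
  unique₁ i = [] ∷ []

  unique₂ : ∀ {i j} → i ≢ j → Unique {A = Label} (i ∷ j ∷ [])
  unique₂ i≢j = (i≢j ∷ []) ∷ [] ∷ []

  unique₃ : ∀ {i j l} → i ≢ j → i ≢ l → j ≢ l → Unique {A = Label} (i ∷ j ∷ l ∷ [])
  unique₃ i≢j i≢l j≢l = (i≢j ∷ i≢l ∷ []) ∷ (j≢l ∷ []) ∷ [] ∷ []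

  Many : ℕ → Vertex → Vertex → Vertex → Set
  Many = ManyExtensions {B}

  Comp : Vertex → Vertex → Vertex → Vertex → Set
  Comp = Completable {B}

  many : ∀ {t u v w} {es : Vec Step (suc t)} → Unique es → (∀ i → Comp u v w (step (lookup es i) w)) → Many t u v w
  many {w = w} {es} unique h = (λ i → step (lookup es i) w) , (λ {i} {j} e → lookup-injective unique i j (step-injective _ _ w e)) , h

  few : ∀ {t u v w} (g : Fin t → Step) → (∀ x → Comp u v w x → ∃[ c ] x ≡ step (g c) w) → ¬ Many t u v w
  few {t} {w = w} g h (f , f-inj , c) with Fin.pigeonhole (n<1+n t) (λ i → proj₁ (h (f i) (c i)))
  ... | i , j , i<j , e = Fin.<⇒≢ i<j (f-inj (trans (proj₂ (h (f i) (c i)))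
    (trans (cong (λ a → step (g a) w) e) (sym (proj₂ (h (f j) (c j)))))))

  -- Walks accepted by `zero?` close up already over the integers, hence for all `m` and `n`.
  zero-exact : Exact (tests zero? zero?)
  zero-exact = zero?-exact m , zero?-exact n

  -- The hexagon +0 +j -0 -j +0 -j, present for all parameters, makes a forward arc alternating, and
  -- all its corners have two labels. From a backward arc, a start -a +b has a ≠ b because a hexagon
  -- does not turn back, and the fourth corner hypothesis rejects it; what is left are starts with
  -- two descents.
  alternating-criterion : (Q : Vertex → Vertex → Vertex → Set) → Invariant₃ {B} Q → ∀ (i : Label) → zero ≢ i →
    (∀ u {i j} → i ≢ j → Q u (up i u) (up j (up i u))) →
    (∀ u {i j} → i ≢ j → Q u (dn i u) (dn j (dn i u))) →
    (∀ u {i j} → i ≢ j → ¬ Q u (up i u) (dn j (up i u))) →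
    (∀ u {i j} → i ≢ j → ¬ Q u (dn i u) (up j (dn i u))) →
    (∀ u a b x y z → let v = dn a u ; w = dn b v in
      Hex u v w x y z → Q u v w → ¬ Q v w x → Q w x y → ¬ Q x y z → ⊥) →
    ¬ ArcTransitive B
  alternating-criterion Q Q-inv j 0≢j q++ q-- q+- q-+ descending =
    ¬arcTransitive (Alternating {B} Q) (alternating-invariant {B} Q-inv) forward backward
    where
    forward : Alternating {B} Q origin (up zero origin)
    forward = _ , _ , _ , _ ,
      at (tests zero? zero?) zero-exact (unique₂ 0≢j) (⁺ 0F) (⁺ 1F) (⁻ 0F) (⁻ 1F) (⁺ 0F) (⁻ 1F) refl origin ,
      q++ _ 0≢j , q+- _ (0≢j ∘ sym) , q-- _ 0≢j , q-+ _ (0≢j ∘ sym)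
    backward : ∀ u a → ¬ Alternating {B} Q u (dn a u)
    backward u a (w , x , y , z , h , q₁ , q₂ , q₃ , q₄) = cases (step-adj (dn a u) w (Hexagon.vw h)) h q₁ q₂ q₃ q₄
      where
      cases : ∀ {w} → ∃[ s ] w ≡ step s (dn a u) → Hex u (dn a u) w x y z → Q u (dn a u) w → ¬ Q (dn a u) w x → Q w x y → ¬ Q x y z → ⊥
      cases ((false , b) , refl) h q₁ q₂ q₃ q₄ = descending u a b x y z h q₁ q₂ q₃ q₄
      cases ((true , b) , refl) h q₁ q₂ q₃ q₄ = q-+ u (λ { refl → Hexagon.u≢w h (sym (up-dn a u)) }) q₁

  lopsided-criterion : (R : Vertex → Vertex → Vertex → Vertex → Set) → Invariant₄ {B} R → ∀ (j : Label) → zero ≢ j →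
    (∀ u {i j} → i ≢ j → ¬ R u (up i u) (up i (up i u)) (up j (up i (up i u)))) →
    (∀ t i s → noTurn Fin._≟_ s (true , i) ≡ true → let u = step s t in R t u (up i u) (up i (up i u))) →
    (∀ u a b x → let v = dn a u ; w = dn b v in
      BAdj w x → v ≢ x → ¬ R u v w x → (∀ t → BAdj t u → t ≢ v → R t u v w) → ⊥) →
    (∀ u {a b} x → a ≢ b → let v = dn a u ; w = up b v in
      BAdj w x → v ≢ x → ¬ R u v w x → (∀ t → BAdj t u → t ≢ v → R t u v w) → ⊥) →
    ¬ ArcTransitive B
  lopsided-criterion R R-inv j 0≢j last first descending valley =
    ¬arcTransitive (Lopsided {B} R) (lopsided-invariant {B} R-inv) forward backward
    where
    v₀ = up zero origin
    forward : Lopsided {B} R origin (up zero origin)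
    forward = up zero v₀ , up j (up zero v₀) ,
      (adj-step (⁺ zero) v₀ , adj-step (⁺ j) (up zero v₀) , noTurn⇒ (⁺ zero) (⁺ zero) origin refl , noTurn⇒ (⁺ zero) (⁺ j) v₀ refl , last origin 0≢j) ,
      λ t tu t≢v → extend (step-adj t origin tu) t≢v
      where
      extend : ∀ {t u} → ∃[ s ] u ≡ step s t → t ≢ up zero u → R t u (up zero u) (up zero (up zero u))
      extend (s , refl) t≢v = first _ zero s (⇒noTurn s (⁺ zero) _ t≢v)
    backward : ∀ u a → ¬ Lopsided {B} R u (dn a u)
    backward u a (w , x , (vw , wx , u≢w , v≢x , ¬r) , r) = cases (step-adj (dn a u) w vw) wx u≢w ¬r r
      where
      cases : ∀ {w} → ∃[ s ] w ≡ step s (dn a u) → BAdj w x → u ≢ w → ¬ R u (dn a u) w x → (∀ t → BAdj t u → t ≢ dn a u → R t u (dn a u) w) → ⊥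
      cases ((false , b) , refl) wx u≢w ¬r r = descending u a b x wx v≢x ¬r r
      cases ((true , b) , refl)  wx u≢w ¬r r = valley u x (λ { refl → u≢w (sym (up-dn a u)) }) wx v≢x ¬r r

  module ByCount (t : ℕ) where

    ¬Many : Vertex → Vertex → Vertex → Set
    ¬Many u v w = ¬ Many t u v w

    many-invariant : Invariant₃ {B} (Many t)
    many-invariant σ u v w = manyExtensions-map {B} t σ

    -- Turns have more than t extensions and straight corners with two labels at most t, so `Q` is
    -- the negated count. Nothing is fixed for straight corners with one label. For -a -b with a ≠ b
    -- the alternation has to break at w or x, for -a -a at v or w.
    few-criterion : ∀ (i : Label) → zero ≢ i →
      (∀ u {i j} → i ≢ j → ¬ Many t u (up i u) (up j (up i u))) →
      (∀ u {i j} → i ≢ j → ¬ Many t u (dn i u) (dn j (dn i u))) →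
      (∀ u {i j} → i ≢ j → Many t u (up i u) (dn j (up i u))) →
      (∀ u {i j} → i ≢ j → Many t u (dn i u) (up j (dn i u))) →
      (∀ u {a b} x y z → a ≢ b → let v = dn a u ; w = dn b v in Hex u v w x y z → ¬ Many t v w x ⊎ Many t w x y) →
      (∀ u a x y z → let v = dn a u ; w = dn a v in Hex u v w x y z → Many t u v w ⊎ ¬ Many t v w x) →
      ¬ ArcTransitive B
    few-criterion i 0≢i q++ q-- q+- q-+ d s = alternating-criterion ¬Many (¬-invariant₃ {B} many-invariant) i 0≢i q++ q--
      (λ u ne ¬M → ¬M (q+- u ne)) (λ u ne ¬M → ¬M (q-+ u ne)) descending
      where
      descending : ∀ u a b x y z → let v = dn a u ; w = dn b v in
        Hex u v w x y z → ¬Many u v w → ¬ ¬Many v w x → ¬Many w x y → ¬ ¬Many x y z → ⊥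
      descending u a b x y z h q₁ q₂ q₃ q₄ with a Fin.≟ b
      descending u a b x y z h q₁ q₂ q₃ q₄ | no a≢b with d u x y z a≢b h
      ... | inj₁ ¬M = q₂ ¬M
      ... | inj₂ M  = q₃ M
      descending u a b x y z h q₁ q₂ q₃ q₄ | yes refl with s u a x y z h
      ... | inj₁ M  = q₁ M
      ... | inj₂ ¬M = q₂ ¬M

-- The cases which are not arc-transitive

divisible? : ℕ → ℕ → Bool
divisible? d x = does (d ∣? x)

-- Rejects finitely many known non-multiples and accepts everything else. This is sound for a
-- modulus that is merely known to be large, and it still evaluates.
avoids? : List ℕ → ℕ → Bool
avoids? ds d = not (does (DecMembership._∈?_ Data.Nat.Properties._≟_ d ds))

divisible?-sound : ∀ {e} d → d ∣ e → ∀ x → e ∣ x → divisible? d x ≡ true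
divisible?-sound d d∣e x e∣x = dec-true (d ∣? x) (∣-trans d∣e e∣x)

divisible?-exact : ∀ {e} d → e ∣ d → ∀ x → divisible? d x ≡ true → e ∣ x
divisible?-exact d e∣d x h = ∣-trans e∣d (witness (d ∣? x) h)

avoids?-sound : ∀ {e} ds → (∀ d → d ∈ ds → ¬ e ∣ d) → ∀ x → e ∣ x → avoids? ds x ≡ true
avoids?-sound ds h x e∣x = cong not (dec-false (DecMembership._∈?_ Data.Nat.Properties._≟_ x ds) (λ x∈ → h x x∈ e∣x))

-- 5 is missing so that m = 5 can be treated like the case m > 6: level changes of 6-walks are even.
levels : List ℕ
levels = 1 ∷ 2 ∷ 3 ∷ 4 ∷ 6 ∷ []

∤-between : ∀ {b e d} → 0 < d × d ≤ b → b < e → ¬ e ∣ d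
∤-between (0<d , d≤b) b<e e∣d = <⇒≱ b<e (≤-trans (∣⇒≤ ⦃ >-nonZero 0<d ⦄ e∣d) d≤b)

level-large : ∀ {m} → 6 < m → ∀ d → d ∈ levels → ¬ m ∣ d
level-large 6<m d d∈ =
  ∤-between (All.lookup (toWitness {a? = All.all? (λ d → (0 <? d) ×-dec (d ≤? 6)) levels} _) d∈) 6<m

level-5 : ∀ d → d ∈ levels → ¬ 5 ∣ d
level-5 d = All.lookup (toWitness {a? = All.all? (λ d → ¬? (5 ∣? d)) levels} _)

odds : List ℕ
odds = 1 ∷ 3 ∷ 5 ∷ 7 ∷ []

-- Six steps from height 6 never exceed height 12, which bounds the exponents.
smallSums : List ℕ
smallSums = cartesianProductWith (λ e o → 2 ^ e * o) (upTo 13) odds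

module GenericCase (k″ m′ n′ : ℕ) (n∣ : suc n′ ∣ 2 ^ suc m′ ∸ 1) (2<m : 2 < suc m′) (1<n : 1 < suc n′) where

  open Corners (suc k″) m′ n′ n∣ 2<m 1<n public
  open ByCount

  -- The nonzero label sums of walks without level change are ± 2ᵉ o with o odd and at most 7.
  smallSums-sound : 7 < n → ∀ d → d ∈ smallSums → ¬ n ∣ d
  smallSums-sound 7<n d d∈ n∣d with ∈-cartesianProductWith⁻ (λ e o → 2 ^ e * o) (upTo 13) odds d∈
  ... | e , o , e∈ , o∈ , refl =
    ∤-between (All.lookup (toWitness {a? = All.all? (λ d → (0 <? d) ×-dec (d ≤? 7)) odds} _) o∈) 7<n
      (subst (n ∣_) (∣-∣-identityʳ o) (≈⇒∣ (2^*-cancel e (≈-trans (∣⇒≈0 n∣d) (≡⇒≈ (sym (*-zeroʳ (2 ^ e))))))))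

  other : ∀ (i : Label) → ∃[ j ] i ≢ j
  other zero    = 1F , λ ()
  other (suc i) = 0F , λ ()

  -- Both hexagons are the one present for all parameters, read from one of its turns, up to
  -- exchanging the labels.
  peak : ∀ u {i j} → i ≢ j → Many 1 u (up i u) (dn j (up i u))
  peak u {i} {j} i≢j = many {es = ⁺ i ∷ ⁻ i ∷ []} (((λ ()) ∷ []) ∷ [] ∷ [])
    λ { 0F → _ , _ , at (tests zero? zero?) zero-exact (unique₂ i≢j) (⁺ 0F) (⁻ 1F) (⁺ 0F) (⁺ 1F) (⁻ 0F) (⁻ 1F) refl u
      ; 1F → _ , _ , at (tests zero? zero?) zero-exact (unique₂ i≢j) (⁺ 0F) (⁻ 1F) (⁻ 0F) (⁺ 1F) (⁻ 0F) (⁺ 1F) refl u }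

  valley : ∀ u {i j} → i ≢ j → Many 1 u (dn i u) (up j (dn i u))
  valley u {i} {j} i≢j = many {es = ⁺ i ∷ ⁻ i ∷ []} (((λ ()) ∷ []) ∷ [] ∷ [])
    λ { 0F → _ , _ , at (tests zero? zero?) zero-exact (unique₂ i≢j) (⁻ 0F) (⁺ 1F) (⁺ 0F) (⁻ 1F) (⁻ 0F) (⁺ 1F) refl u
      ; 1F → _ , _ , at (tests zero? zero?) zero-exact (unique₂ i≢j) (⁻ 0F) (⁺ 1F) (⁻ 0F) (⁺ 1F) (⁺ 0F) (⁻ 1F) refl u }

  -- Threshold 1: a straight corner with two labels has a single continuation, turns have two. In
  -- the only hexagon starting with -a -b, a ≠ b, the corner at x is the turn (+a, -b), where the
  -- alternation breaks. For -a -a it breaks because either the hexagon is a line, whose corner at w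
  -- again has one continuation, or the corner at v already has two. The lists may contain patterns
  -- that do not close up: the line does so only if `m` divides 6 and `n` divides 63.
  ¬arcTransitive-generic : ∀ test → Sound test →
    Complete test (prefix true true false) ((⁺ 0 ∷ ⁺ 1 ∷ ⁻ 0 ∷ ⁻ 1 ∷ ⁺ 0 ∷ ⁻ 1 ∷ []) ∷ []) →
    Complete test (prefix false false false) ((⁻ 0 ∷ ⁻ 1 ∷ ⁺ 0 ∷ ⁻ 1 ∷ ⁺ 0 ∷ ⁺ 1 ∷ []) ∷ []) →
    (Complete test (prefix false false true) ((⁻ 0 ∷ ⁻ 0 ∷ ⁻ 0 ∷ ⁻ 0 ∷ ⁻ 0 ∷ ⁻ 0 ∷ []) ∷ [])
      ⊎ (∀ u a → Many 1 u (dn a u) (dn a (dn a u)))) →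
    ¬ ArcTransitive B
  ¬arcTransitive-generic test sound c++ c-- c= = few-criterion 1 1F (λ ()) up-few dn-few peak valley dn-cases (straight c=)
    where
    up-few : ∀ u {i j} → i ≢ j → ¬ Many 1 u (up i u) (up j (up i u))
    up-few u {i} {j} i≢j = few (λ _ → ⁻ i) λ x (y , z , h) → ext (classify-≢ test sound true true c++ i≢j h)
      where
      ext : ∀ {x y z} → Classified _ u (⁺ i) (⁺ j) x y z → ∃[ c ] x ≡ step (⁻ i) (up j (up i u))
      ext (classified (here refl) inj (e₀ ∷ _ ∷ e₂ ∷ _)) = 0F , cong (λ l → dn l (up j (up i u))) (inj (trans e₂ (sym e₀)))

    dn-few : ∀ u {i j} → i ≢ j → ¬ Many 1 u (dn i u) (dn j (dn i u))
    dn-few u {i} {j} i≢j = few (λ _ → ⁺ i) λ x (y , z , h) → ext (classify-≢ test sound false false c-- i≢j h)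
      where
      ext : ∀ {x y z} → Classified _ u (⁻ i) (⁻ j) x y z → ∃[ c ] x ≡ step (⁺ i) (dn j (dn i u))
      ext (classified (here refl) inj (e₀ ∷ _ ∷ e₂ ∷ _)) = 0F , cong (λ l → up l (dn j (dn i u))) (inj (trans e₂ (sym e₀)))

    dn-cases : ∀ u {a b} x y z → a ≢ b → let v = dn a u ; w = dn b v in Hex u v w x y z → ¬ Many 1 v w x ⊎ Many 1 w x y
    dn-cases u {a} {b} x y z a≢b h = inj₂ (turn (classify-≢ test sound false false c-- a≢b h))
      where
      turn : ∀ {x y z} → Classified _ u (⁻ a) (⁻ b) x y z → Many 1 (dn b (dn a u)) x y
      turn (classified (here refl) inj (e₀ ∷ _ ∷ e₂ ∷ e₃ ∷ _)) = peak _ λ { refl → 0≢1+n (trans (sym e₂) e₃) }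

    straight : (Complete test (prefix false false true) ((⁻ 0 ∷ ⁻ 0 ∷ ⁻ 0 ∷ ⁻ 0 ∷ ⁻ 0 ∷ ⁻ 0 ∷ []) ∷ [])
      ⊎ (∀ u a → Many 1 u (dn a u) (dn a (dn a u)))) →
      ∀ u a x y z → let v = dn a u ; w = dn a v in Hex u v w x y z → Many 1 u v w ⊎ ¬ Many 1 v w x
    straight (inj₂ M)   u a x y z h = inj₁ (M u a)
    straight (inj₁ c==) u a x y z h = inj₂ (subst (λ x → ¬ Many 1 _ _ x) (sym (ext (classify-≡ test sound false false c== h))) (line-few (dn a u)))
      where
      ext : ∀ {u x y z} → Classified _ u (⁻ a) (⁻ a) x y z → x ≡ dn a (dn a (dn a u))
      ext (classified (here refl) inj (e₀ ∷ _ ∷ e₂ ∷ _)) = cong (λ l → dn l _) (inj (trans e₂ (sym e₀)))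
      line-few : ∀ u → ¬ Many 1 u (dn a u) (dn a (dn a u))
      line-few u = few (λ _ → ⁻ a) λ x (y , z , h) → 0F , ext (classify-≡ test sound false false c== h)

  ¬arcTransitive-large : 6 < m ⊎ m ≡ 5 → 7 < n → ¬ ArcTransitive B
  ¬arcTransitive-large m-large 7<n = ¬arcTransitive-generic (tests (avoids? levels) (avoids? smallSums))
    (avoids?-sound levels (m∤ m-large) , avoids?-sound smallSums (smallSums-sound 7<n))
    (complete refl) (complete refl) (inj₁ (complete refl))
    where
    m∤ : 6 < m ⊎ m ≡ 5 → ∀ d → d ∈ levels → ¬ m ∣ d
    m∤ (inj₁ 6<m) = level-large 6<m
    m∤ (inj₂ refl) = level-5

¬arcTransitive-4-15 : ∀ k″ n∣ → ¬ ArcTransitive (Bouwer (2 + k″) 4 15)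
¬arcTransitive-4-15 k″ n∣ = ¬arcTransitive-generic (tests (divisible? 4) (divisible? 15))
  (divisible?-sound 4 ∣-refl , divisible?-sound 15 ∣-refl) (complete refl) (complete refl) (inj₁ (complete refl))
  where open GenericCase k″ 3 14 n∣ (m≤m+n 3 1) (m≤m+n 2 13)

¬arcTransitive-6-63 : ∀ k″ n∣ → ¬ ArcTransitive (Bouwer (2 + k″) 6 63)
¬arcTransitive-6-63 k″ n∣ = ¬arcTransitive-generic (tests (divisible? 6) (divisible? 63))
  (divisible?-sound 6 ∣-refl , divisible?-sound 63 ∣-refl) (complete refl) (complete refl) (inj₁ (complete refl))
  where open GenericCase k″ 5 62 n∣ (m≤m+n 3 3) (m≤m+n 2 61)

module _ (k″ m′ : ℕ) (n∣ : 7 ∣ 2 ^ suc m′ ∸ 1) (6<m : 6 < suc m′) where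

  open GenericCase k″ m′ 6 n∣ (≤-trans (m≤m+n 3 4) 6<m) (m≤m+n 2 5)

  ¬arcTransitive-7 : ¬ ArcTransitive B
  ¬arcTransitive-7 = ¬arcTransitive-generic (tests (avoids? levels) (divisible? 7))
    (avoids?-sound levels (level-large 6<m) , divisible?-sound 7 ∣-refl) (complete refl) (complete refl) (inj₂ straight)
    where
    -- As 1 + 2 + 4 = 7, three steps along one label on consecutive levels cancel; hence -a -a
    -- continues with +b as well as with -a.
    straight : ∀ u a → Many 1 u (dn a u) (dn a (dn a u))
    straight u a with other a
    ... | b , a≢b = many {es = ⁺ b ∷ ⁻ a ∷ []} (((λ ()) ∷ []) ∷ [] ∷ [])
      λ { 0F → _ , _ , at (tests zero? (divisible? 7)) exact (unique₂ a≢b) (⁻ 0F) (⁻ 0F) (⁺ 1F) (⁺ 1F) (⁺ 1F) (⁻ 0F) refl u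
        ; 1F → _ , _ , at (tests zero? (divisible? 7)) exact (unique₂ a≢b) (⁻ 0F) (⁻ 0F) (⁻ 0F) (⁺ 1F) (⁺ 1F) (⁺ 1F) refl u }
      where
      exact : Exact (tests zero? (divisible? 7))
      exact = zero?-exact m , divisible?-exact 7 ∣-refl

module ThreeLabels (k‴ m′ n′ : ℕ) (n∣ : suc n′ ∣ 2 ^ suc m′ ∸ 1) (2<m : 2 < suc m′) (1<n : 1 < suc n′) where

  open GenericCase (suc k‴) m′ n′ n∣ 2<m 1<n public

  third : ∀ (i j : Label) → ∃[ l ] (i ≢ l × j ≢ l)
  third zero          zero          = 1F , (λ ()) , (λ ())
  third zero          (suc zero)    = 2F , (λ ()) , (λ ())
  third zero          (suc (suc _)) = 1F , (λ ()) , (λ ())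
  third (suc zero)    zero          = 2F , (λ ()) , (λ ())
  third (suc (suc _)) zero          = 1F , (λ ()) , (λ ())
  third (suc _)       (suc _)       = 0F , (λ ()) , (λ ())

  ⁺-≢ : ∀ {i j : Label} → i ≢ j → ⁺ i ≢ ⁺ j
  ⁺-≢ i≢j refl = i≢j refl

  ⁻-≢ : ∀ {i j : Label} → i ≢ j → ⁻ i ≢ ⁻ j
  ⁻-≢ i≢j refl = i≢j refl

  module _ (u : Vertex) {i j : Label} (i≢j : i ≢ j) where

    private
      l = proj₁ (third i j)
      i≢l = proj₁ (proj₂ (third i j))
      j≢l = proj₂ (proj₂ (third i j))

    -- A third label l adds the extension +l through +i -j +l -i +j -l, which closes up for all
    -- parameters.
    peak₂ : Many 2 u (up i u) (dn j (up i u))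
    peak₂ = many {es = ⁺ i ∷ ⁻ i ∷ ⁺ l ∷ []} (((λ ()) ∷ ⁺-≢ i≢l ∷ []) ∷ ((λ ()) ∷ []) ∷ [] ∷ [])
      λ { 0F → _ , _ , at (tests zero? zero?) zero-exact (unique₂ i≢j) (⁺ 0F) (⁻ 1F) (⁺ 0F) (⁺ 1F) (⁻ 0F) (⁻ 1F) refl u
        ; 1F → _ , _ , at (tests zero? zero?) zero-exact (unique₂ i≢j) (⁺ 0F) (⁻ 1F) (⁻ 0F) (⁺ 1F) (⁻ 0F) (⁺ 1F) refl u
        ; 2F → _ , _ , at (tests zero? zero?) zero-exact (unique₃ i≢j i≢l j≢l) (⁺ 0F) (⁻ 1F) (⁺ 2F) (⁻ 0F) (⁺ 1F) (⁻ 2F) refl u }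

    valley₂ : Many 2 u (dn i u) (up j (dn i u))
    valley₂ = many {es = ⁺ i ∷ ⁻ i ∷ ⁻ l ∷ []} (((λ ()) ∷ (λ ()) ∷ []) ∷ (⁻-≢ i≢l ∷ []) ∷ [] ∷ [])
      λ { 0F → _ , _ , at (tests zero? zero?) zero-exact (unique₂ i≢j) (⁻ 0F) (⁺ 1F) (⁺ 0F) (⁻ 1F) (⁻ 0F) (⁺ 1F) refl u
        ; 1F → _ , _ , at (tests zero? zero?) zero-exact (unique₂ i≢j) (⁻ 0F) (⁺ 1F) (⁻ 0F) (⁺ 1F) (⁺ 0F) (⁻ 1F) refl u
        ; 2F → _ , _ , at (tests zero? zero?) zero-exact (unique₃ i≢j i≢l j≢l) (⁻ 0F) (⁺ 1F) (⁻ 2F) (⁺ 0F) (⁻ 1F) (⁺ 2F) refl u }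

module _ (k‴ : ℕ) (n∣ : 21 ∣ 2 ^ 6 ∸ 1) where

  open ThreeLabels k‴ 5 20 n∣ (m≤m+n 3 3) (m≤m+n 2 19)
  open ByCount

  -- As 1 + 4 + 16 = 21 and m = 6, also +i +j +i +j +i +j closes up, and straight corners with two
  -- labels reach two extensions. The third label keeps turns ahead with three.
  ¬arcTransitive-6-21 : ¬ ArcTransitive B
  ¬arcTransitive-6-21 = few-criterion 2 1F (λ ()) up-few dn-few peak₂ valley₂ dn-cases straight
    where
    test : Tests
    test = tests (divisible? 6) (divisible? 21)
    sound : Sound test
    sound = divisible?-sound 6 ∣-refl , divisible?-sound 21 ∣-refl

    up-few : ∀ u {i j} → i ≢ j → ¬ Many 2 u (up i u) (up j (up i u))
    up-few u {i} {j} i≢j = few (lookup (⁻ i ∷ ⁺ i ∷ [])) λ x (y , z , h) → ext (classify-≢ test sound true true (complete refl) i≢j h)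
      where
      ext : ∀ {x y z} → Classified ((⁺ 0 ∷ ⁺ 1 ∷ ⁻ 0 ∷ ⁻ 1 ∷ ⁺ 0 ∷ ⁻ 1 ∷ []) ∷ (⁺ 0 ∷ ⁺ 1 ∷ ⁺ 0 ∷ ⁺ 1 ∷ ⁺ 0 ∷ ⁺ 1 ∷ []) ∷ []) u (⁺ i) (⁺ j) x y z →
        ∃[ c ] x ≡ step (lookup (⁻ i ∷ ⁺ i ∷ []) c) (up j (up i u))
      ext (classified (here refl)         inj (e₀ ∷ _ ∷ e₂ ∷ _)) = 0F , cong (λ l → dn l (up j (up i u))) (inj (trans e₂ (sym e₀)))
      ext (classified (there (here refl)) inj (e₀ ∷ _ ∷ e₂ ∷ _)) = 1F , cong (λ l → up l (up j (up i u))) (inj (trans e₂ (sym e₀)))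

    descents : List Pattern
    descents = (⁻ 0 ∷ ⁻ 1 ∷ ⁺ 0 ∷ ⁻ 1 ∷ ⁺ 0 ∷ ⁺ 1 ∷ []) ∷ (⁻ 0 ∷ ⁻ 1 ∷ ⁻ 0 ∷ ⁻ 1 ∷ ⁻ 0 ∷ ⁻ 1 ∷ []) ∷ []
    descents-complete : Complete test (prefix false false false) descents
    descents-complete = complete refl

    dn-few : ∀ u {i j} → i ≢ j → ¬ Many 2 u (dn i u) (dn j (dn i u))
    dn-few u {i} {j} i≢j = few (lookup (⁺ i ∷ ⁻ i ∷ [])) λ x (y , z , h) → ext (classify-≢ test sound false false descents-complete i≢j h)
      where
      ext : ∀ {x y z} → Classified descents u (⁻ i) (⁻ j) x y z → ∃[ c ] x ≡ step (lookup (⁺ i ∷ ⁻ i ∷ []) c) (dn j (dn i u))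
      ext (classified (here refl)         inj (e₀ ∷ _ ∷ e₂ ∷ _)) = 0F , cong (λ l → up l (dn j (dn i u))) (inj (trans e₂ (sym e₀)))
      ext (classified (there (here refl)) inj (e₀ ∷ _ ∷ e₂ ∷ _)) = 1F , cong (λ l → dn l (dn j (dn i u))) (inj (trans e₂ (sym e₀)))

    dn-cases : ∀ u {a b} x y z → a ≢ b → let v = dn a u ; w = dn b v in Hex u v w x y z → ¬ Many 2 v w x ⊎ Many 2 w x y
    dn-cases u {a} {b} x y z a≢b h = turn (classify-≢ test sound false false descents-complete a≢b h)
      where
      turn : ∀ {x y z} → Classified descents u (⁻ a) (⁻ b) x y z → ¬ Many 2 (dn a u) (dn b (dn a u)) x ⊎ Many 2 (dn b (dn a u)) x y
      turn (classified (here refl)         inj (_ ∷ _ ∷ e₂ ∷ e₃ ∷ _)) = inj₂ (peak₂ _ λ { refl → 0≢1+n (trans (sym e₂) e₃) })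
      turn (classified (there (here refl)) inj (_ ∷ e₁ ∷ e₂ ∷ _))     = inj₁ (dn-few _ λ { refl → 0≢1+n (trans (sym e₂) e₁) })

    lines : List Pattern
    lines = (⁻ 0 ∷ ⁻ 0 ∷ ⁻ 0 ∷ ⁻ 0 ∷ ⁻ 0 ∷ ⁻ 0 ∷ []) ∷ []

    straight : ∀ u a x y z → let v = dn a u ; w = dn a v in Hex u v w x y z → Many 2 u v w ⊎ ¬ Many 2 v w x
    straight u a x y z h = inj₂ (subst (λ x → ¬ Many 2 _ _ x) (sym (ext (classify-≡ test sound false false (complete refl) h))) (line-few (dn a u)))
      where
      ext : ∀ {u x y z} → Classified lines u (⁻ a) (⁻ a) x y z → x ≡ dn a (dn a (dn a u))
      ext (classified (here refl) inj (e₀ ∷ _ ∷ e₂ ∷ _)) = cong (λ l → dn l _) (inj (trans e₂ (sym e₀)))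
      line-few : ∀ u → ¬ Many 2 u (dn a u) (dn a (dn a u))
      line-few u = few (λ _ → ⁻ a) λ x (y , z , h) → 0F , ext (classify-≡ test sound false false (complete refl) h)

module _ (k‴ m′ : ℕ) (n∣ : 7 ∣ 2 ^ suc m′ ∸ 1) (2<m : 2 < suc m′) (3∣m : 3 ∣ suc m′) (m∣6 : suc m′ ∣ 6) where

  open ThreeLabels k‴ m′ 6 n∣ 2<m (m≤m+n 2 5)
  open ByCount

  -- Here straight corners with two labels have at most three extensions, while turns and descents
  -- along one label have four; hence the threshold 3. The cases m = 3 and m = 6 go together: level
  -- changes of six-step walks are even, so divisibility by 3, which is sound for both, agrees on
  -- them with divisibility by 6, which is exact for both.
  ¬arcTransitive-3∣m∣6-7 : ¬ ArcTransitive B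
  ¬arcTransitive-3∣m∣6-7 = few-criterion 3 1F (λ ()) up-few dn-few peak₃ valley₃ dn-cases (λ u a x y z h → inj₁ (straight u a))
    where
    test exactTest : Tests
    test      = tests (divisible? 3) (divisible? 7)
    exactTest = tests (divisible? 6) (divisible? 7)
    sound : Sound test
    sound = divisible?-sound 3 3∣m , divisible?-sound 7 ∣-refl
    exact : Exact exactTest
    exact = divisible?-exact 6 m∣6 , divisible?-exact 7 ∣-refl

    ascents descents : List Pattern
    ascents  = (⁺ 0 ∷ ⁺ 1 ∷ ⁻ 0 ∷ ⁻ 1 ∷ ⁺ 0 ∷ ⁻ 1 ∷ []) ∷ (⁺ 0 ∷ ⁺ 1 ∷ ⁺ 0 ∷ ⁺ 1 ∷ ⁺ 0 ∷ ⁺ 1 ∷ []) ∷ (⁺ 0 ∷ ⁺ 1 ∷ ⁺ 1 ∷ ⁺ 1 ∷ ⁺ 0 ∷ ⁺ 0 ∷ []) ∷ []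
    descents = (⁻ 0 ∷ ⁻ 1 ∷ ⁺ 0 ∷ ⁻ 1 ∷ ⁺ 0 ∷ ⁺ 1 ∷ []) ∷ (⁻ 0 ∷ ⁻ 1 ∷ ⁻ 0 ∷ ⁻ 1 ∷ ⁻ 0 ∷ ⁻ 1 ∷ []) ∷ (⁻ 0 ∷ ⁻ 1 ∷ ⁻ 1 ∷ ⁻ 1 ∷ ⁻ 0 ∷ ⁻ 0 ∷ []) ∷ []
    descents-complete : Complete test (prefix false false false) descents
    descents-complete = complete refl

    up-few : ∀ u {i j} → i ≢ j → ¬ Many 3 u (up i u) (up j (up i u))
    up-few u {i} {j} i≢j = few (lookup (⁻ i ∷ ⁺ i ∷ ⁺ j ∷ [])) λ x (y , z , h) → ext (classify-≢ test sound true true (complete refl) i≢j h)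
      where
      ext : ∀ {x y z} → Classified ascents u (⁺ i) (⁺ j) x y z → ∃[ c ] x ≡ step (lookup (⁻ i ∷ ⁺ i ∷ ⁺ j ∷ []) c) (up j (up i u))
      ext (classified (here refl)                 inj (e₀ ∷ _ ∷ e₂ ∷ _)) = 0F , cong (λ l → dn l (up j (up i u))) (inj (trans e₂ (sym e₀)))
      ext (classified (there (here refl))         inj (e₀ ∷ _ ∷ e₂ ∷ _)) = 1F , cong (λ l → up l (up j (up i u))) (inj (trans e₂ (sym e₀)))
      ext (classified (there (there (here refl))) inj (_ ∷ e₁ ∷ e₂ ∷ _)) = 2F , cong (λ l → up l (up j (up i u))) (inj (trans e₂ (sym e₁)))

    dn-few : ∀ u {i j} → i ≢ j → ¬ Many 3 u (dn i u) (dn j (dn i u))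
    dn-few u {i} {j} i≢j = few (lookup (⁺ i ∷ ⁻ i ∷ ⁻ j ∷ [])) λ x (y , z , h) → ext (classify-≢ test sound false false descents-complete i≢j h)
      where
      ext : ∀ {x y z} → Classified descents u (⁻ i) (⁻ j) x y z → ∃[ c ] x ≡ step (lookup (⁺ i ∷ ⁻ i ∷ ⁻ j ∷ []) c) (dn j (dn i u))
      ext (classified (here refl)                 inj (e₀ ∷ _ ∷ e₂ ∷ _)) = 0F , cong (λ l → up l (dn j (dn i u))) (inj (trans e₂ (sym e₀)))
      ext (classified (there (here refl))         inj (e₀ ∷ _ ∷ e₂ ∷ _)) = 1F , cong (λ l → dn l (dn j (dn i u))) (inj (trans e₂ (sym e₀)))
      ext (classified (there (there (here refl))) inj (_ ∷ e₁ ∷ e₂ ∷ _)) = 2F , cong (λ l → dn l (dn j (dn i u))) (inj (trans e₂ (sym e₁)))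

    peak₃ : ∀ u {i j} → i ≢ j → Many 3 u (up i u) (dn j (up i u))
    peak₃ u {i} {j} i≢j with third i j
    ... | l , i≢l , j≢l = many {es = ⁺ i ∷ ⁻ i ∷ ⁺ l ∷ ⁻ j ∷ []}
      (((λ ()) ∷ ⁺-≢ i≢l ∷ (λ ()) ∷ []) ∷ ((λ ()) ∷ ⁻-≢ i≢j ∷ []) ∷ ((λ ()) ∷ []) ∷ [] ∷ [])
      λ { 0F → _ , _ , at exactTest exact (unique₂ i≢j) (⁺ 0F) (⁻ 1F) (⁺ 0F) (⁺ 1F) (⁻ 0F) (⁻ 1F) refl u
        ; 1F → _ , _ , at exactTest exact (unique₂ i≢j) (⁺ 0F) (⁻ 1F) (⁻ 0F) (⁺ 1F) (⁻ 0F) (⁺ 1F) refl u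
        ; 2F → _ , _ , at exactTest exact (unique₃ i≢j i≢l j≢l) (⁺ 0F) (⁻ 1F) (⁺ 2F) (⁻ 0F) (⁺ 1F) (⁻ 2F) refl u
        ; 3F → _ , _ , at exactTest exact (unique₂ i≢j) (⁺ 0F) (⁻ 1F) (⁻ 1F) (⁻ 1F) (⁺ 0F) (⁺ 0F) refl u }

    valley₃ : ∀ u {i j} → i ≢ j → Many 3 u (dn i u) (up j (dn i u))
    valley₃ u {i} {j} i≢j with third i j
    ... | l , i≢l , j≢l = many {es = ⁺ i ∷ ⁻ i ∷ ⁻ l ∷ ⁺ j ∷ []}
      (((λ ()) ∷ (λ ()) ∷ ⁺-≢ i≢j ∷ []) ∷ (⁻-≢ i≢l ∷ (λ ()) ∷ []) ∷ ((λ ()) ∷ []) ∷ [] ∷ [])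
      λ { 0F → _ , _ , at exactTest exact (unique₂ i≢j) (⁻ 0F) (⁺ 1F) (⁺ 0F) (⁻ 1F) (⁻ 0F) (⁺ 1F) refl u
        ; 1F → _ , _ , at exactTest exact (unique₂ i≢j) (⁻ 0F) (⁺ 1F) (⁻ 0F) (⁺ 1F) (⁺ 0F) (⁻ 1F) refl u
        ; 2F → _ , _ , at exactTest exact (unique₃ i≢j i≢l j≢l) (⁻ 0F) (⁺ 1F) (⁻ 2F) (⁺ 0F) (⁻ 1F) (⁺ 2F) refl u
        ; 3F → _ , _ , at exactTest exact (unique₂ i≢j) (⁻ 0F) (⁺ 1F) (⁺ 1F) (⁺ 1F) (⁻ 0F) (⁻ 0F) refl u }

    straight : ∀ u a → Many 3 u (dn a u) (dn a (dn a u))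
    straight u a with other a
    ... | b , a≢b with third a b
    ...   | l , a≢l , b≢l = many {es = ⁻ a ∷ ⁻ b ∷ ⁻ l ∷ ⁺ b ∷ []}
      ((⁻-≢ a≢b ∷ ⁻-≢ a≢l ∷ (λ ()) ∷ []) ∷ (⁻-≢ b≢l ∷ (λ ()) ∷ []) ∷ ((λ ()) ∷ []) ∷ [] ∷ [])
      λ { 0F → _ , _ , at exactTest exact (unique₁ a) (⁻ 0F) (⁻ 0F) (⁻ 0F) (⁻ 0F) (⁻ 0F) (⁻ 0F) refl u
        ; 1F → _ , _ , at exactTest exact (unique₂ a≢b) (⁻ 0F) (⁻ 0F) (⁻ 1F) (⁻ 1F) (⁻ 1F) (⁻ 0F) refl u
        ; 2F → _ , _ , at exactTest exact (unique₂ a≢l) (⁻ 0F) (⁻ 0F) (⁻ 1F) (⁻ 1F) (⁻ 1F) (⁻ 0F) refl u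
        ; 3F → _ , _ , at exactTest exact (unique₂ a≢b) (⁻ 0F) (⁻ 0F) (⁺ 1F) (⁺ 1F) (⁺ 1F) (⁻ 0F) refl u }

    dn-cases : ∀ u {a b} x y z → a ≢ b → let v = dn a u ; w = dn b v in Hex u v w x y z → ¬ Many 3 v w x ⊎ Many 3 w x y
    dn-cases u {a} {b} x y z a≢b h = turn (classify-≢ test sound false false descents-complete a≢b h)
      where
      turn : ∀ {x y z} → Classified descents u (⁻ a) (⁻ b) x y z → ¬ Many 3 (dn a u) (dn b (dn a u)) x ⊎ Many 3 (dn b (dn a u)) x y
      turn (classified (here refl)                 inj (_ ∷ _ ∷ e₂ ∷ e₃ ∷ _)) = inj₂ (peak₃ _ λ { refl → 0≢1+n (trans (sym e₂) e₃) })
      turn (classified (there (here refl))         inj (_ ∷ e₁ ∷ e₂ ∷ _))     = inj₁ (dn-few _ λ { refl → 0≢1+n (trans (sym e₂) e₁) })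
      turn (classified (there (there (here refl))) inj (_ ∷ _ ∷ e₂ ∷ e₃ ∷ _)) with inj (trans e₂ (sym e₃))
      ... | refl = inj₂ (straight _ _)

module _ (k″ : ℕ) (n∣ : 9 ∣ 2 ^ 6 ∸ 1) where

  open GenericCase k″ 5 8 n∣ (m≤m+n 3 3) (m≤m+n 2 7)
  open ByCount k

  -- As 1 + 8 = 9, weights three levels apart cancel, so +i +j +l +i +j +l closes up for every l.
  -- The roles are exchanged: straight corners with two labels have `k + 1` extensions, whereas
  -- turns and descents along one label have at most `k`.
  ¬arcTransitive-6-9 : ¬ ArcTransitive B
  ¬arcTransitive-6-9 = alternating-criterion (Many k) many-invariant 1F (λ ()) up-many dn-many peak-few valley-few descending
    where
    test : Tests
    test = tests (divisible? 6) (divisible? 9)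
    sound : Sound test
    sound = divisible?-sound 6 ∣-refl , divisible?-sound 9 ∣-refl
    exact : Exact test
    exact = divisible?-exact 6 ∣-refl , divisible?-exact 9 ∣-refl

    up-many : ∀ u {i j} → i ≢ j → Many k u (up i u) (up j (up i u))
    up-many u {i} {j} i≢j = (λ c → step (g c) w) , (λ {c} {d} e → g-inj c d (step-injective _ _ w e)) , ext
      where
      w = up j (up i u)
      g : Fin (suc k) → Step
      g zero    = ⁻ i
      g (suc l) = ⁺ l
      g-inj : ∀ c d → g c ≡ g d → c ≡ d
      g-inj zero    zero    e    = refl
      g-inj (suc l) (suc _) refl = refl
      ext : ∀ c → Comp u (up i u) w (step (g c) w)
      ext zero = _ , _ , at test exact (unique₂ i≢j) (⁺ 0F) (⁺ 1F) (⁻ 0F) (⁻ 1F) (⁺ 0F) (⁻ 1F) refl u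
      ext (suc l) with i Fin.≟ l | j Fin.≟ l
      ... | yes refl | _        = _ , _ , at test exact (unique₂ i≢j) (⁺ 0F) (⁺ 1F) (⁺ 0F) (⁺ 0F) (⁺ 1F) (⁺ 0F) refl u
      ... | no _     | yes refl = _ , _ , at test exact (unique₂ i≢j) (⁺ 0F) (⁺ 1F) (⁺ 1F) (⁺ 0F) (⁺ 1F) (⁺ 1F) refl u
      ... | no i≢l   | no j≢l   = _ , _ , at test exact (unique₃ i≢j i≢l j≢l) (⁺ 0F) (⁺ 1F) (⁺ 2F) (⁺ 0F) (⁺ 1F) (⁺ 2F) refl u

    dn-many : ∀ u {i j} → i ≢ j → Many k u (dn i u) (dn j (dn i u))
    dn-many u {i} {j} i≢j = (λ c → step (g c) w) , (λ {c} {d} e → g-inj c d (step-injective _ _ w e)) , ext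
      where
      w = dn j (dn i u)
      g : Fin (suc k) → Step
      g zero    = ⁺ i
      g (suc l) = ⁻ l
      g-inj : ∀ c d → g c ≡ g d → c ≡ d
      g-inj zero    zero    e    = refl
      g-inj (suc l) (suc _) refl = refl
      ext : ∀ c → Comp u (dn i u) w (step (g c) w)
      ext zero = _ , _ , at test exact (unique₂ i≢j) (⁻ 0F) (⁻ 1F) (⁺ 0F) (⁻ 1F) (⁺ 0F) (⁺ 1F) refl u
      ext (suc l) with i Fin.≟ l | j Fin.≟ l
      ... | yes refl | _        = _ , _ , at test exact (unique₂ i≢j) (⁻ 0F) (⁻ 1F) (⁻ 0F) (⁻ 0F) (⁻ 1F) (⁻ 0F) refl u
      ... | no _     | yes refl = _ , _ , at test exact (unique₂ i≢j) (⁻ 0F) (⁻ 1F) (⁻ 1F) (⁻ 0F) (⁻ 1F) (⁻ 1F) refl u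
      ... | no i≢l   | no j≢l   = _ , _ , at test exact (unique₃ i≢j i≢l j≢l) (⁻ 0F) (⁻ 1F) (⁻ 2F) (⁻ 0F) (⁻ 1F) (⁻ 2F) refl u

    -- Label j, which cannot repeat at the turn, stands for the one extension in the other direction.
    replace : Label → Step → (Label → Step) → Label → Step
    replace j s f l = if does (l Fin.≟ j) then s else f l

    replace-same : ∀ j s f → replace j s f j ≡ s
    replace-same j s f rewrite dec-true (j Fin.≟ j) refl = refl

    replace-other : ∀ {j l} s f → l ≢ j → replace j s f l ≡ f l
    replace-other {j} {l} s f l≢j rewrite dec-false (l Fin.≟ j) l≢j = refl

    peaks valleys lines descents : List Pattern
    peaks    = (⁺ 0 ∷ ⁻ 1 ∷ ⁺ 0 ∷ ⁺ 1 ∷ ⁻ 0 ∷ ⁻ 1 ∷ []) ∷ (⁺ 0 ∷ ⁻ 1 ∷ ⁺ 2 ∷ ⁻ 0 ∷ ⁺ 1 ∷ ⁻ 2 ∷ []) ∷ (⁺ 0 ∷ ⁻ 1 ∷ ⁻ 0 ∷ ⁺ 1 ∷ ⁻ 0 ∷ ⁺ 1 ∷ []) ∷ []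
    valleys  = (⁻ 0 ∷ ⁺ 1 ∷ ⁺ 0 ∷ ⁻ 1 ∷ ⁻ 0 ∷ ⁺ 1 ∷ []) ∷ (⁻ 0 ∷ ⁺ 1 ∷ ⁻ 2 ∷ ⁺ 0 ∷ ⁻ 1 ∷ ⁺ 2 ∷ []) ∷ (⁻ 0 ∷ ⁺ 1 ∷ ⁻ 0 ∷ ⁺ 1 ∷ ⁺ 0 ∷ ⁻ 1 ∷ []) ∷ []
    lines    = (⁻ 0 ∷ ⁻ 0 ∷ ⁻ 0 ∷ ⁻ 0 ∷ ⁻ 0 ∷ ⁻ 0 ∷ []) ∷ (⁻ 0 ∷ ⁻ 0 ∷ ⁻ 1 ∷ ⁻ 0 ∷ ⁻ 0 ∷ ⁻ 1 ∷ []) ∷ []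
    descents = (⁻ 0 ∷ ⁻ 1 ∷ ⁺ 0 ∷ ⁻ 1 ∷ ⁺ 0 ∷ ⁺ 1 ∷ []) ∷ (⁻ 0 ∷ ⁻ 1 ∷ ⁻ 0 ∷ ⁻ 0 ∷ ⁻ 1 ∷ ⁻ 0 ∷ [])
             ∷ (⁻ 0 ∷ ⁻ 1 ∷ ⁻ 1 ∷ ⁻ 0 ∷ ⁻ 1 ∷ ⁻ 1 ∷ []) ∷ (⁻ 0 ∷ ⁻ 1 ∷ ⁻ 2 ∷ ⁻ 0 ∷ ⁻ 1 ∷ ⁻ 2 ∷ []) ∷ []

    peak-few : ∀ u {i j} → i ≢ j → ¬ Many k u (up i u) (dn j (up i u))
    peak-few u {i} {j} i≢j = few (replace j (⁻ i) ⁺) λ x (y , z , h) → ext (classify-≢ test sound true false (complete refl) i≢j h)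
      where
      w = dn j (up i u)
      rising : ∀ {l} → l ≢ j → ∃[ c ] up l w ≡ step (replace j (⁻ i) ⁺ c) w
      rising {l} l≢j = l , cong (λ s → step s w) (sym (replace-other (⁻ i) ⁺ l≢j))
      ext : ∀ {x y z} → Classified peaks u (⁺ i) (⁻ j) x y z → ∃[ c ] x ≡ step (replace j (⁻ i) ⁺ c) w
      ext (classified (here refl)                 inj (_ ∷ e₁ ∷ e₂ ∷ _)) = rising λ { refl → 0≢1+n (trans (sym e₂) e₁) }
      ext (classified (there (here refl))         inj (_ ∷ e₁ ∷ e₂ ∷ _)) = rising λ { refl → 1+n≢n (trans (sym e₂) e₁) }
      ext (classified (there (there (here refl))) inj (e₀ ∷ _ ∷ e₂ ∷ _)) =
        j , cong (λ s → step s w) (trans (cong ⁻ (inj (trans e₂ (sym e₀)))) (sym (replace-same j (⁻ i) ⁺)))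

    valley-few : ∀ u {i j} → i ≢ j → ¬ Many k u (dn i u) (up j (dn i u))
    valley-few u {i} {j} i≢j = few (replace j (⁺ i) ⁻) λ x (y , z , h) → ext (classify-≢ test sound false true (complete refl) i≢j h)
      where
      w = up j (dn i u)
      falling : ∀ {l} → l ≢ j → ∃[ c ] dn l w ≡ step (replace j (⁺ i) ⁻ c) w
      falling {l} l≢j = l , cong (λ s → step s w) (sym (replace-other (⁺ i) ⁻ l≢j))
      ext : ∀ {x y z} → Classified valleys u (⁻ i) (⁺ j) x y z → ∃[ c ] x ≡ step (replace j (⁺ i) ⁻ c) w
      ext (classified (here refl)                 inj (e₀ ∷ _ ∷ e₂ ∷ _)) =
        j , cong (λ s → step s w) (trans (cong ⁺ (inj (trans e₂ (sym e₀)))) (sym (replace-same j (⁺ i) ⁻)))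
      ext (classified (there (here refl))         inj (_ ∷ e₁ ∷ e₂ ∷ _)) = falling λ { refl → 1+n≢n (trans (sym e₂) e₁) }
      ext (classified (there (there (here refl))) inj (_ ∷ e₁ ∷ e₂ ∷ _)) = falling λ { refl → 0≢1+n (trans (sym e₂) e₁) }

    line-few : ∀ u a → ¬ Many k u (dn a u) (dn a (dn a u))
    line-few u a = few ⁻ λ x (y , z , h) → ext (classify-≡ test sound false false (complete refl) h)
      where
      ext : ∀ {x y z} → Classified lines u (⁻ a) (⁻ a) x y z → ∃[ c ] x ≡ dn c (dn a (dn a u))
      ext (classified (here refl)         inj (_ ∷ _ ∷ _ ∷ _)) = _ , refl
      ext (classified (there (here refl)) inj (_ ∷ _ ∷ _ ∷ _)) = _ , refl

    descending : ∀ u a b x y z → let v = dn a u ; w = dn b v in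
      Hex u v w x y z → Many k u v w → ¬ Many k v w x → Many k w x y → ¬ Many k x y z → ⊥
    descending u a b x y z h q₁ q₂ q₃ q₄ with a Fin.≟ b
    ... | yes refl = line-few u a q₁
    ... | no a≢b   = cases (classify-≢ test sound false false (complete refl) a≢b h) q₂ q₃ q₄
      where
      cases : ∀ {x y z} → Classified descents u (⁻ a) (⁻ b) x y z →
        ¬ Many k (dn a u) (dn b (dn a u)) x → Many k (dn b (dn a u)) x y → ¬ Many k x y z → ⊥
      cases (classified (here refl) inj (_ ∷ _ ∷ e₂ ∷ e₃ ∷ _)) q₂ q₃ q₄ =
        peak-few _ (λ { refl → 0≢1+n (trans (sym e₂) e₃) }) q₃
      cases (classified (there (here refl)) inj (_ ∷ e₁ ∷ e₂ ∷ _)) q₂ q₃ q₄ =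
        q₂ (dn-many _ λ { refl → 0≢1+n (trans (sym e₂) e₁) })
      -- In -0 -1 -1 -0 -1 -1 the corners at v, w and x fit the alternation; it breaks only at y,
      -- the straight corner (-0, -1).
      cases (classified (there (there (here refl))) inj (_ ∷ _ ∷ _ ∷ e₃ ∷ e₄ ∷ _)) q₂ q₃ q₄ =
        q₄ (dn-many _ λ { refl → 0≢1+n (trans (sym e₃) e₄) })
      cases (classified (there (there (there (here refl)))) inj (_ ∷ e₁ ∷ e₂ ∷ _)) q₂ q₃ q₄ =
        q₂ (dn-many _ λ { refl → 1+n≢n (trans (sym e₂) e₁) })

-- The case `n = 5` with at least three labels

sameShape : ∀ {t} → Walk (Fin t) 3 → Pattern → Bool
sameShape ((b₀ , a₀) ∷ (b₁ , a₁) ∷ (b₂ , a₂) ∷ []) ((c₀ , x₀) ∷ (c₁ , x₁) ∷ (c₂ , x₂) ∷ _) =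
  same b₀ c₀ ∧ same b₁ c₁ ∧ same b₂ c₂ ∧
  same (does (a₀ Fin.≟ a₁)) (x₀ ≡ᵇ x₁) ∧ same (does (a₀ Fin.≟ a₂)) (x₀ ≡ᵇ x₂) ∧ same (does (a₁ Fin.≟ a₂)) (x₁ ≡ᵇ x₂)
  where
  same : Bool → Bool → Bool
  same b c = not (b xor c)

sameShape-relabel : ∀ {t} (f : Fin t → ℕ) → (∀ {a b} → f a ≡ f b → a ≡ b) → ∀ q (w : Walk ℕ 3) →
  sameShape q (relabelʷ f q Vec.++ w) ≡ true
sameShape-relabel f f-inj ((b₀ , a₀) ∷ (b₁ , a₁) ∷ (b₂ , a₂) ∷ []) w =
  ∧-intro (same-refl b₀) (∧-intro (same-refl b₁) (∧-intro (same-refl b₂)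
    (∧-intro (labels a₀ a₁) (∧-intro (labels a₀ a₂) (labels a₁ a₂)))))
  where
  same-refl : ∀ b → not (b xor b) ≡ true
  same-refl true  = refl
  same-refl false = refl
  labels : ∀ a b → not (does (a Fin.≟ b) xor (f a ≡ᵇ f b)) ≡ true
  labels a b = trans (cong (λ e → not (does (a Fin.≟ b) xor e)) (does-injective Fin._≟_ Data.Nat.Properties._≟_ f f-inj a b)) (same-refl (does (a Fin.≟ b)))

module Five (k‴ m′ : ℕ) (n∣ : 5 ∣ 2 ^ suc m′ ∸ 1) (2<m : 2 < suc m′) where

  open ThreeLabels k‴ m′ 4 n∣ 2<m (m≤m+n 2 3) public

  data Classified₃ (ps : List Pattern) (u : Vertex) (s₀ s₁ s₂ : Step) : (y z : Vertex) → Set where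
    classified₃ : ∀ {s₃ s₄ s₅ p f} → let x = step s₂ (step s₁ (step s₀ u)) in
      p ∈ ps → (∀ {x y} → f x ≡ f y → x ≡ y) → Realizes f (s₀ ∷ s₁ ∷ s₂ ∷ s₃ ∷ s₄ ∷ s₅ ∷ []) p →
      Classified₃ ps u s₀ s₁ s₂ (step s₃ x) (step s₄ (step s₃ x))

  classify₃ : ∀ test → Sound test → ∀ {t} {ls : Vec Label t} → Unique ls → ∀ {q₀ q₁ q₂ ps} →
    Complete test (sameShape (q₀ ∷ q₁ ∷ q₂ ∷ [])) ps → ∀ {u y z} →
    let s₀ = map₂ (lookup ls) q₀ ; s₁ = map₂ (lookup ls) q₁ ; s₂ = map₂ (lookup ls) q₂ in
    Hex u (step s₀ u) (step s₁ (step s₀ u)) (step s₂ (step s₁ (step s₀ u))) y z → Classified₃ ps u s₀ s₁ s₂ y z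
  classify₃ test sound {ls = ls} unique {q₀} {q₁} {q₂} {ps} comp {u} h = from (toTail s₀ s₁ refl refl (hexagonView h)) refl
    where
    s₀ = map₂ (lookup ls) q₀
    s₁ = map₂ (lookup ls) q₁
    s₂ = map₂ (lookup ls) q₂
    from : ∀ {x y z} → Tail u s₀ s₁ x y z → x ≡ step s₂ (step s₁ (step s₀ u)) → Classified₃ ps u s₀ s₁ s₂ y z
    from (tail t₂ s₃ s₄ s₅ c nb) e with step-injective t₂ s₂ _ e
    ... | refl =
      let p , p∈ , f , f-inj , r = classify test sound (sameShape (q₀ ∷ q₁ ∷ q₂ ∷ [])) ps comp u _ c nb
            (λ f f-inj → sameShape-relabel (f ∘ lookup ls) (lookup-injective unique _ _ ∘ f-inj) (q₀ ∷ q₁ ∷ q₂ ∷ []) (relabelʷ f (s₃ ∷ s₄ ∷ s₅ ∷ [])))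
      in classified₃ p∈ f-inj r

  ¬classified₃-[] : ∀ {u s₀ s₁ s₂ y z} → ¬ Classified₃ [] u s₀ s₁ s₂ y z
  ¬classified₃-[] (classified₃ () _ _)

  noTurn-≢ : ∀ (i j : Label) b → noTurn Fin._≟_ (b , i) (not b , j) ≡ true → i ≢ j
  noTurn-≢ i .i true  e refl rewrite dec-true (i Fin.≟ i) refl with () ← e
  noTurn-≢ i .i false e refl rewrite dec-true (i Fin.≟ i) refl with () ← e

  -- The names of the hypotheses spell the three steps. A backward arc continued by -a is refuted
  -- because `R` holds on every (-a, -a, s). One continued by -b with b ≠ a is entered along -c with
  -- a third label c, where `R` fails on (-c, -a, -b).
  five-criterion : (R : Vertex → Vertex → Vertex → Vertex → Set) → Invariant₄ {B} R →
    (∀ u {i j} → i ≢ j → ¬ R u (up i u) (up i (up i u)) (up j (up i (up i u)))) →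
    (∀ u {a b c} → c ≢ a → a ≢ b → c ≢ b → ¬ R u (dn c u) (dn a (dn c u)) (dn b (dn a (dn c u)))) →
    (∀ u i → R u (up i u) (up i (up i u)) (up i (up i (up i u)))) →
    (∀ u {l i} → l ≢ i → R u (up l u) (up i (up l u)) (up i (up i (up l u)))) →
    (∀ u {l i} → l ≢ i → R u (dn l u) (up i (dn l u)) (up i (up i (dn l u)))) →
    (∀ u a → R u (dn a u) (dn a (dn a u)) (dn a (dn a (dn a u)))) →
    (∀ u {a b} → a ≢ b → R u (dn a u) (dn a (dn a u)) (dn b (dn a (dn a u)))) →
    (∀ u {a b} → a ≢ b → R u (dn a u) (dn a (dn a u)) (up b (dn a (dn a u)))) →
    (∀ u {a b} x → a ≢ b → let v = dn a u ; w = up b v in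
      BAdj w x → v ≢ x → ¬ R u v w x → (∀ t → BAdj t u → t ≢ v → R t u v w) → ⊥) →
    ¬ ArcTransitive B
  five-criterion R R-inv +i+i+j -c-a-b +i+i+i +l+i+i -l+i+i -a-a-a -a-a-b -a-a+b valley =
    lopsided-criterion R R-inv 1F (λ ()) +i+i+j first descending valley
    where
    first : ∀ t i s → noTurn Fin._≟_ s (⁺ i) ≡ true → let u = step s t in R t u (up i u) (up i (up i u))
    first t i (true , l) nt with l Fin.≟ i
    ... | yes refl = +i+i+i t i
    ... | no l≢i   = +l+i+i t l≢i
    first t i (false , l) nt = -l+i+i t (noTurn-≢ l i false nt)
    straight : ∀ u a s → noTurn Fin._≟_ (⁻ a) s ≡ true → R u (dn a u) (dn a (dn a u)) (step s (dn a (dn a u)))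
    straight u a (false , b) nt with a Fin.≟ b
    ... | yes refl = -a-a-a u a
    ... | no a≢b   = -a-a-b u a≢b
    straight u a (true , b) nt = -a-a+b u (noTurn-≢ a b false nt)
    descending : ∀ u a b x → let v = dn a u ; w = dn b v in
      BAdj w x → v ≢ x → ¬ R u v w x → (∀ t → BAdj t u → t ≢ v → R t u v w) → ⊥
    descending u a b x wx v≢x ¬r r with a Fin.≟ b
    ... | yes refl = extend (step-adj _ x wx) v≢x ¬r
      where
      extend : ∀ {x} → ∃[ s ] x ≡ step s (dn a (dn a u)) → dn a u ≢ x → ¬ R u (dn a u) (dn a (dn a u)) x → ⊥
      extend (s , refl) v≢x ¬r = ¬r (straight u a s (⇒noTurn (⁻ a) s (dn a u) v≢x))
    ... | no a≢b with third a b
    ...   | c , a≢c , b≢c = -c-a-b (up c u) (a≢c ∘ sym) a≢b (b≢c ∘ sym)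
      (subst (λ z → R (up c u) z (dn a z) (dn b (dn a z))) (sym (dn-up c u))
        (r (up c u) (subst (BAdj (up c u)) (dn-up c u) (adj-step (⁻ c) (up c u))) (up≢dn c a u)))

module _ (k‴ m′ : ℕ) (n∣ : 5 ∣ 2 ^ suc m′ ∸ 1) (6<m : 6 < suc m′) where

  open Five k‴ m′ n∣ (≤-trans (m≤m+n 3 4) 6<m)

  -- As 1 + 4 = 5, weights two levels apart cancel; in +0 +0 +0 -1 -0 -1, for instance, the label
  -- sums are 1 + 2 + 4 - 2 and -(4 + 1). For m > 6 such hexagons complete all the required paths,
  -- while (+i, +i, +j) and (-c, -a, -b) lie in none.
  ¬arcTransitive-5 : ¬ ArcTransitive B
  ¬arcTransitive-5 = five-criterion Comp (λ σ u v w x → completable-map {B} σ)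
    +i+i+j -c-a-b
    (λ u i → let j , i≢j = other i in _ , _ , hex (unique₂ i≢j) (⁺ 0F) (⁺ 0F) (⁺ 0F) (⁻ 1F) (⁻ 0F) (⁻ 1F) refl u)
    (λ u l≢i → _ , _ , hex (unique₂ l≢i) (⁺ 0F) (⁺ 1F) (⁺ 1F) (⁻ 0F) (⁻ 0F) (⁻ 1F) refl u)
    (λ u l≢i → _ , _ , hex (unique₂ l≢i) (⁻ 0F) (⁺ 1F) (⁺ 1F) (⁺ 1F) (⁻ 0F) (⁻ 1F) refl u)
    (λ u a → let b , a≢b = other a in _ , _ , hex (unique₂ a≢b) (⁻ 0F) (⁻ 0F) (⁻ 0F) (⁺ 1F) (⁺ 0F) (⁺ 1F) refl u)
    (λ u a≢b → _ , _ , hex (unique₂ a≢b) (⁻ 0F) (⁻ 0F) (⁻ 1F) (⁺ 0F) (⁺ 1F) (⁺ 1F) refl u)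
    (λ u a≢b → _ , _ , hex (unique₂ a≢b) (⁻ 0F) (⁻ 0F) (⁺ 1F) (⁺ 0F) (⁺ 1F) (⁻ 0F) refl u)
    (λ u x a≢b wx v≢x ¬r _ → extend u a≢b (step-adj _ x wx) v≢x ¬r)
    where
    test : Tests
    test = tests (avoids? levels) (divisible? 5)
    sound : Sound test
    sound = avoids?-sound levels (level-large 6<m) , divisible?-sound 5 ∣-refl
    hex = at (tests zero? (divisible? 5)) (zero?-exact m , divisible?-exact 5 ∣-refl)

    +i+i+j : ∀ u {i j} → i ≢ j → ¬ Comp u (up i u) (up i (up i u)) (up j (up i (up i u)))
    +i+i+j u i≢j (y , z , h) =
      ¬classified₃-[] (classify₃ test sound (unique₂ i≢j) {⁺ 0F} {⁺ 0F} {⁺ 1F} (complete refl) h)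

    -c-a-b : ∀ u {a b c} → c ≢ a → a ≢ b → c ≢ b → ¬ Comp u (dn c u) (dn a (dn c u)) (dn b (dn a (dn c u)))
    -c-a-b u c≢a a≢b c≢b (y , z , h) =
      ¬classified₃-[] (classify₃ test sound (unique₃ c≢a c≢b a≢b) {⁻ 0F} {⁻ 1F} {⁻ 2F} (complete refl) h)

    extend : ∀ u {a b x} → a ≢ b → ∃[ s ] x ≡ step s (up b (dn a u)) → dn a u ≢ x → ¬ Comp u (dn a u) (up b (dn a u)) x → ⊥
    extend u {a} {b} a≢b ((true , c) , refl) v≢x ¬r with a Fin.≟ c | b Fin.≟ c
    ... | yes refl | _        = ¬r (_ , _ , hex (unique₂ a≢b) (⁻ 0F) (⁺ 1F) (⁺ 0F) (⁺ 0F) (⁻ 1F) (⁻ 1F) refl u)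
    ... | no _     | yes refl = ¬r (_ , _ , hex (unique₂ a≢b) (⁻ 0F) (⁺ 1F) (⁺ 1F) (⁺ 1F) (⁻ 0F) (⁻ 1F) refl u)
    ... | no a≢c   | no b≢c   = ¬r (_ , _ , hex (unique₃ a≢b a≢c b≢c) (⁻ 0F) (⁺ 1F) (⁺ 2F) (⁺ 1F) (⁻ 0F) (⁻ 2F) refl u)
    extend u {a} {b} a≢b ((false , c) , refl) v≢x ¬r with a Fin.≟ c
    ... | yes refl = ¬r (_ , _ , hex (unique₂ a≢b) (⁻ 0F) (⁺ 1F) (⁻ 0F) (⁺ 1F) (⁺ 0F) (⁻ 1F) refl u)
    ... | no a≢c   = ¬r (_ , _ , hex (unique₃ a≢b a≢c b≢c) (⁻ 0F) (⁺ 1F) (⁻ 2F) (⁺ 0F) (⁻ 1F) (⁺ 2F) refl u)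
      where
      b≢c : b ≢ c
      b≢c = noTurn-≢ b c true (⇒noTurn (⁺ b) (⁻ c) (dn a u) v≢x)

module _ (k‴ : ℕ) (n∣ : 5 ∣ 2 ^ 4 ∸ 1) where

  open Five k‴ 3 n∣ (m≤m+n 3 1)

  -- For m = 4 a level change of 4 closes up, so (+i, +i, +j) does lie in a hexagon, +i +i +j +j -i
  -- +j. It has only one fourth step, however, so `R` asks for two.
  Two : Vertex → Vertex → Vertex → Vertex → Set
  Two u v w x = MoreThan {B} 1 (λ y → ∃[ z ] Hex u v w x y z)

  two : ∀ {u v w x z z′} s t → s ≢ t → Hex u v w x (step s x) z → Hex u v w x (step t x) z′ → Two u v w x
  two {x = x} s t s≢t h h′ =
    (λ c → step (lookup es c) x) ,
    (λ {c} {d} e → lookup-injective ((s≢t ∷ []) ∷ [] ∷ []) c d (step-injective (lookup es c) (lookup es d) x e)) ,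
    λ { 0F → _ , h ; 1F → _ , h′ }
    where es = s ∷ t ∷ []

  ¬two : ∀ {u v w x} y₀ → (∀ y z → Hex u v w x y z → y ≡ y₀) → ¬ Two u v w x
  ¬two y₀ h (f , f-inj , g) with () ← f-inj {0F} {1F} (trans (h _ _ (proj₂ (g 0F))) (sym (h _ _ (proj₂ (g 1F)))))

  ¬arcTransitive-4-5 : ¬ ArcTransitive B
  ¬arcTransitive-4-5 = five-criterion Two Two-map
    +i+i+j -c-a-b +i+i+i
    (λ u {l} {i} l≢i → two (⁻ l) (⁺ l) (λ ())
      (hex (unique₂ l≢i) (⁺ 0F) (⁺ 1F) (⁺ 1F) (⁻ 0F) (⁻ 0F) (⁻ 1F) refl u)
      (hex (unique₂ l≢i) (⁺ 0F) (⁺ 1F) (⁺ 1F) (⁺ 0F) (⁺ 0F) (⁻ 1F) refl u))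
    (λ u {l} {i} l≢i → two (⁺ i) (⁻ l) (λ ())
      (hex (unique₂ l≢i) (⁻ 0F) (⁺ 1F) (⁺ 1F) (⁺ 1F) (⁻ 0F) (⁻ 1F) refl u)
      (hex (unique₂ l≢i) (⁻ 0F) (⁺ 1F) (⁺ 1F) (⁻ 0F) (⁺ 1F) (⁻ 0F) refl u))
    -a-a-a
    (λ u {a} {b} a≢b → two (⁺ a) (⁻ b) (λ ())
      (hex (unique₂ a≢b) (⁻ 0F) (⁻ 0F) (⁻ 1F) (⁺ 0F) (⁺ 1F) (⁺ 1F) refl u)
      (hex (unique₂ a≢b) (⁻ 0F) (⁻ 0F) (⁻ 1F) (⁻ 1F) (⁻ 0F) (⁺ 1F) refl u))
    (λ u {a} {b} a≢b → two (⁺ a) (⁺ b) (⁺-≢ a≢b)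
      (hex (unique₂ a≢b) (⁻ 0F) (⁻ 0F) (⁺ 1F) (⁺ 0F) (⁺ 1F) (⁻ 0F) refl u)
      (hex (unique₂ a≢b) (⁻ 0F) (⁻ 0F) (⁺ 1F) (⁺ 1F) (⁻ 0F) (⁺ 1F) refl u))
    -a+b
    where
    test : Tests
    test = tests (divisible? 4) (divisible? 5)
    sound : Sound test
    sound = divisible?-sound 4 ∣-refl , divisible?-sound 5 ∣-refl
    hex = at test (divisible?-exact 4 ∣-refl , divisible?-exact 5 ∣-refl)

    Two-map : Invariant₄ {B} Two
    Two-map σ u v w x (f , f-inj , g) =
      app {B} σ ∘ f , f-inj ∘ app-injective {B} σ , λ c → app {B} σ (proj₁ (g c)) , hexagon-map {B} σ (proj₂ (g c))

    +i+i+j : ∀ u {i j} → i ≢ j → ¬ Two u (up i u) (up i (up i u)) (up j (up i (up i u)))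
    +i+i+j u {i} {j} i≢j = ¬two (up j (up j (up i (up i u))))
      λ y z h → unique (classify₃ test sound (unique₂ i≢j) {⁺ 0F} {⁺ 0F} {⁺ 1F} (complete refl) h)
      where
      unique : ∀ {y z} → Classified₃ ((⁺ 0 ∷ ⁺ 0 ∷ ⁺ 1 ∷ ⁺ 1 ∷ ⁻ 0 ∷ ⁺ 1 ∷ []) ∷ []) u (⁺ i) (⁺ i) (⁺ j) y z → y ≡ up j (up j (up i (up i u)))
      unique (classified₃ (here refl) inj (_ ∷ _ ∷ e₂ ∷ e₃ ∷ _)) = cong (λ l → up l (up j (up i (up i u)))) (inj (trans e₃ (sym e₂)))

    -c-a-b : ∀ u {a b c} → c ≢ a → a ≢ b → c ≢ b → ¬ Two u (dn c u) (dn a (dn c u)) (dn b (dn a (dn c u)))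
    -c-a-b u c≢a a≢b c≢b (f , _ , g) =
      ¬classified₃-[] (classify₃ test sound (unique₃ c≢a c≢b a≢b) {⁻ 0F} {⁻ 1F} {⁻ 2F} (complete refl) (proj₂ (g 0F)))

    -- The single hexagon is +c -a +b -c +a -b. This refutes a backward arc -a continued by +b:
    -- entering it along +c, with a third label c, leaves only one fourth step.
    +c-a+b : ∀ u {a b c} → c ≢ a → a ≢ b → c ≢ b → ¬ Two u (up c u) (dn a (up c u)) (up b (dn a (up c u)))
    +c-a+b u {a} {b} {c} c≢a a≢b c≢b = ¬two (dn c (up b (dn a (up c u))))
      λ y z h → unique (classify₃ test sound (unique₃ c≢a c≢b a≢b) {⁺ 0F} {⁻ 1F} {⁺ 2F} (complete refl) h)
      where
      unique : ∀ {y z} → Classified₃ ((⁺ 0 ∷ ⁻ 1 ∷ ⁺ 2 ∷ ⁻ 0 ∷ ⁺ 1 ∷ ⁻ 2 ∷ []) ∷ []) u (⁺ c) (⁻ a) (⁺ b) y z → y ≡ dn c (up b (dn a (up c u)))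
      unique (classified₃ (here refl) inj (e₀ ∷ _ ∷ _ ∷ e₃ ∷ _)) = cong (λ l → dn l (up b (dn a (up c u)))) (inj (trans e₃ (sym e₀)))

    +i+i+i : ∀ u i → Two u (up i u) (up i (up i u)) (up i (up i (up i u)))
    +i+i+i u i with other i
    ... | j , i≢j with third i j
    ...   | l , i≢l , j≢l = two (⁻ j) (⁻ l) (⁻-≢ j≢l)
      (hex (unique₂ i≢j) (⁺ 0F) (⁺ 0F) (⁺ 0F) (⁻ 1F) (⁻ 0F) (⁻ 1F) refl u)
      (hex (unique₂ i≢l) (⁺ 0F) (⁺ 0F) (⁺ 0F) (⁻ 1F) (⁻ 0F) (⁻ 1F) refl u)

    -a-a-a : ∀ u a → Two u (dn a u) (dn a (dn a u)) (dn a (dn a (dn a u)))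
    -a-a-a u a with other a
    ... | b , a≢b with third a b
    ...   | c , a≢c , b≢c = two (⁺ b) (⁺ c) (⁺-≢ b≢c)
      (hex (unique₂ a≢b) (⁻ 0F) (⁻ 0F) (⁻ 0F) (⁺ 1F) (⁺ 0F) (⁺ 1F) refl u)
      (hex (unique₂ a≢c) (⁻ 0F) (⁻ 0F) (⁻ 0F) (⁺ 1F) (⁺ 0F) (⁺ 1F) refl u)

    -a+b : ∀ u {a b} x → a ≢ b → let v = dn a u ; w = up b v in
      BAdj w x → v ≢ x → ¬ Two u v w x → (∀ t → BAdj t u → t ≢ v → Two t u v w) → ⊥
    -a+b u {a} {b} x a≢b _ _ _ r with third a b
    ... | c , a≢c , b≢c = +c-a+b (dn c u) (a≢c ∘ sym) a≢b (b≢c ∘ sym)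
      (subst (λ z → Two (dn c u) z (dn a z) (up b (dn a z))) (sym (up-dn c u))
        (r (dn c u) (subst (BAdj (dn c u)) (up-dn c u) (adj-step (⁺ c) (dn c u)))
          (λ e → a≢c (cong proj₂ (step-injective (⁻ a) (⁻ c) u (sym e))))))

-- The case distinction and the theorem

Exceptional : ℕ → ℕ → ℕ → Set
Exceptional k m n = n ≡ 3 ⊎ (k ≡ 2 × n ≡ 5) ⊎ (k ≡ 2 × m ≡ 3 × n ≡ 7)
  ⊎ (k ≡ 2 × m ≡ 6 × n ≡ 7) ⊎ (k ≡ 2 × m ≡ 6 × n ≡ 21)

exceptional? : ∀ k m n → Dec (Exceptional k m n)
exceptional? k m n = (n ≟ 3) ⊎-dec (((k ≟ 2) ×-dec (n ≟ 5)) ⊎-dec (((k ≟ 2) ×-dec ((m ≟ 3) ×-dec (n ≟ 7)))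
  ⊎-dec (((k ≟ 2) ×-dec ((m ≟ 6) ×-dec (n ≟ 7))) ⊎-dec ((k ≟ 2) ×-dec ((m ≟ 6) ×-dec (n ≟ 21))))))

exceptional⇒arcTransitive : ∀ k m n → 1 < k → 1 < m → n ∣ 2 ^ m ∸ 1 → Exceptional k m n → ArcTransitive (Bouwer k m n)
exceptional⇒arcTransitive (suc k′) (suc m′) n _ _ n∣ (inj₁ refl) = arcTransitive-3 k′ m′ n∣
exceptional⇒arcTransitive k (suc m′) n _ _ n∣ (inj₂ (inj₁ (refl , refl))) = arcTransitive-2-5 m′ n∣
exceptional⇒arcTransitive k m n _ _ n∣ (inj₂ (inj₂ (inj₁ (refl , refl , refl)))) = arcTransitive-2-3-7
exceptional⇒arcTransitive k m n _ _ n∣ (inj₂ (inj₂ (inj₂ (inj₁ (refl , refl , refl))))) = arcTransitive-2-6-7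
exceptional⇒arcTransitive k m n _ _ n∣ (inj₂ (inj₂ (inj₂ (inj₂ (refl , refl , refl))))) = arcTransitive-2-6-21

divisors : ∀ N .⦃ _ : NonZero N ⦄ ds →
  {True (All.all? (λ d → (d ∣? N) →-dec ((1 <? d) →-dec (DecMembership._∈?_ _≟_ d ds))) (upTo (suc N)))} →
  ∀ {d} → d ∣ N → 1 < d → d ∈ ds
divisors N ds {check} d∣N = All.lookup (toWitness check) (∈-upTo⁺ (s≤s (∣⇒≤ d∣N))) d∣N

2∤2^m∸1 : ∀ m′ → ¬ 2 ∣ 2 ^ suc m′ ∸ 1
2∤2^m∸1 m′ 2∣ with s≤s () ← ∣⇒≤ (∣m+n∣m⇒∣n (subst (2 ∣_) (sym (m∸n+n≡m (m^n>0 2 (suc m′)))) (m∣m*n (2 ^ m′))) 2∣)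

-- Even n cannot divide 2ᵐ - 1, and n = 3 is exceptional. Every n > 7 exceeds the odd part of each
-- relevant label sum, which leaves 5 and 7 for separate treatment.
¬exceptional⇒¬arcTransitive-6<m : ∀ k″ m′ n → 6 < suc m′ → 1 < n → n ∣ 2 ^ suc m′ ∸ 1 →
  ¬ Exceptional (2 + k″) (suc m′) n → ¬ ArcTransitive (Bouwer (2 + k″) (suc m′) n)
¬exceptional⇒¬arcTransitive-6<m k″ m′ 1 6<m (s≤s ()) n∣ ¬E
¬exceptional⇒¬arcTransitive-6<m k″ m′ 2 6<m 1<n n∣ ¬E = ⊥-elim (2∤2^m∸1 m′ n∣)
¬exceptional⇒¬arcTransitive-6<m k″ m′ 3 6<m 1<n n∣ ¬E = ⊥-elim (¬E (inj₁ refl))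
¬exceptional⇒¬arcTransitive-6<m k″ m′ 4 6<m 1<n n∣ ¬E = ⊥-elim (2∤2^m∸1 m′ (∣-trans (divides 2 refl) n∣))
¬exceptional⇒¬arcTransitive-6<m zero    m′ 5 6<m 1<n n∣ ¬E = ⊥-elim (¬E (inj₂ (inj₁ (refl , refl))))
¬exceptional⇒¬arcTransitive-6<m (suc k‴) m′ 5 6<m 1<n n∣ ¬E = ¬arcTransitive-5 k‴ m′ n∣ 6<m
¬exceptional⇒¬arcTransitive-6<m k″ m′ 6 6<m 1<n n∣ ¬E = ⊥-elim (2∤2^m∸1 m′ (∣-trans (divides 3 refl) n∣))
¬exceptional⇒¬arcTransitive-6<m k″ m′ 7 6<m 1<n n∣ ¬E = ¬arcTransitive-7 k″ m′ n∣ 6<m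
¬exceptional⇒¬arcTransitive-6<m k″ m′ n@(suc n′@(suc (suc (suc (suc (suc (suc (suc n‴)))))))) 6<m 1<n n∣ ¬E =
  GenericCase.¬arcTransitive-large k″ m′ n′ n∣ (≤-trans (m≤m+n 3 4) 6<m) 1<n (inj₁ 6<m) (m≤m+n 8 n‴)

-- For m ≤ 6, n is a divisor of 3, 7, 15, 31 or 63, so only k varies. The case m = 5 with n = 31 is
-- covered by the argument for large m.
¬exceptional⇒¬arcTransitive : ∀ k m n → 1 < k → 1 < m → 1 < n → n ∣ 2 ^ m ∸ 1 →
  ¬ Exceptional k m n → ¬ ArcTransitive (Bouwer k m n)
¬exceptional⇒¬arcTransitive _ 2 n (s≤s (s≤s z≤n)) _ 1<n n∣ ¬E with divisors 3 (3 ∷ []) n∣ 1<n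
... | here refl = ⊥-elim (¬E (inj₁ refl))
¬exceptional⇒¬arcTransitive (suc (suc k″)) 3 n _ _ 1<n n∣ ¬E with divisors 7 (7 ∷ []) n∣ 1<n | k″
... | here refl | zero   = ⊥-elim (¬E (inj₂ (inj₂ (inj₁ (refl , refl , refl)))))
... | here refl | suc k‴ = ¬arcTransitive-3∣m∣6-7 k‴ 2 n∣ (m≤m+n 3 0) ∣-refl (divides 2 refl)
¬exceptional⇒¬arcTransitive (suc (suc k″)) 4 n _ _ 1<n n∣ ¬E with divisors 15 (3 ∷ 5 ∷ 15 ∷ []) n∣ 1<n | k″
... | here refl                 | _      = ⊥-elim (¬E (inj₁ refl))
... | there (here refl)         | zero   = ⊥-elim (¬E (inj₂ (inj₁ (refl , refl))))
... | there (here refl)         | suc k‴ = ¬arcTransitive-4-5 k‴ n∣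
... | there (there (here refl)) | k″     = ¬arcTransitive-4-15 k″ n∣
¬exceptional⇒¬arcTransitive (suc (suc k″)) 5 n _ _ 1<n n∣ ¬E with divisors 31 (31 ∷ []) n∣ 1<n
... | here refl = GenericCase.¬arcTransitive-large k″ 4 30 n∣ (m≤m+n 3 2) 1<n (inj₂ refl) (m≤m+n 8 23)
¬exceptional⇒¬arcTransitive (suc (suc k″)) 6 n _ _ 1<n n∣ ¬E with divisors 63 (3 ∷ 7 ∷ 9 ∷ 21 ∷ 63 ∷ []) n∣ 1<n | k″
... | here refl                                 | _      = ⊥-elim (¬E (inj₁ refl))
... | there (here refl)                         | zero   = ⊥-elim (¬E (inj₂ (inj₂ (inj₂ (inj₁ (refl , refl , refl))))))
... | there (here refl)                         | suc k‴ = ¬arcTransitive-3∣m∣6-7 k‴ 5 n∣ (m≤m+n 3 3) (divides 2 refl) ∣-refl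
... | there (there (here refl))                 | k″     = ¬arcTransitive-6-9 k″ n∣
... | there (there (there (here refl)))         | zero   = ⊥-elim (¬E (inj₂ (inj₂ (inj₂ (inj₂ (refl , refl , refl))))))
... | there (there (there (here refl)))         | suc k‴ = ¬arcTransitive-6-21 k‴ n∣
... | there (there (there (there (here refl)))) | k″     = ¬arcTransitive-6-63 k″ n∣
¬exceptional⇒¬arcTransitive (suc (suc k″)) (suc (suc (suc (suc (suc (suc (suc m‴))))))) n _ _ 1<n n∣ ¬E =
  ¬exceptional⇒¬arcTransitive-6<m k″ (6 + m‴) n (m≤m+n 7 m‴) 1<n n∣ ¬E
¬exceptional⇒¬arcTransitive zero    _ _ () _ _ _
¬exceptional⇒¬arcTransitive (suc _) zero _ _ () _ _
¬exceptional⇒¬arcTransitive (suc _) (suc zero) _ _ (s≤s ()) _ _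
¬exceptional⇒¬arcTransitive (suc zero) _ _ (s≤s ()) _ _ _

halfArcTransitive : ∀ k m n → 1 < k → 1 < m → 1 < n → n ∣ 2 ^ m ∸ 1 → ¬ Exceptional k m n → HalfArcTransitive (Bouwer k m n)
halfArcTransitive k@(suc k′) m@(suc m′) n@(suc n′) 1<k 1<m 1<n n∣ ¬E =
  Model.vertexTransitive k′ m′ n′ n∣ , Model.edgeTransitive k′ m′ n′ n∣ , ¬exceptional⇒¬arcTransitive k m n 1<k 1<m 1<n n∣ ¬E

theorem1p1 : (k m n : ℕ) → 1 < k → 1 < m → 1 < n → n ∣ 2 ^ m ∸ 1 →
    (ArcTransitive (Bouwer k m n) ⇔
    (n ≡ 3 ⊎ (k ≡ 2 × n ≡ 5) ⊎ (k ≡ 2 × m ≡ 3 × n ≡ 7)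
    ⊎ (k ≡ 2 × m ≡ 6 × n ≡ 7) ⊎ (k ≡ 2 × m ≡ 6 × n ≡ 21)))
    × (¬ (n ≡ 3 ⊎ (k ≡ 2 × n ≡ 5) ⊎ (k ≡ 2 × m ≡ 3 × n ≡ 7)
    ⊎ (k ≡ 2 × m ≡ 6 × n ≡ 7) ⊎ (k ≡ 2 × m ≡ 6 × n ≡ 21))
    → HalfArcTransitive (Bouwer k m n))
    × (m > 6 → n > 5 → HalfArcTransitive (Bouwer k m n))
theorem1p1 k m n 1<k 1<m 1<n n∣ =
  mk⇔ only-if (exceptional⇒arcTransitive k m n 1<k 1<m n∣) ,
  halfArcTransitive k m n 1<k 1<m 1<n n∣ ,
  λ m>6 n>5 → halfArcTransitive k m n 1<k 1<m 1<n n∣ (unexceptional m>6 n>5)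
  where
  only-if : ArcTransitive (Bouwer k m n) → Exceptional k m n
  only-if at with exceptional? k m n
  ... | yes E = E
  ... | no ¬E = ⊥-elim (¬exceptional⇒¬arcTransitive k m n 1<k 1<m 1<n n∣ ¬E at)
  unexceptional : m > 6 → n > 5 → ¬ Exceptional k m n
  unexceptional m>6 n>5 (inj₁ refl)                                         = <⇒≱ n>5 (m≤m+n 3 2)
  unexceptional m>6 n>5 (inj₂ (inj₁ (_ , refl)))                            = <⇒≱ n>5 ≤-refl
  unexceptional m>6 n>5 (inj₂ (inj₂ (inj₁ (_ , refl , _))))                 = <⇒≱ m>6 (m≤m+n 3 3)
  unexceptional m>6 n>5 (inj₂ (inj₂ (inj₂ (inj₁ (_ , refl , _)))))          = <⇒≱ m>6 ≤-refl
  unexceptional m>6 n>5 (inj₂ (inj₂ (inj₂ (inj₂ (_ , refl , _)))))          = <⇒≱ m>6 ≤-refl
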